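{- For $n\ge1$ let $P_{n}^{(\mathrm{lpk},\mathrm{ilpk})}(s,t)=\sum_{\pi\in\mathfrak{S}_{n}}s^{\mathrm{lpk}(\pi)}t^{\mathrm{ilpk}(\pi)}$. Then: (a) As formal power series, \[ \frac{1}{(1-s)(1-t)}+\sum_{n=1}^{\infty}\frac{((1+s)(1+t))^{n}}{((1-s)(1-t))^{n+1}}P_{n}^{(\mathrm{lpk},\mathrm{ilpk})}\left(\frac{4s}{(1+s)^{2}},\frac{4t}{(1+t)^{2}}\right)x^{n} =\sum_{i,j=0}^{\infty}\frac{(1+x)^{2ij+i+j}}{(1-x)^{2ij+i+j+1}}s^{i}t^{j}. \] (b) For all $n\geq1$, \[ \frac{((1+s)(1+t))^{n}}{((1-s)(1-t))^{n+1}}P_{n}^{(\mathrm{lpk},\mathrm{ilpk})}\left(\frac{4s}{(1+s)^{2}},\frac{4t}{(1+t)^{2}}\right) =\sum_{i,j=0}^{\infty}\sum_{k=0}^{n}\binom{2ij+i+j}{k}\binom{2ij+i+j+n-k}{n-k}s^{i}t^{j}. \] (c) For all $n\geq1$, \[ \frac{((1+s)(1+t))^{n}}{((1-s)(1-t))^{n+1}}P_{n}^{(\mathrm{lpk},\mathrm{ilpk})}\left(\frac{4s}{(1+s)^{2}},\frac{4t}{(1+t)^{2}}\right) =\frac{1}{n!}\sum_{k=0}^n e(n,k) \frac{B_{k}(s)B_{k}(t)}{(1-s)^{k+1}(1-t)^{k+1}}. \]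
   Context: $\mathfrak{S}_n$ is the symmetric group on $[n]$. For $\pi\in\mathfrak{S}_n$, $i$ with $2\le i\le n-1$ is a peak if $\pi(i-1)<\pi(i)>\pi(i+1)$; $i\in[n-1]$ is a left peak if $i$ is a peak, or if $i=1$ and $\pi(1)>\pi(2)$; $\mathrm{lpk}(\pi)$ is the number of left peaks and $\mathrm{ilpk}(\pi)=\mathrm{lpk}(\pi^{ -1})$. The type B Eulerian polynomials $B_n(t)$ are defined by $\frac{B_{n}(t)}{(1-t)^{n+1}}=\sum_{k=0}^{\infty}(2k+1)^{n}t^{k}$ (so $B_0=1$). $e(n,k)$ is the number of permutations in $\mathfrak{S}_n$ with exactly $k$ cycles of odd length (and any number of cycles of even length). -}

module Defs where

open import Data.Bool using (Bool; true; false; _∧_; _∨_; not; if_then_else_)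
open import Data.Nat as ℕ using (ℕ; zero; suc; _∸_; _<ᵇ_; _≡ᵇ_; _≤ᵇ_; _!)
open import Data.Nat.Combinatorics using (_C_)
open import Data.Nat.Properties using (_!≢0)
open import Data.Fin as Fin using (Fin; toℕ)
open import Data.Fin.Properties using (any?)
open import Data.Vec as Vec using (Vec; []; _∷_; lookup; tabulate)
open import Data.List as List using (List; []; _∷_; map; concatMap; filter; length; upTo; allFin; foldr)
open import Data.Product using (_,_)
open import Relation.Nullary using (yes; no)
open import Relation.Binary.PropositionalEquality using (_≡_)
open import Data.Integer using (+_)
open import Data.Rational as ℚ using (ℚ; 0ℚ; 1ℚ; _/_)

all : ∀ {A : Set} → (A → Bool) → List A → Bool
all p = foldr (λ x b → p x ∧ b) true

sumℕ : List ℕ → ℕ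
sumℕ = foldr ℕ._+_ 0

-- Permutations of [n], represented by their one-line notation
-- π = (π(1),…,π(n)) as a vector over Fin n (value v : Fin n stands for v+1).

allWords : (n m : ℕ) → List (Vec (Fin n) m)
allWords n zero    = Vec.[] ∷ []
allWords n (suc m) = concatMap (λ w → map (λ a → a Vec.∷ w) (allFin n)) (allWords n m)

isInjective : ∀ {n} → Vec (Fin n) n → Bool
isInjective {n} w =
  all (λ i → all (λ j → not (toℕ (lookup w i) ≡ᵇ toℕ (lookup w j)) ∨ (toℕ i ≡ᵇ toℕ j))
                 (allFin n))
      (allFin n)

Sym : (n : ℕ) → List (Vec (Fin n) n)
Sym n = filter (λ w → isInjective w Data.Bool.≟ true) (allWords n n)
  where import Data.Bool

inverse : ∀ {n} → Vec (Fin n) n → Vec (Fin n) n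
inverse {n} w = tabulate search
  where
  search : Fin n → Fin n
  search j with any? (λ i → lookup w i Fin.≟ j)
  ... | yes (i , _) = i
  ... | no _        = j

-- π(i) for 1 ≤ i ≤ n as a natural number in [1,n] (0 outside the range)
val : ∀ {n} → Vec (Fin n) n → ℕ → ℕ
val w i = nth (Vec.toList w) i
  where
  nth : ∀ {n} → List (Fin n) → ℕ → ℕ
  nth []       _             = 0
  nth (x ∷ xs) zero          = 0
  nth (x ∷ xs) (suc zero)    = suc (toℕ x)
  nth (x ∷ xs) (suc (suc k)) = nth xs (suc k)

isLeftPeak : ∀ {n} → Vec (Fin n) n → ℕ → Bool
isLeftPeak {n} w i =
     ((i ≡ᵇ 1) ∧ (val w 2 <ᵇ val w 1))
  ∨  ((2 ≤ᵇ i) ∧ (i ≤ᵇ n ∸ 1) ∧ (val w (i ∸ 1) <ᵇ val w i) ∧ (val w (suc i) <ᵇ val w i))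

lpk : ∀ {n} → Vec (Fin n) n → ℕ
lpk {n} w = length (List.filter (λ i → isLeftPeak w i Data.Bool.≟ true) (map suc (upTo (n ∸ 1))))
  where import Data.Bool

ilpk : ∀ {n} → Vec (Fin n) n → ℕ
ilpk w = lpk (inverse w)

iter : ∀ {n} → Vec (Fin n) n → ℕ → Fin n → Fin n
iter w zero    i = i
iter w (suc m) i = lookup w (iter w m i)

cycleLength : ∀ {n} → Vec (Fin n) n → Fin n → ℕ
cycleLength {n} w i = first (map suc (upTo n))
  where
  first : List ℕ → ℕ
  first []       = 0
  first (m ∷ ms) = if toℕ (iter w m i) ≡ᵇ toℕ i then m else first ms

isCycleMin : ∀ {n} → Vec (Fin n) n → Fin n → Bool
isCycleMin {n} w i = all (λ m → toℕ i ≤ᵇ toℕ (iter w m i)) (upTo n)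

oddCycles : ∀ {n} → Vec (Fin n) n → ℕ
oddCycles {n} w =
  length (List.filter (λ i → (isCycleMin w i ∧ not (Parity.even? (cycleLength w i))) Data.Bool.≟ true) (allFin n))
  where
  import Data.Bool
  module Parity where
    even? : ℕ → Bool
    even? zero          = true
    even? (suc zero)    = false
    even? (suc (suc k)) = even? k

e : ℕ → ℕ → ℕ
e n k = length (List.filter (λ w → oddCycles w ℕ.≟ k) (Sym n))

fromℕ : ℕ → ℚ
fromℕ n = (+ n) / 1

sumℚ : List ℚ → ℚ
sumℚ = foldr ℚ._+_ 0ℚ

Σ[≤_] : ℕ → (ℕ → ℚ) → ℚ
Σ[≤ n ] f = sumℚ (map f (upTo (suc n)))

-- one variable: coefficient sequences
PS1 : Set
PS1 = ℕ → ℚ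

-- two variables (s,t): coefficient of s^i t^j
PS2 : Set
PS2 = ℕ → ℕ → ℚ

module P1 where
  const : ℚ → PS1
  const c zero    = c
  const c (suc _) = 0ℚ

  var : PS1
  var (suc zero) = 1ℚ
  var _          = 0ℚ

  _+_ : PS1 → PS1 → PS1
  (f + g) i = f i ℚ.+ g i

  _-_ : PS1 → PS1 → PS1
  (f - g) i = f i ℚ.- g i

  _*_ : PS1 → PS1 → PS1
  (f * g) n = Σ[≤ n ] (λ a → f a ℚ.* g (n ∸ a))

  _^_ : PS1 → ℕ → PS1
  f ^ zero  = const 1ℚ
  f ^ suc k = f * (f ^ k)

  -- multiplicative inverse of a series with constant term 1:
  -- f⁻¹ = Σ_k (1 - f)^k  (only k ≤ n contributes to the coefficient of x^n)
  inv : PS1 → PS1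
  inv f n = Σ[≤ n ] (λ k → ((const 1ℚ - f) ^ k) n)

module P2 where
  const : ℚ → PS2
  const c zero    zero    = c
  const c _       _       = 0ℚ

  s : PS2
  s (suc zero) zero = 1ℚ
  s _          _    = 0ℚ

  t : PS2
  t zero (suc zero) = 1ℚ
  t _    _          = 0ℚ

  inS : PS1 → PS2
  inS f i zero    = f i
  inS f i (suc _) = 0ℚ

  inT : PS1 → PS2
  inT f zero    j = f j
  inT f (suc _) j = 0ℚ

  _+_ : PS2 → PS2 → PS2
  (f + g) i j = f i j ℚ.+ g i j

  _-_ : PS2 → PS2 → PS2
  (f - g) i j = f i j ℚ.- g i j

  scale : ℚ → PS2 → PS2
  scale c f i j = c ℚ.* f i j

  _*_ : PS2 → PS2 → PS2
  (f * g) i j = Σ[≤ i ] (λ a → Σ[≤ j ] (λ b → f a b ℚ.* g (i ∸ a) (j ∸ b)))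

  _^_ : PS2 → ℕ → PS2
  f ^ zero  = const 1ℚ
  f ^ suc k = f * (f ^ k)

  -- multiplicative inverse of a series with constant term 1:
  -- f⁻¹ = Σ_k (1 - f)^k  (only k ≤ i+j contributes to the coefficient of s^i t^j)
  inv : PS2 → PS2
  inv f i j = Σ[≤ i ℕ.+ j ] (λ k → ((const 1ℚ - f) ^ k) i j)

  sum : List PS2 → PS2
  sum = foldr _+_ (const 0ℚ)

Plpk : (n : ℕ) → PS2 → PS2 → PS2
Plpk n S T = P2.sum (map (λ w → (S P2.^ lpk w) P2.* (T P2.^ ilpk w)) (Sym n))

S₄ : PS2
S₄ = P2.scale (fromℕ 4) P2.s P2.* P2.inv ((P2.const 1ℚ P2.+ P2.s) P2.^ 2)

T₄ : PS2
T₄ = P2.scale (fromℕ 4) P2.t P2.* P2.inv ((P2.const 1ℚ P2.+ P2.t) P2.^ 2)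

LHS : ℕ → PS2
LHS n = (((P2.const 1ℚ P2.+ P2.s) P2.* (P2.const 1ℚ P2.+ P2.t)) P2.^ n)
        P2.* (P2.inv (((P2.const 1ℚ P2.- P2.s) P2.* (P2.const 1ℚ P2.- P2.t)) P2.^ suc n)
        P2.* Plpk n S₄ T₄)

-- type B Eulerian polynomial: B_n(t) = (1-t)^{n+1} Σ_k (2k+1)^n t^k
B : ℕ → PS1
B n = ((P1.const 1ℚ P1.- P1.var) P1.^ suc n) P1.* (λ k → fromℕ ((2 ℕ.* k ℕ.+ 1) ℕ.^ n))

RHSaCoeff : ℕ → ℕ → ℚ
RHSaCoeff m n = (((P1.const 1ℚ P1.+ P1.var) P1.^ m) P1.* P1.inv ((P1.const 1ℚ P1.- P1.var) P1.^ suc m)) n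

μ : ℕ → ℕ → ℕ
μ i j = 2 ℕ.* i ℕ.* j ℕ.+ i ℕ.+ j

RHSb : ℕ → PS2
RHSb n i j = fromℕ (sumℕ (map (λ k → (μ i j C k) ℕ.* ((μ i j ℕ.+ (n ∸ k)) C (n ∸ k))) (upTo (suc n))))

RHSc : ℕ → PS2
RHSc n = P2.scale ((+ 1 / (n !)) ⦃ n !≢0 ⦄)
  (P2.sum (map (λ k → P2.scale (fromℕ (e n k))
                 ((P2.inS (B k) P2.* P2.inT (B k))
                  P2.* P2.inv (((P2.const 1ℚ P2.- P2.s) P2.^ suc k) P2.* ((P2.const 1ℚ P2.- P2.t) P2.^ suc k))))
               (upTo (suc n))))

{-# OPTIONS --safe #-}

-- Both sides of every identity are Delannoy numbers D(μ, n), where 2μ + 1 = (2i + 1)(2j + 1).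
--
-- Read a permutation π as the word of its ascents and descents.  The coefficient of sⁱ in
-- (1+s)ⁿ/(1-s)ⁿ⁺¹ · (4s/(1+s)²)^lpk(π) counts the weakly increasing words of length n in the letters 0, …, 2i in which
-- an even letter repeats only along an ascent of π and an odd letter only along a descent.  By standardization, summing
-- over π the product of this count for π and the count (with j) for π⁻¹ counts pairs of words in the letters
-- 0, …, 2i and 0, …, 2j; ordering the pairs of letters boustrophedonically turns them into weakly increasing words in
-- the letters 0, …, 2μ in which only even letters repeat.  There are D(μ, n) of those.
--
-- For (c), E(n) = Σ_π (2μ+1)^(number of odd cycles of π) satisfies E(n+1) = (2μ+1) E(n) + n² E(n-1): either 1 is a fixed
-- point, or removing π(1) from its cycle changes the parity of the cycle of 1 and no other cycle, and removing the next
-- successor of 1 (or 1 itself) restores it.  The numbers n! D(μ, n) satisfy the same recurrence.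

module Submission where

open import Defs
open import Algebra.Bundles using (CommutativeRing)
open import Data.Bool as Bool using (Bool; true; false; _∧_; _∨_; not; if_then_else_)
open import Data.Bool.Properties using (T-≡; ∨-identityʳ)
open import Data.Empty using (⊥; ⊥-elim)
open import Data.Fin as Fin using (Fin; zero; suc; toℕ; punchOut; punchIn)
import Data.Fin.Properties as Fin
open import Data.Fin.Properties using (any?)
open import Data.Integer as ℤ using (+_)
import Data.Integer.Properties as ℤ
open import Data.List as List using (List; []; _∷_; map; foldr; upTo; allFin; length; filter; applyUpTo; _++_; cartesianProduct; cartesianProductWith; concatMap; replicate)
import Data.List.Properties as List
open import Data.List.Properties using (map-applyUpTo; map-upTo)
open import Data.List.Membership.Propositional using (_∈_)
open import Data.List.Membership.Propositional.Properties
open import Data.List.Membership.Propositional.Properties.WithK using (unique∧set⇒bag)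
open import Data.List.Relation.Binary.BagAndSetEquality using (∼bag⇒↭)
open import Data.List.Relation.Binary.Permutation.Propositional using (_↭_)
open import Data.List.Relation.Binary.Permutation.Propositional.Properties using () renaming (map⁺ to ↭-map⁺)
open import Data.List.Relation.Unary.All as All using ([]; _∷_)
open import Data.List.Relation.Unary.AllPairs using ([]; _∷_)
open import Data.List.Relation.Unary.Any using (here; there)
open import Data.List.Relation.Unary.Unique.Propositional using (Unique)
import Data.List.Relation.Unary.Unique.Propositional.Properties as Unique
open import Data.Nat as ℕ using (ℕ; zero; suc; NonZero; _∸_; _<_; _≤_; s≤s; z≤n; _<ᵇ_; _≡ᵇ_; _≤ᵇ_; _!)
open import Data.Nat.Combinatorics using (_C_; nCk+nC[k+1]≡[n+1]C[k+1]; k>n⇒nCk≡0; nCn≡1)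
open import Data.Nat.ListAction.Properties using (sum-↭)
import Data.Nat.Properties as ℕ
open import Data.Nat.Properties using (_!≢0)
open import Data.Nat.Solver using (module +-*-Solver)
open import Data.Product using (_,_; _×_; proj₁; proj₂; ∃)
open import Data.Rational as ℚ using (ℚ; 0ℚ; 1ℚ; _/_)
import Data.Rational.Properties as ℚ
import Data.Rational.Unnormalised as ℚᵘ
import Data.Rational.Unnormalised.Properties as ℚᵘ
open import Data.Sum using (_⊎_; inj₁; inj₂)
open import Data.Vec as Vec using (Vec; []; _∷_; lookup; tabulate)
import Data.Vec.Properties as Vec
open import Function using (id; _∘_; mk⇔; Equivalence; Injective)
open import Relation.Binary.Definitions using (tri<; tri≈; tri>)
open import Relation.Binary.PropositionalEquality using (_≡_; _≢_; refl; cong; cong₂; sym; trans; subst; subst₂; module ≡-Reasoning)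
open import Relation.Nullary using (Dec; yes; no; ¬_; contradiction)

-- The compatible words are left enriched P-partitions: letter `2k` stands for k and letter `2k - 1`
-- for -k in the order 0 < -1 < 1 < -2 < 2 < .... Why left peaks alone decide their number: split
-- the counts by the parity of the number of letters left. Read from the end of the pattern, the two
-- resulting series take only two shapes, one for ascents and one for descents, and each passage
-- through a run of descents contributes one factor 4s/(1+s)². An ascent prepended to the pattern
-- makes an initial run of descents count as well. Why standardization decouples the two counts: π
-- together with a word compatible with π⁻¹ is the same datum as one arbitrary word u, and the
-- ascents of π are visible in consecutive letters of u. The count for π then imposes a condition on
-- a second word that depends on u; an odd letter of the second word negates this condition, which
-- is what reading every other row backwards absorbs. In (c), `B_k(s)/(1-s)^(k+1)` has the
-- coefficients `(2i+1)^k`, so the sum over k becomes a sum of powers of 2μ + 1. Insertion into the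
-- cycle of 1 exchanges the two weights of that cycle, so this weight is kept as a parameter.

-- Formal power series

module PowerSeries {c ℓ} (R : CommutativeRing c ℓ) where
  open CommutativeRing R renaming (refl to ≈-refl; sym to ≈-sym; trans to ≈-trans)
  open import Relation.Binary.Reasoning.Setoid setoid
  open import Algebra.Solver.Ring.NaturalCoefficients.Default commutativeSemiring
    using (solve; _:=_; _:+_; _:*_)

  Series : Set c
  Series = ℕ → Carrier

  infix 4 _≋_
  infixl 7 _⊛_
  _≋_ : Series → Series → Set ℓ
  f ≋ g = ∀ n → f n ≈ g n

  sumTo : ℕ → Series → Carrier
  sumTo n h = foldr _+_ 0# (map h (upTo n))

  sumTo-suc : ∀ n h → sumTo (suc n) h ≡ h 0 + sumTo n (h ∘ suc)
  sumTo-suc n h = cong (λ l → h 0 + foldr _+_ 0# l)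
    (trans (map-applyUpTo suc h n) (sym (map-upTo (h ∘ suc) n)))

  sumTo-cong : ∀ n {h k} → h ≋ k → sumTo n h ≈ sumTo n k
  sumTo-cong zero    e = ≈-refl
  sumTo-cong (suc n) {h} {k} e = begin
    sumTo (suc n) h            ≡⟨ sumTo-suc n h ⟩
    h 0 + sumTo n (h ∘ suc)    ≈⟨ +-cong (e 0) (sumTo-cong n (e ∘ suc)) ⟩
    k 0 + sumTo n (k ∘ suc)    ≡⟨ sumTo-suc n k ⟨
    sumTo (suc n) k            ∎

  sumTo-sucʳ : ∀ n h → sumTo (suc n) h ≈ sumTo n h + h n
  sumTo-sucʳ zero    h = +-comm _ _
  sumTo-sucʳ (suc n) h = begin
    sumTo (suc (suc n)) h                    ≡⟨ sumTo-suc (suc n) h ⟩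
    h 0 + sumTo (suc n) (h ∘ suc)            ≈⟨ +-congˡ (sumTo-sucʳ n (h ∘ suc)) ⟩
    h 0 + (sumTo n (h ∘ suc) + h (suc n))    ≈⟨ +-assoc _ _ _ ⟨
    h 0 + sumTo n (h ∘ suc) + h (suc n)      ≡⟨ cong (_+ h (suc n)) (sumTo-suc n h) ⟨
    sumTo (suc n) h + h (suc n)              ∎

  sumTo-zero : ∀ n h → (∀ a → a ℕ.< n → h a ≈ 0#) → sumTo n h ≈ 0#
  sumTo-zero zero    h e = ≈-refl
  sumTo-zero (suc n) h e = begin
    sumTo (suc n) h            ≡⟨ sumTo-suc n h ⟩
    h 0 + sumTo n (h ∘ suc)    ≈⟨ +-cong (e 0 (ℕ.s≤s ℕ.z≤n)) (sumTo-zero n (h ∘ suc) (λ a a<n → e (suc a) (ℕ.s≤s a<n))) ⟩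
    0# + 0#                    ≈⟨ +-identityˡ _ ⟩
    0#                         ∎

  _⊛_ : Series → Series → Series
  (f ⊛ g) n = sumTo (suc n) (λ a → f a * g (n ∸ a))

  ⊛-zero : ∀ f g → (f ⊛ g) 0 ≈ f 0 * g 0
  ⊛-zero f g = +-identityʳ _

  -- Peeling off `f 0` leaves a product with the shifted series `f ∘ suc` at a smaller index. The
  -- ring laws below are inductions along this step, so that no double sum has to be rearranged.
  ⊛-suc : ∀ f g n → (f ⊛ g) (suc n) ≈ f 0 * g (suc n) + (f ∘ suc ⊛ g) n
  ⊛-suc f g n = reflexive (sumTo-suc (suc n) _)

  ⊛-cong : ∀ {f f′ g g′} → f ≋ f′ → g ≋ g′ → f ⊛ g ≋ f′ ⊛ g′
  ⊛-cong p q n = sumTo-cong (suc n) (λ a → *-cong (p a) (q (n ∸ a)))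

  ⊛-distribʳ : ∀ f g h → (λ n → g n + h n) ⊛ f ≋ (λ n → (g ⊛ f) n + (h ⊛ f) n)
  ⊛-distribʳ f g h zero = begin
    ((λ n → g n + h n) ⊛ f) 0   ≈⟨ ⊛-zero (λ n → g n + h n) f ⟩
    (g 0 + h 0) * f 0           ≈⟨ distribʳ _ _ _ ⟩
    g 0 * f 0 + h 0 * f 0       ≈⟨ +-cong (⊛-zero g f) (⊛-zero h f) ⟨
    (g ⊛ f) 0 + (h ⊛ f) 0       ∎
  ⊛-distribʳ f g h (suc n) = begin
    ((λ n → g n + h n) ⊛ f) (suc n)
      ≈⟨ ⊛-suc (λ n → g n + h n) f n ⟩
    (g 0 + h 0) * f (suc n) + ((λ n → g (suc n) + h (suc n)) ⊛ f) n
      ≈⟨ +-congˡ (⊛-distribʳ f (g ∘ suc) (h ∘ suc) n) ⟩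
    (g 0 + h 0) * f (suc n) + ((g ∘ suc ⊛ f) n + (h ∘ suc ⊛ f) n)
      ≈⟨ solve 5 (λ a b x u v → (a :+ b) :* x :+ (u :+ v) := (a :* x :+ u) :+ (b :* x :+ v))
           ≈-refl (g 0) (h 0) (f (suc n)) _ _ ⟩
    (g 0 * f (suc n) + (g ∘ suc ⊛ f) n) + (h 0 * f (suc n) + (h ∘ suc ⊛ f) n)
      ≈⟨ +-cong (⊛-suc g f n) (⊛-suc h f n) ⟨
    (g ⊛ f) (suc n) + (h ⊛ f) (suc n) ∎

  ⊛-scale : ∀ x f g → (λ n → x * f n) ⊛ g ≋ (λ n → x * (f ⊛ g) n)
  ⊛-scale x f g zero = begin
    ((λ n → x * f n) ⊛ g) 0  ≈⟨ ⊛-zero (λ n → x * f n) g ⟩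
    x * f 0 * g 0            ≈⟨ *-assoc _ _ _ ⟩
    x * (f 0 * g 0)          ≈⟨ *-congˡ (⊛-zero f g) ⟨
    x * (f ⊛ g) 0            ∎
  ⊛-scale x f g (suc n) = begin
    ((λ n → x * f n) ⊛ g) (suc n)
      ≈⟨ ⊛-suc (λ n → x * f n) g n ⟩
    x * f 0 * g (suc n) + ((λ n → x * f (suc n)) ⊛ g) n
      ≈⟨ +-cong (*-assoc _ _ _) (⊛-scale x (f ∘ suc) g n) ⟩
    x * (f 0 * g (suc n)) + x * (f ∘ suc ⊛ g) n
      ≈⟨ distribˡ _ _ _ ⟨
    x * (f 0 * g (suc n) + (f ∘ suc ⊛ g) n)
      ≈⟨ *-congˡ (⊛-suc f g n) ⟨
    x * (f ⊛ g) (suc n) ∎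

  ⊛-assoc : ∀ f g h → (f ⊛ g) ⊛ h ≋ f ⊛ (g ⊛ h)
  ⊛-assoc f g h zero = begin
    ((f ⊛ g) ⊛ h) 0       ≈⟨ ⊛-zero (f ⊛ g) h ⟩
    (f ⊛ g) 0 * h 0       ≈⟨ *-congʳ (⊛-zero f g) ⟩
    f 0 * g 0 * h 0       ≈⟨ *-assoc _ _ _ ⟩
    f 0 * (g 0 * h 0)     ≈⟨ *-congˡ (⊛-zero g h) ⟨
    f 0 * (g ⊛ h) 0       ≈⟨ ⊛-zero f (g ⊛ h) ⟨
    (f ⊛ (g ⊛ h)) 0       ∎
  ⊛-assoc f g h (suc n) = begin
    ((f ⊛ g) ⊛ h) (suc n)
      ≈⟨ ⊛-suc (f ⊛ g) h n ⟩
    (f ⊛ g) 0 * h (suc n) + ((f ⊛ g) ∘ suc ⊛ h) n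
      ≈⟨ +-cong (*-congʳ (⊛-zero f g)) (⊛-cong {g = h} (⊛-suc f g) (λ _ → ≈-refl) n) ⟩
    f 0 * g 0 * h (suc n) + ((λ k → f 0 * g (suc k) + (f ∘ suc ⊛ g) k) ⊛ h) n
      ≈⟨ +-congˡ (⊛-distribʳ h (λ k → f 0 * g (suc k)) (f ∘ suc ⊛ g) n) ⟩
    f 0 * g 0 * h (suc n) + (((λ k → f 0 * g (suc k)) ⊛ h) n + ((f ∘ suc ⊛ g) ⊛ h) n)
      ≈⟨ +-congˡ (+-cong (⊛-scale (f 0) (g ∘ suc) h n) (⊛-assoc (f ∘ suc) g h n)) ⟩
    f 0 * g 0 * h (suc n) + (f 0 * (g ∘ suc ⊛ h) n + (f ∘ suc ⊛ (g ⊛ h)) n)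
      ≈⟨ solve 5 (λ a b x u v → a :* b :* x :+ (a :* u :+ v) := a :* (b :* x :+ u) :+ v)
           ≈-refl (f 0) (g 0) (h (suc n)) _ _ ⟩
    f 0 * (g 0 * h (suc n) + (g ∘ suc ⊛ h) n) + (f ∘ suc ⊛ (g ⊛ h)) n
      ≈⟨ +-congʳ (*-congˡ (⊛-suc g h n)) ⟨
    f 0 * (g ⊛ h) (suc n) + (f ∘ suc ⊛ (g ⊛ h)) n
      ≈⟨ ⊛-suc f (g ⊛ h) n ⟨
    (f ⊛ (g ⊛ h)) (suc n) ∎

  -- Commutativity exchanges the factors, so its induction has to peel the right end of the sum as
  -- well as the left.
  ⊛-sucʳ : ∀ f g n → (f ⊛ g) (suc n) ≈ (f ⊛ g ∘ suc) n + f (suc n) * g 0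
  ⊛-sucʳ f g zero = begin
    (f ⊛ g) 1                             ≈⟨ ⊛-suc f g 0 ⟩
    f 0 * g 1 + (f ∘ suc ⊛ g) 0           ≈⟨ +-cong (⊛-zero f (g ∘ suc)) (≈-sym (⊛-zero (f ∘ suc) g)) ⟨
    (f ⊛ g ∘ suc) 0 + f 1 * g 0           ∎
  ⊛-sucʳ f g (suc n) = begin
    (f ⊛ g) (suc (suc n))
      ≈⟨ ⊛-suc f g (suc n) ⟩
    f 0 * g (suc (suc n)) + (f ∘ suc ⊛ g) (suc n)
      ≈⟨ +-congˡ (⊛-sucʳ (f ∘ suc) g n) ⟩
    f 0 * g (suc (suc n)) + ((f ∘ suc ⊛ g ∘ suc) n + f (suc (suc n)) * g 0)
      ≈⟨ +-assoc _ _ _ ⟨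
    f 0 * g (suc (suc n)) + (f ∘ suc ⊛ g ∘ suc) n + f (suc (suc n)) * g 0
      ≈⟨ +-congʳ (⊛-suc f (g ∘ suc) n) ⟨
    (f ⊛ g ∘ suc) (suc n) + f (suc (suc n)) * g 0 ∎

  ⊛-comm : ∀ f g → f ⊛ g ≋ g ⊛ f
  ⊛-comm f g zero = begin
    (f ⊛ g) 0   ≈⟨ ⊛-zero f g ⟩
    f 0 * g 0   ≈⟨ *-comm _ _ ⟩
    g 0 * f 0   ≈⟨ ⊛-zero g f ⟨
    (g ⊛ f) 0   ∎
  ⊛-comm f g (suc n) = begin
    (f ⊛ g) (suc n)                    ≈⟨ ⊛-suc f g n ⟩
    f 0 * g (suc n) + (f ∘ suc ⊛ g) n  ≈⟨ +-cong (*-comm _ _) (⊛-comm (f ∘ suc) g n) ⟩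
    g (suc n) * f 0 + (g ⊛ f ∘ suc) n  ≈⟨ +-comm _ _ ⟩
    (g ⊛ f ∘ suc) n + g (suc n) * f 0  ≈⟨ ⊛-sucʳ g f n ⟨
    (g ⊛ f) (suc n)                    ∎

  constant : Carrier → Series
  constant x zero    = x
  constant x (suc _) = 0#

  ⊛-zeroˡ : ∀ f → (λ _ → 0#) ⊛ f ≋ (λ _ → 0#)
  ⊛-zeroˡ f zero = ≈-trans (⊛-zero (λ _ → 0#) f) (zeroˡ _)
  ⊛-zeroˡ f (suc n) = begin
    ((λ _ → 0#) ⊛ f) (suc n)                ≈⟨ ⊛-suc (λ _ → 0#) f n ⟩
    0# * f (suc n) + ((λ _ → 0#) ⊛ f) n     ≈⟨ +-cong (zeroˡ _) (⊛-zeroˡ f n) ⟩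
    0# + 0#                                 ≈⟨ +-identityˡ _ ⟩
    0#                                      ∎

  constant-⊛ : ∀ x f → constant x ⊛ f ≋ (λ n → x * f n)
  constant-⊛ x f zero = ⊛-zero (constant x) f
  constant-⊛ x f (suc n) = begin
    (constant x ⊛ f) (suc n)                ≈⟨ ⊛-suc (constant x) f n ⟩
    x * f (suc n) + ((λ _ → 0#) ⊛ f) n      ≈⟨ +-congˡ (⊛-zeroˡ f n) ⟩
    x * f (suc n) + 0#                      ≈⟨ +-identityʳ _ ⟩
    x * f (suc n)                           ∎

  ⊛-identityˡ : ∀ f → constant 1# ⊛ f ≋ f
  ⊛-identityˡ f n = ≈-trans (constant-⊛ 1# f n) (*-identityˡ _)

  commutativeRing′ : CommutativeRing c ℓ
  commutativeRing′ = record
    { Carrier = Series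
    ; _≈_ = _≋_
    ; _+_ = λ f g n → f n + g n
    ; _*_ = _⊛_
    ; -_ = λ f n → - f n
    ; 0# = λ _ → 0#
    ; 1# = constant 1#
    ; isCommutativeRing = record
      { isRing = record
        { +-isAbelianGroup = record
          { isGroup = record
            { isMonoid = record
              { isSemigroup = record
                { isMagma = record
                  { isEquivalence = record
                    { refl = λ _ → ≈-refl
                    ; sym = λ p n → ≈-sym (p n)
                    ; trans = λ p q n → ≈-trans (p n) (q n) }
                  ; ∙-cong = λ p q n → +-cong (p n) (q n) }
                ; assoc = λ f g h n → +-assoc _ _ _ }
              ; identity = (λ f n → +-identityˡ _) , (λ f n → +-identityʳ _) }
            ; inverse = (λ f n → -‿inverseˡ _) , (λ f n → -‿inverseʳ _)
            ; ⁻¹-cong = λ p n → -‿cong (p n) }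
          ; comm = λ f g n → +-comm _ _ }
        ; *-cong = ⊛-cong
        ; *-assoc = ⊛-assoc
        ; *-identity = ⊛-identityˡ , (λ f n → ≈-trans (⊛-comm f (constant 1#) n) (⊛-identityˡ f n))
        ; distrib = (λ f g h n → ≈-trans (⊛-comm f _ n) (≈-trans (⊛-distribʳ f g h n)
                      (+-cong (⊛-comm g f n) (⊛-comm h f n)))) , ⊛-distribʳ }
      ; *-comm = ⊛-comm } }

-- Ring structures on the series of the statement

module _ {c ℓ} (R : CommutativeRing c ℓ) where
  open CommutativeRing R renaming (refl to ≈-refl; sym to ≈-sym; trans to ≈-trans)
  open import Relation.Binary.Reasoning.Setoid setoid

  -- The series operations of the statement agree with those of `PowerSeries` up to pointwise
  -- equality. With `mul` and `one` as the operations of the ring, its laws apply to the expressions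
  -- of the statement as they stand.
  replaceProduct : (mul : Carrier → Carrier → Carrier) (one : Carrier) →
                   (∀ x y → mul x y ≈ x * y) → one ≈ 1# → CommutativeRing c ℓ
  replaceProduct mul one mul≈* one≈1 = record
    { Carrier = Carrier ; _≈_ = _≈_ ; _+_ = _+_ ; _*_ = mul ; -_ = -_ ; 0# = 0# ; 1# = one
    ; isCommutativeRing = record
      { isRing = record
        { +-isAbelianGroup = +-isAbelianGroup
        ; *-cong = λ p q → via (*-cong p q)
        ; *-assoc = λ x y z → ≈-trans (mul≈* _ _) (≈-trans (*-congʳ (mul≈* x y))
                     (≈-trans (*-assoc x y z) (≈-sym (≈-trans (mul≈* _ _) (*-congˡ (mul≈* y z))))))
        ; *-identity = (λ x → ≈-trans (mul≈* _ _) (≈-trans (*-congʳ one≈1) (*-identityˡ x)))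
                     , (λ x → ≈-trans (mul≈* _ _) (≈-trans (*-congˡ one≈1) (*-identityʳ x)))
        ; distrib = (λ x y z → ≈-trans (mul≈* _ _) (≈-trans (distribˡ x y z) (+-cong (≈-sym (mul≈* _ _)) (≈-sym (mul≈* _ _)))))
                  , (λ x y z → ≈-trans (mul≈* _ _) (≈-trans (distribʳ x y z) (+-cong (≈-sym (mul≈* _ _)) (≈-sym (mul≈* _ _))))) }
      ; *-comm = λ x y → via (*-comm x y) } }
    where
    via : ∀ {x y x′ y′} → x * y ≈ x′ * y′ → mul x y ≈ mul x′ y′
    via p = ≈-trans (mul≈* _ _) (≈-trans p (≈-sym (mul≈* _ _)))

  inverse-unique : ∀ x y y′ → x * y ≈ 1# → x * y′ ≈ 1# → y ≈ y′
  inverse-unique x y y′ p q = begin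
    y               ≈⟨ *-identityʳ y ⟨
    y * 1#          ≈⟨ *-congˡ q ⟨
    y * (x * y′)    ≈⟨ *-assoc y x y′ ⟨
    y * x * y′      ≈⟨ *-congʳ (≈-trans (*-comm y x) p) ⟩
    1# * y′         ≈⟨ *-identityˡ y′ ⟩
    y′              ∎

module Q = CommutativeRing ℚ.+-*-commutativeRing
module PSℚ = PowerSeries ℚ.+-*-commutativeRing

P1-ring : CommutativeRing _ _
P1-ring = replaceProduct PSℚ.commutativeRing′ P1._*_ (P1.const 1ℚ) (λ f g n → refl) (λ { zero → refl ; (suc n) → refl })

module PSP1 = PowerSeries P1-ring

sumTo-eval : ∀ n (h : ℕ → PS1) j → PSP1.sumTo n h j ≡ PSℚ.sumTo n (λ a → h a j)
sumTo-eval zero    h j = refl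
sumTo-eval (suc n) h j = begin
  PSP1.sumTo (suc n) h j                           ≡⟨ cong (λ g → g j) (PSP1.sumTo-suc n h) ⟩
  h 0 j ℚ.+ PSP1.sumTo n (h ∘ suc) j               ≡⟨ cong (h 0 j ℚ.+_) (sumTo-eval n (h ∘ suc) j) ⟩
  h 0 j ℚ.+ PSℚ.sumTo n (λ a → h (suc a) j)        ≡⟨ PSℚ.sumTo-suc n (λ a → h a j) ⟨
  PSℚ.sumTo (suc n) (λ a → h a j)                  ∎
  where open ≡-Reasoning

-- Series in `s` whose coefficients are series in `t`. `sumTo-eval` turns the product of that
-- iterated ring into the double sum.
P2-ring : CommutativeRing _ _
P2-ring = replaceProduct PSP1.commutativeRing′ P2._*_ (P2.const 1ℚ)
  (λ f g i j → sym (sumTo-eval (suc i) (λ a → f a P1.* g (i ∸ a)) j))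
  (λ { zero zero → refl ; zero (suc j) → refl ; (suc i) j → refl })

module R1 = CommutativeRing P1-ring
module R2 = CommutativeRing P2-ring

-- Reciprocals as geometric series

private
  -- `P2.inv` truncates the geometric series at `i + j`, a bound that varies with the coefficient. A
  -- separate bound `K` allows one truncation to be used for all coefficients of a product.
  geom : PS2 → ℕ → PS2
  geom h K i j = Σ[≤ K ] (λ k → (h P2.^ k) i j)

  geom-sucʳ : ∀ h K i j → geom h (suc K) i j ≡ geom h K i j ℚ.+ (h P2.^ suc K) i j
  geom-sucʳ h K i j = PSℚ.sumTo-sucʳ (suc K) (λ k → (h P2.^ k) i j)

  geom-sucˡ : ∀ h K → geom h (suc K) R2.≈ (P2.const 1ℚ P2.+ (h P2.* geom h K))
  geom-sucˡ h zero i j = begin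
    geom h 1 i j
      ≡⟨ cong (P2.const 1ℚ i j ℚ.+_) (ℚ.+-identityʳ _) ⟩
    P2.const 1ℚ i j ℚ.+ (h P2.* P2.const 1ℚ) i j
      ≡⟨ cong (P2.const 1ℚ i j ℚ.+_) (R2.*-congˡ {h} (λ a b → sym (ℚ.+-identityʳ (P2.const 1ℚ a b))) i j) ⟩
    P2.const 1ℚ i j ℚ.+ (h P2.* geom h 0) i j ∎
    where open ≡-Reasoning
  geom-sucˡ h (suc K) = begin
    geom h (suc (suc K))
      ≈⟨ geom-sucʳ h (suc K) ⟩
    geom h (suc K) P2.+ (h P2.* (h P2.^ suc K))
      ≈⟨ R2.+-congʳ {h P2.* (h P2.^ suc K)} (geom-sucˡ h K) ⟩
    (P2.const 1ℚ P2.+ (h P2.* geom h K)) P2.+ (h P2.* (h P2.^ suc K))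
      ≈⟨ R2.+-assoc (P2.const 1ℚ) (h P2.* geom h K) (h P2.* (h P2.^ suc K)) ⟩
    P2.const 1ℚ P2.+ ((h P2.* geom h K) P2.+ (h P2.* (h P2.^ suc K)))
      ≈⟨ R2.+-congˡ {P2.const 1ℚ} (R2.distribˡ h (geom h K) (h P2.^ suc K)) ⟨
    P2.const 1ℚ P2.+ (h P2.* (geom h K P2.+ (h P2.^ suc K)))
      ≈⟨ R2.+-congˡ {P2.const 1ℚ} (R2.*-congˡ {h} (geom-sucʳ h K)) ⟨
    P2.const 1ℚ P2.+ (h P2.* geom h (suc K)) ∎
    where open import Relation.Binary.Reasoning.Setoid R2.setoid

  -- A factor without constant term raises the total degree by at least one, so `k` of them leave
  -- nothing in degrees below `k`.
  pow-order : ∀ h → h 0 0 ≡ 0ℚ → ∀ k i j → i ℕ.+ j < k → (h P2.^ k) i j ≡ 0ℚ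
  pow-order h h0 (suc k) i j (s≤s i+j≤k) =
    PSℚ.sumTo-zero (suc i) _ λ a a≤i → PSℚ.sumTo-zero (suc j) _ λ b b≤j → term a b a≤i b≤j
    where
    term : ∀ a b → a < suc i → b < suc j → h a b ℚ.* (h P2.^ k) (i ∸ a) (j ∸ b) ≡ 0ℚ
    term zero zero _ _ = trans (cong (ℚ._* (h P2.^ k) i j) h0) (ℚ.*-zeroˡ ((h P2.^ k) i j))
    term (suc a) b (s≤s a<i) _ = trans (cong (h (suc a) b ℚ.*_) (pow-order h h0 k _ _
      (ℕ.≤-trans (ℕ.+-mono-<-≤ (ℕ.∸-monoʳ-< (s≤s z≤n) a<i) (ℕ.m∸n≤m j b)) i+j≤k))) (ℚ.*-zeroʳ (h (suc a) b))
    term zero (suc b) _ (s≤s b<j) = trans (cong (h 0 (suc b) ℚ.*_) (pow-order h h0 k _ _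
      (ℕ.≤-trans (ℕ.+-monoʳ-< i (ℕ.∸-monoʳ-< (s≤s z≤n) b<j)) i+j≤k))) (ℚ.*-zeroʳ (h 0 (suc b)))

  geom-stable : ∀ h → h 0 0 ≡ 0ℚ → ∀ d i j → geom h (d ℕ.+ (i ℕ.+ j)) i j ≡ geom h (i ℕ.+ j) i j
  geom-stable h h0 zero    i j = refl
  geom-stable h h0 (suc d) i j = begin
    geom h (suc (d ℕ.+ (i ℕ.+ j))) i j
      ≡⟨ geom-sucʳ h (d ℕ.+ (i ℕ.+ j)) i j ⟩
    geom h (d ℕ.+ (i ℕ.+ j)) i j ℚ.+ (h P2.^ suc (d ℕ.+ (i ℕ.+ j))) i j
      ≡⟨ cong₂ ℚ._+_ (geom-stable h h0 d i j) (pow-order h h0 _ i j (s≤s (ℕ.m≤n+m (i ℕ.+ j) d))) ⟩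
    geom h (i ℕ.+ j) i j ℚ.+ 0ℚ
      ≡⟨ ℚ.+-identityʳ _ ⟩
    geom h (i ℕ.+ j) i j ∎
    where open ≡-Reasoning

  geom-stable-≤ : ∀ h → h 0 0 ≡ 0ℚ → ∀ K i j → i ℕ.+ j ≤ K → geom h K i j ≡ geom h (i ℕ.+ j) i j
  geom-stable-≤ h h0 K i j le = trans (cong (λ K → geom h K i j) (sym (ℕ.m∸n+n≡m le))) (geom-stable h h0 (K ∸ (i ℕ.+ j)) i j)

P2-inverseʳ : ∀ f → f 0 0 ≡ 1ℚ → f P2.* P2.inv f R2.≈ P2.const 1ℚ
P2-inverseʳ f f0 = begin
  f P2.* g
    ≈⟨ R2.*-congʳ {g} f≈1-h ⟩
  (P2.const 1ℚ P2.- h) P2.* g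
    ≈⟨ R2.distribʳ g (P2.const 1ℚ) (R2.- h) ⟩
  (P2.const 1ℚ P2.* g) P2.+ ((R2.- h) P2.* g)
    ≈⟨ R2.+-cong (R2.*-identityˡ g) (R2.sym (-‿distribˡ-* h g)) ⟩
  g P2.- (h P2.* g)
    ≈⟨ R2.+-congʳ {R2.- (h P2.* g)} g≈1+hg ⟩
  (P2.const 1ℚ P2.+ (h P2.* g)) P2.- (h P2.* g)
    ≈⟨ R2.+-assoc (P2.const 1ℚ) (h P2.* g) (R2.- (h P2.* g)) ⟩
  P2.const 1ℚ P2.+ ((h P2.* g) P2.- (h P2.* g))
    ≈⟨ R2.+-congˡ {P2.const 1ℚ} (R2.-‿inverseʳ (h P2.* g)) ⟩
  P2.const 1ℚ P2.+ R2.0#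
    ≈⟨ R2.+-identityʳ (P2.const 1ℚ) ⟩
  P2.const 1ℚ ∎
  where
  open import Relation.Binary.Reasoning.Setoid R2.setoid
  open import Algebra.Properties.Ring R2.ring using (-‿distribˡ-*)
  open import Algebra.Properties.Ring Q.ring using () renaming (⁻¹-anti-homo‿- to q-anti)
  h g : PS2
  h = P2.const 1ℚ P2.- f
  g = P2.inv f

  h0 : h 0 0 ≡ 0ℚ
  h0 = cong (λ x → 1ℚ ℚ.- x) f0

  f≈1-h : f R2.≈ (P2.const 1ℚ P2.- h)
  f≈1-h i j = eq (P2.const 1ℚ i j) (f i j)
    where
    eq : ∀ x y → y ≡ x ℚ.- (x ℚ.- y)
    eq x y = sym (trans (cong (x ℚ.+_) (q-anti x y)) (trans (ℚ.+-comm x (y ℚ.- x))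
      (trans (ℚ.+-assoc y (ℚ.- x) x) (trans (cong (y ℚ.+_) (ℚ.+-inverseˡ x)) (ℚ.+-identityʳ y)))))

  -- The product `h * g` involves coefficients of `g` of lower degree, each truncated at its own
  -- bound. By stability all of them may be read at the common bound `i + j`, where `geom-sucˡ`
  -- applies.
  g≈1+hg : g R2.≈ (P2.const 1ℚ P2.+ (h P2.* g))
  g≈1+hg i j = trans (sym (geom-stable h h0 1 i j)) (trans (geom-sucˡ h (i ℕ.+ j) i j)
    (cong (P2.const 1ℚ i j ℚ.+_) (PSℚ.sumTo-cong (suc i) λ a → PSℚ.sumTo-cong (suc j) λ b →
      cong (h a b ℚ.*_) (geom-stable-≤ h h0 (i ℕ.+ j) (i ∸ a) (j ∸ b) (ℕ.+-mono-≤ (ℕ.m∸n≤m i a) (ℕ.m∸n≤m j b))))))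

-- Expansion of both sides

-- The power operation is a parameter, since `P1._^_` and `P2._^_` are separate recursions.
module Powers {c ℓ} (R : CommutativeRing c ℓ)
  (_^_ : CommutativeRing.Carrier R → ℕ → CommutativeRing.Carrier R)
  (^-zero : ∀ x → CommutativeRing._≈_ R (x ^ 0) (CommutativeRing.1# R))
  (^-suc : ∀ x k → CommutativeRing._≈_ R (x ^ suc k) (CommutativeRing._*_ R x (x ^ k))) where
  open CommutativeRing R renaming (refl to ≈-refl; sym to ≈-sym; trans to ≈-trans)
  open import Relation.Binary.Reasoning.Setoid setoid
  open import Algebra.Properties.CommutativeSemigroup *-commutativeSemigroup using (interchange)

  ^-cong : ∀ {x y} k → x ≈ y → x ^ k ≈ y ^ k
  ^-cong {x} {y} zero    p = ≈-trans (^-zero x) (≈-sym (^-zero y))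
  ^-cong {x} {y} (suc k) p = begin
    x ^ suc k     ≈⟨ ^-suc x k ⟩
    x * (x ^ k)   ≈⟨ *-cong p (^-cong k p) ⟩
    y * (y ^ k)   ≈⟨ ^-suc y k ⟨
    y ^ suc k     ∎

  ^-distrib-* : ∀ x y k → (x * y) ^ k ≈ (x ^ k) * (y ^ k)
  ^-distrib-* x y zero = begin
    (x * y) ^ 0         ≈⟨ ^-zero (x * y) ⟩
    1#                  ≈⟨ *-identityˡ 1# ⟨
    1# * 1#             ≈⟨ *-cong (^-zero x) (^-zero y) ⟨
    (x ^ 0) * (y ^ 0)   ∎
  ^-distrib-* x y (suc k) = begin
    (x * y) ^ suc k                   ≈⟨ ^-suc (x * y) k ⟩
    (x * y) * ((x * y) ^ k)           ≈⟨ *-congˡ (^-distrib-* x y k) ⟩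
    (x * y) * ((x ^ k) * (y ^ k))     ≈⟨ interchange x y (x ^ k) (y ^ k) ⟩
    (x * (x ^ k)) * (y * (y ^ k))     ≈⟨ *-cong (^-suc x k) (^-suc y k) ⟨
    (x ^ suc k) * (y ^ suc k)         ∎

  1^k : ∀ k → 1# ^ k ≈ 1#
  1^k zero    = ^-zero 1#
  1^k (suc k) = begin
    1# ^ suc k    ≈⟨ ^-suc 1# k ⟩
    1# * (1# ^ k) ≈⟨ *-identityˡ _ ⟩
    1# ^ k        ≈⟨ 1^k k ⟩
    1#            ∎

  ^-inverse : ∀ x y k → x * y ≈ 1# → (x ^ k) * (y ^ k) ≈ 1#
  ^-inverse x y k p = begin
    (x ^ k) * (y ^ k)  ≈⟨ ^-distrib-* x y k ⟨
    (x * y) ^ k        ≈⟨ ^-cong k p ⟩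
    1# ^ k             ≈⟨ 1^k k ⟩
    1#                 ∎

module Pow1 = Powers P1-ring P1._^_ (λ x → R1.refl {x P1.^ 0}) (λ x k → R1.refl {x P1.^ suc k})
module Pow2 = Powers P2-ring P2._^_ (λ x → R2.refl {x P2.^ 0}) (λ x k → R2.refl {x P2.^ suc k})

const-* : ∀ x g → P1.const x P1.* g R1.≈ (λ n → x ℚ.* g n)
const-* x g n = trans (R1.*-congʳ {g} {P1.const x} {PSℚ.constant x} (λ { zero → refl ; (suc _) → refl }) n) (PSℚ.constant-⊛ x g n)

inS-const : ∀ f i → P2.inS f i R1.≈ P1.const (f i)
inS-const f i zero    = refl
inS-const f i (suc j) = refl

inT-constant : ∀ g → P2.inT g R2.≈ PSP1.constant g
inT-constant g zero    j = refl
inT-constant g (suc i) j = refl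

inT-* : ∀ g F i → (P2.inT g P2.* F) i R1.≈ (g P1.* F i)
inT-* g F i j = begin
  (P2.inT g P2.* F) i j            ≡⟨ R2.*-congʳ {F} (inT-constant g) i j ⟩
  (PSP1.constant g P2.* F) i j     ≡⟨ sumTo-eval (suc i) (λ a → PSP1.constant g a P1.* F (i ∸ a)) j ⟨
  (PSP1.constant g PSP1.⊛ F) i j   ≡⟨ PSP1.constant-⊛ g F i j ⟩
  (g P1.* F i) j                   ∎
  where open ≡-Reasoning

inS-homo-* : ∀ f g → P2.inS (f P1.* g) R2.≈ (P2.inS f P2.* P2.inS g)
inS-homo-* f g i j = sym (trans (PSℚ.sumTo-cong (suc i) λ a →
    trans (R1.*-cong (inS-const f a) (inS-const g (i ∸ a)) j) (const-* (f a) (P1.const (g (i ∸ a))) j))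
    (rest j))
  where
  rest : ∀ j → PSℚ.sumTo (suc i) (λ a → f a ℚ.* P1.const (g (i ∸ a)) j) ≡ P2.inS (f P1.* g) i j
  rest zero    = refl
  rest (suc j) = PSℚ.sumTo-zero (suc i) _ (λ a _ → ℚ.*-zeroʳ (f a))

inS-cong : ∀ {f g} → f R1.≈ g → P2.inS f R2.≈ P2.inS g
inS-cong p i zero    = p i
inS-cong p i (suc j) = refl

inT-cong : ∀ {f g} → f R1.≈ g → P2.inT f R2.≈ P2.inT g
inT-cong p zero    j = p j
inT-cong p (suc i) j = refl

inT-homo-* : ∀ f g → P2.inT (f P1.* g) R2.≈ (P2.inT f P2.* P2.inT g)
inT-homo-* f g zero    j = sym (inT-* f (P2.inT g) zero j)
inT-homo-* f g (suc i) j = sym (trans (inT-* f (P2.inT g) (suc i) j) (R1.zeroʳ f j))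

inS-1 : P2.inS (P1.const 1ℚ) R2.≈ P2.const 1ℚ
inS-1 zero    zero    = refl
inS-1 zero    (suc j) = refl
inS-1 (suc i) zero    = refl
inS-1 (suc i) (suc j) = refl

inT-1 : P2.inT (P1.const 1ℚ) R2.≈ P2.const 1ℚ
inT-1 zero    zero    = refl
inT-1 zero    (suc j) = refl
inT-1 (suc i) j       = refl

inS-homo-^ : ∀ f k → P2.inS (f P1.^ k) R2.≈ (P2.inS f P2.^ k)
inS-homo-^ f zero    = inS-1
inS-homo-^ f (suc k) = R2.trans (inS-homo-* f (f P1.^ k)) (R2.*-congˡ {P2.inS f} (inS-homo-^ f k))

inT-homo-^ : ∀ f k → P2.inT (f P1.^ k) R2.≈ (P2.inT f P2.^ k)
inT-homo-^ f zero    = inT-1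
inT-homo-^ f (suc k) = R2.trans (inT-homo-* f (f P1.^ k)) (R2.*-congˡ {P2.inT f} (inT-homo-^ f k))

-- This separates the variables: a factor brought to this form has coefficients that are products of
-- one-variable coefficients.
inS-*-inT : ∀ f g i j → (P2.inS f P2.* P2.inT g) i j ≡ f i ℚ.* g j
inS-*-inT f g i j = begin
  (P2.inS f P2.* P2.inT g) i j   ≡⟨ R2.*-comm (P2.inS f) (P2.inT g) i j ⟩
  (P2.inT g P2.* P2.inS f) i j   ≡⟨ inT-* g (P2.inS f) i j ⟩
  (g P1.* P2.inS f i) j          ≡⟨ R1.*-congˡ {g} (inS-const f i) j ⟩
  (g P1.* P1.const (f i)) j      ≡⟨ R1.*-comm g (P1.const (f i)) j ⟩
  (P1.const (f i) P1.* g) j      ≡⟨ const-* (f i) g j ⟩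
  f i ℚ.* g j                    ∎
  where open ≡-Reasoning

-- Read off from the two-variable inverse in degree 0 of `t`, where the truncation bounds `i` and
-- `i + 0` agree.
P1-inverseʳ : ∀ f → f 0 ≡ 1ℚ → f P1.* P1.inv f R1.≈ P1.const 1ℚ
P1-inverseʳ f f0 i = begin
  (f P1.* P1.inv f) i
    ≡⟨ PSℚ.sumTo-cong (suc i) (λ a → trans (cong (f a ℚ.*_) (inv≡ (i ∸ a))) (sym (ℚ.+-identityʳ _))) ⟩
  (P2.inS f P2.* P2.inv (P2.inS f)) i 0
    ≡⟨ P2-inverseʳ (P2.inS f) f0 i 0 ⟩
  P2.const 1ℚ i 0
    ≡⟨ inS-1 i 0 ⟨
  P1.const 1ℚ i ∎
  where
  open ≡-Reasoning
  1-inS : P2.inS (P1.const 1ℚ P1.- f) R2.≈ (P2.const 1ℚ P2.- P2.inS f)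
  1-inS zero    zero    = refl
  1-inS (suc i) zero    = refl
  1-inS zero    (suc j) = refl
  1-inS (suc i) (suc j) = refl

  inv≡ : ∀ i → P1.inv f i ≡ P2.inv (P2.inS f) i 0
  inv≡ i = begin
    PSℚ.sumTo (suc i) (λ k → ((P1.const 1ℚ P1.- f) P1.^ k) i)
      ≡⟨ PSℚ.sumTo-cong (suc i) (λ k → trans (inS-homo-^ (P1.const 1ℚ P1.- f) k i 0) (Pow2.^-cong k 1-inS i 0)) ⟩
    PSℚ.sumTo (suc i) (λ k → ((P2.const 1ℚ P2.- P2.inS f) P2.^ k) i 0)
      ≡⟨ cong (λ n → PSℚ.sumTo (suc n) (λ k → ((P2.const 1ℚ P2.- P2.inS f) P2.^ k) i 0)) (ℕ.+-identityʳ i) ⟨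
    P2.inv (P2.inS f) i 0 ∎

-- Separation of the variables

1+x 1-x : PS1
1+x = P1.const 1ℚ P1.+ P1.var
1-x = P1.const 1ℚ P1.- P1.var

var-*-suc : ∀ g n → (P1.var P1.* g) (suc n) ≡ g n
var-*-suc g n = begin
  (P1.var P1.* g) (suc n)                                  ≡⟨ PSℚ.⊛-suc P1.var g n ⟩
  0ℚ ℚ.* g (suc n) ℚ.+ ((P1.var ∘ suc) P1.* g) n           ≡⟨ cong₂ ℚ._+_ (ℚ.*-zeroˡ (g (suc n)))
                                                               (R1.*-congʳ {g} {P1.var ∘ suc} {P1.const 1ℚ} (λ { zero → refl ; (suc _) → refl }) n) ⟩
  0ℚ ℚ.+ (P1.const 1ℚ P1.* g) n                            ≡⟨ ℚ.+-identityˡ _ ⟩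
  (P1.const 1ℚ P1.* g) n                                   ≡⟨ R1.*-identityˡ g n ⟩
  g n ∎
  where open ≡-Reasoning

var-*-zero : ∀ g → (P1.var P1.* g) 0 ≡ 0ℚ
var-*-zero g = trans (PSℚ.⊛-zero P1.var g) (ℚ.*-zeroˡ (g 0))

1+x-*-suc : ∀ g n → (1+x P1.* g) (suc n) ≡ g (suc n) ℚ.+ g n
1+x-*-suc g n = trans (R1.distribʳ g (P1.const 1ℚ) P1.var (suc n)) (cong₂ ℚ._+_ (R1.*-identityˡ g (suc n)) (var-*-suc g n))

1+x-*-zero : ∀ g → (1+x P1.* g) 0 ≡ g 0
1+x-*-zero g = trans (PSℚ.⊛-zero 1+x g) (ℚ.*-identityˡ (g 0))

1-x-*-suc : ∀ g n → (1-x P1.* g) (suc n) ≡ g (suc n) ℚ.- g n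
1-x-*-suc g n = begin
  (1-x P1.* g) (suc n)
    ≡⟨ R1.distribʳ g (P1.const 1ℚ) (R1.- P1.var) (suc n) ⟩
  (P1.const 1ℚ P1.* g) (suc n) ℚ.+ ((R1.- P1.var) P1.* g) (suc n)
    ≡⟨ cong₂ ℚ._+_ (R1.*-identityˡ g (suc n)) (trans (sym (-‿distribˡ-* P1.var g (suc n))) (cong ℚ.-_ (var-*-suc g n))) ⟩
  g (suc n) ℚ.- g n ∎
  where
  open ≡-Reasoning
  open import Algebra.Properties.Ring R1.ring using (-‿distribˡ-*)

1-x-*-zero : ∀ g → (1-x P1.* g) 0 ≡ g 0
1-x-*-zero g = trans (PSℚ.⊛-zero 1-x g) (ℚ.*-identityˡ (g 0))

-- This is `1/(1-x)`. Multiplying by it forms partial sums, and its powers take the place of all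
-- divisions by powers of `1-x`.
ones : PS1
ones _ = 1ℚ

ones-inverse : 1-x P1.* ones R1.≈ P1.const 1ℚ
ones-inverse zero    = 1-x-*-zero ones
ones-inverse (suc n) = 1-x-*-suc ones n

1+x⁻¹ : PS1
1+x⁻¹ = P1.inv 1+x

1+x-inverse : 1+x P1.* 1+x⁻¹ R1.≈ P1.const 1ℚ
1+x-inverse = P1-inverseʳ 1+x refl

1+s≈ : P2.const 1ℚ P2.+ P2.s R2.≈ P2.inS 1+x
1+s≈ zero          zero    = refl
1+s≈ zero          (suc j) = refl
1+s≈ (suc zero)    zero    = refl
1+s≈ (suc zero)    (suc j) = refl
1+s≈ (suc (suc i)) zero    = refl
1+s≈ (suc (suc i)) (suc j) = refl

1-s≈ : P2.const 1ℚ P2.- P2.s R2.≈ P2.inS 1-x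
1-s≈ zero          zero    = refl
1-s≈ zero          (suc j) = refl
1-s≈ (suc zero)    zero    = refl
1-s≈ (suc zero)    (suc j) = refl
1-s≈ (suc (suc i)) zero    = refl
1-s≈ (suc (suc i)) (suc j) = refl

1+t≈ : P2.const 1ℚ P2.+ P2.t R2.≈ P2.inT 1+x
1+t≈ zero    zero          = refl
1+t≈ zero    (suc zero)    = refl
1+t≈ zero    (suc (suc j)) = refl
1+t≈ (suc i) j             = refl

1-t≈ : P2.const 1ℚ P2.- P2.t R2.≈ P2.inT 1-x
1-t≈ zero    zero          = refl
1-t≈ zero    (suc zero)    = refl
1-t≈ zero    (suc (suc j)) = refl
1-t≈ (suc i) j             = refl

4x : PS1
4x n = fromℕ 4 ℚ.* P1.var n

4s≈ : P2.scale (fromℕ 4) P2.s R2.≈ P2.inS 4x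
4s≈ zero          zero    = refl
4s≈ zero          (suc j) = refl
4s≈ (suc zero)    zero    = refl
4s≈ (suc zero)    (suc j) = refl
4s≈ (suc (suc i)) zero    = refl
4s≈ (suc (suc i)) (suc j) = refl

4t≈ : P2.scale (fromℕ 4) P2.t R2.≈ P2.inT 4x
4t≈ zero    zero          = refl
4t≈ zero    (suc zero)    = refl
4t≈ zero    (suc (suc j)) = refl
4t≈ (suc i) j             = refl

P2-inv-unique : ∀ f g → f P2.* g R2.≈ P2.const 1ℚ → f 0 0 ≡ 1ℚ → P2.inv f R2.≈ g
P2-inv-unique f g p f0 = inverse-unique P2-ring f (P2.inv f) g (P2-inverseʳ f f0) p

⊗-inverse : ∀ f g f′ g′ → f P1.* f′ R1.≈ P1.const 1ℚ → g P1.* g′ R1.≈ P1.const 1ℚ →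
  (P2.inS f P2.* P2.inT g) P2.* (P2.inS f′ P2.* P2.inT g′) R2.≈ P2.const 1ℚ
⊗-inverse f g f′ g′ p q = begin
  (P2.inS f P2.* P2.inT g) P2.* (P2.inS f′ P2.* P2.inT g′)
    ≈⟨ interchange (P2.inS f) (P2.inT g) (P2.inS f′) (P2.inT g′) ⟩
  (P2.inS f P2.* P2.inS f′) P2.* (P2.inT g P2.* P2.inT g′)
    ≈⟨ R2.*-cong (inS-homo-* f f′) (inT-homo-* g g′) ⟨
  P2.inS (f P1.* f′) P2.* P2.inT (g P1.* g′)
    ≈⟨ R2.*-cong (R2.trans (inS-cong p) inS-1) (R2.trans (inT-cong q) inT-1) ⟩
  P2.const 1ℚ P2.* P2.const 1ℚ
    ≈⟨ R2.*-identityˡ (P2.const 1ℚ) ⟩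
  P2.const 1ℚ ∎
  where
  open import Relation.Binary.Reasoning.Setoid R2.setoid
  open import Algebra.Properties.CommutativeSemigroup R2.*-commutativeSemigroup using (interchange)

-- The substituted argument `4x/(1+x)²` in one variable.
Q₄ : PS1
Q₄ = 4x P1.* (1+x⁻¹ P1.^ 2)

S₄≈ : S₄ R2.≈ P2.inS Q₄
S₄≈ = R2.trans (R2.*-cong 4s≈ (P2-inv-unique ((P2.const 1ℚ P2.+ P2.s) P2.^ 2) (P2.inS (1+x⁻¹ P1.^ 2)) isInverse refl))
               (R2.sym (inS-homo-* 4x (1+x⁻¹ P1.^ 2)))
  where
  isInverse : ((P2.const 1ℚ P2.+ P2.s) P2.^ 2) P2.* P2.inS (1+x⁻¹ P1.^ 2) R2.≈ P2.const 1ℚ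
  isInverse = R2.trans (R2.*-congʳ {P2.inS (1+x⁻¹ P1.^ 2)} (R2.trans (Pow2.^-cong 2 1+s≈) (R2.sym (inS-homo-^ 1+x 2))))
    (R2.trans (R2.sym (inS-homo-* (1+x P1.^ 2) (1+x⁻¹ P1.^ 2))) (R2.trans (inS-cong (Pow1.^-inverse 1+x 1+x⁻¹ 2 1+x-inverse)) inS-1))

T₄≈ : T₄ R2.≈ P2.inT Q₄
T₄≈ = R2.trans (R2.*-cong 4t≈ (P2-inv-unique ((P2.const 1ℚ P2.+ P2.t) P2.^ 2) (P2.inT (1+x⁻¹ P1.^ 2)) isInverse refl))
               (R2.sym (inT-homo-* 4x (1+x⁻¹ P1.^ 2)))
  where
  isInverse : ((P2.const 1ℚ P2.+ P2.t) P2.^ 2) P2.* P2.inT (1+x⁻¹ P1.^ 2) R2.≈ P2.const 1ℚ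
  isInverse = R2.trans (R2.*-congʳ {P2.inT (1+x⁻¹ P1.^ 2)} (R2.trans (Pow2.^-cong 2 1+t≈) (R2.sym (inT-homo-^ 1+x 2))))
    (R2.trans (R2.sym (inT-homo-* (1+x P1.^ 2) (1+x⁻¹ P1.^ 2))) (R2.trans (inT-cong (Pow1.^-inverse 1+x 1+x⁻¹ 2 1+x-inverse)) inT-1))

sumℚ-cong : ∀ {A : Set} {f g : A → ℚ} → (∀ x → f x ≡ g x) → ∀ xs → sumℚ (map f xs) ≡ sumℚ (map g xs)
sumℚ-cong p []       = refl
sumℚ-cong p (x ∷ xs) = cong₂ ℚ._+_ (p x) (sumℚ-cong p xs)

const-0 : P2.const 0ℚ R2.≈ R2.0#
const-0 zero    zero    = refl
const-0 zero    (suc j) = refl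
const-0 (suc i) j       = refl

P2-sum-eval : ∀ {A : Set} (F : A → PS2) xs i j → P2.sum (map F xs) i j ≡ sumℚ (map (λ x → F x i j) xs)
P2-sum-eval F []       i j = const-0 i j
P2-sum-eval F (x ∷ xs) i j = cong (F x i j ℚ.+_) (P2-sum-eval F xs i j)

*-distrib-sum : ∀ {A : Set} G (F : A → PS2) xs → G P2.* P2.sum (map F xs) R2.≈ P2.sum (map (λ x → G P2.* F x) xs)
*-distrib-sum G F []       = R2.trans (R2.*-congˡ {G} const-0) (R2.trans (R2.zeroʳ G) (R2.sym const-0))
*-distrib-sum G F (x ∷ xs) = R2.trans (R2.distribˡ G (F x) (P2.sum (map F xs)))
                                      (R2.+-congˡ {G P2.* F x} (*-distrib-sum G F xs))

^-const : ∀ f k → f 0 ≡ 1ℚ → (f P1.^ k) 0 ≡ 1ℚ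
^-const f zero    f0 = refl
^-const f (suc k) f0 = trans (PSℚ.⊛-zero f (f P1.^ k)) (cong₂ ℚ._*_ f0 (^-const f k f0))

inv-⊗ : ∀ F f g → F R2.≈ (P2.inS f P2.* P2.inT f) → f P1.* g R1.≈ P1.const 1ℚ → f 0 ≡ 1ℚ →
        P2.inv F R2.≈ (P2.inS g P2.* P2.inT g)
inv-⊗ F f g F≈ fg≈1 f0 = P2-inv-unique F (P2.inS g P2.* P2.inT g)
  (R2.trans (R2.*-congʳ {P2.inS g P2.* P2.inT g} F≈) (⊗-inverse f f g g fg≈1 fg≈1))
  (trans (F≈ 0 0) (trans (inS-*-inT f f 0 0) (cong₂ ℚ._*_ f0 f0)))

inv-[1-s]^k[1-t]^k : ∀ k → P2.inv (((P2.const 1ℚ P2.- P2.s) P2.^ k) P2.* ((P2.const 1ℚ P2.- P2.t) P2.^ k))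
                     R2.≈ (P2.inS (ones P1.^ k) P2.* P2.inT (ones P1.^ k))
inv-[1-s]^k[1-t]^k k = inv-⊗ (((P2.const 1ℚ P2.- P2.s) P2.^ k) P2.* ((P2.const 1ℚ P2.- P2.t) P2.^ k)) (1-x P1.^ k) (ones P1.^ k)
  (R2.*-cong (R2.trans (Pow2.^-cong k 1-s≈) (R2.sym (inS-homo-^ 1-x k)))
             (R2.trans (Pow2.^-cong k 1-t≈) (R2.sym (inT-homo-^ 1-x k))))
  (Pow1.^-inverse 1-x ones k ones-inverse) (^-const 1-x k refl)

inv-[[1-s][1-t]]^k : ∀ k → P2.inv (((P2.const 1ℚ P2.- P2.s) P2.* (P2.const 1ℚ P2.- P2.t)) P2.^ k)
                     R2.≈ (P2.inS (ones P1.^ k) P2.* P2.inT (ones P1.^ k))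
inv-[[1-s][1-t]]^k k = inv-⊗ (((P2.const 1ℚ P2.- P2.s) P2.* (P2.const 1ℚ P2.- P2.t)) P2.^ k) (1-x P1.^ k) (ones P1.^ k)
  (R2.trans (Pow2.^-cong k (R2.*-cong 1-s≈ 1-t≈)) (R2.trans (Pow2.^-distrib-* (P2.inS 1-x) (P2.inT 1-x) k)
    (R2.*-cong (R2.sym (inS-homo-^ 1-x k)) (R2.sym (inT-homo-^ 1-x k)))))
  (Pow1.^-inverse 1-x ones k ones-inverse) (^-const 1-x k refl)

inv-[1-s][1-t] : ∀ i j → P2.inv ((P2.const 1ℚ P2.- P2.s) P2.* (P2.const 1ℚ P2.- P2.t)) i j ≡ 1ℚ
inv-[1-s][1-t] i j = trans (inv-⊗ ((P2.const 1ℚ P2.- P2.s) P2.* (P2.const 1ℚ P2.- P2.t)) 1-x ones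
  (R2.*-cong 1-s≈ 1-t≈) ones-inverse refl i j) (inS-*-inT ones ones i j)

-- `(1+x)ⁿ/(1-x)ⁿ⁺¹ · (4x/(1+x)²)ᵖ`: what a permutation of `[n]` with `p` left peaks contributes in
-- one variable.
G : ℕ → ℕ → PS1
G n p = (1+x P1.^ n) P1.* ((ones P1.^ suc n) P1.* (Q₄ P1.^ p))

LHS-coeff : ∀ n i j → LHS n i j ≡ sumℚ (map (λ w → G n (lpk w) i ℚ.* G n (ilpk w) j) (Sym n))
LHS-coeff n i j = begin
  (A P2.* (I P2.* P2.sum (map F (Sym n)))) i j
    ≡⟨ R2.trans (R2.*-congˡ {A} (*-distrib-sum I F (Sym n))) (*-distrib-sum A (λ w → I P2.* F w) (Sym n)) i j ⟩
  P2.sum (map (λ w → A P2.* (I P2.* F w)) (Sym n)) i j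
    ≡⟨ P2-sum-eval (λ w → A P2.* (I P2.* F w)) (Sym n) i j ⟩
  sumℚ (map (λ w → (A P2.* (I P2.* F w)) i j) (Sym n))
    ≡⟨ sumℚ-cong (λ w → trans (factor (lpk w) (ilpk w) i j) (inS-*-inT (G n (lpk w)) (G n (ilpk w)) i j)) (Sym n) ⟩
  sumℚ (map (λ w → G n (lpk w) i ℚ.* G n (ilpk w) j) (Sym n)) ∎
  where
  open ≡-Reasoning
  A I : PS2
  A = ((P2.const 1ℚ P2.+ P2.s) P2.* (P2.const 1ℚ P2.+ P2.t)) P2.^ n
  I = P2.inv (((P2.const 1ℚ P2.- P2.s) P2.* (P2.const 1ℚ P2.- P2.t)) P2.^ suc n)
  F : _ → PS2
  F w = (S₄ P2.^ lpk w) P2.* (T₄ P2.^ ilpk w)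
  a b : PS1
  a = 1+x P1.^ n
  b = ones P1.^ suc n

  A≈ : A R2.≈ (P2.inS a P2.* P2.inT a)
  A≈ = R2.trans (Pow2.^-cong n (R2.*-cong 1+s≈ 1+t≈)) (R2.trans (Pow2.^-distrib-* (P2.inS 1+x) (P2.inT 1+x) n)
    (R2.*-cong (R2.sym (inS-homo-^ 1+x n)) (R2.sym (inT-homo-^ 1+x n))))

  factor : ∀ p q → A P2.* (I P2.* ((S₄ P2.^ p) P2.* (T₄ P2.^ q))) R2.≈ (P2.inS (G n p) P2.* P2.inT (G n q))
  factor p q = begin′
    A P2.* (I P2.* ((S₄ P2.^ p) P2.* (T₄ P2.^ q)))
      ≈⟨ R2.*-cong A≈ (R2.*-cong (inv-[[1-s][1-t]]^k (suc n))
           (R2.*-cong (R2.trans (Pow2.^-cong p S₄≈) (R2.sym (inS-homo-^ Q₄ p)))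
                      (R2.trans (Pow2.^-cong q T₄≈) (R2.sym (inT-homo-^ Q₄ q))))) ⟩
    (P2.inS a P2.* P2.inT a) P2.* ((P2.inS b P2.* P2.inT b) P2.* (P2.inS c P2.* P2.inT d))
      ≈⟨ R2.*-congˡ {P2.inS a P2.* P2.inT a} (interchange (P2.inS b) (P2.inT b) (P2.inS c) (P2.inT d)) ⟩
    (P2.inS a P2.* P2.inT a) P2.* ((P2.inS b P2.* P2.inS c) P2.* (P2.inT b P2.* P2.inT d))
      ≈⟨ interchange (P2.inS a) (P2.inT a) (P2.inS b P2.* P2.inS c) (P2.inT b P2.* P2.inT d) ⟩
    (P2.inS a P2.* (P2.inS b P2.* P2.inS c)) P2.* (P2.inT a P2.* (P2.inT b P2.* P2.inT d))
      ≈⟨ R2.*-cong (R2.trans (inS-homo-* a (b P1.* c)) (R2.*-congˡ {P2.inS a} (inS-homo-* b c)))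
                   (R2.trans (inT-homo-* a (b P1.* d)) (R2.*-congˡ {P2.inT a} (inT-homo-* b d))) ⟨
    P2.inS (G n p) P2.* P2.inT (G n q) ∎′
    where
    open import Relation.Binary.Reasoning.Setoid R2.setoid renaming (begin_ to begin′_; _∎ to _∎′)
    open import Algebra.Properties.CommutativeSemigroup R2.*-commutativeSemigroup using (interchange)
    c d : PS1
    c = Q₄ P1.^ p
    d = Q₄ P1.^ q

-- Dividing `B k` by `(1-x)^(k+1)` undoes its definition and gives back the series of `(2m+1)^k`, so
-- the Eulerian polynomials disappear from the coefficients.
RHSc-coeff : ∀ n i j → RHSc n i j ≡ (+ 1 / (n !)) ⦃ n !≢0 ⦄ ℚ.*
  sumℚ (map (λ k → fromℕ (e n k) ℚ.* (fromℕ ((2 ℕ.* i ℕ.+ 1) ℕ.^ k) ℚ.* fromℕ ((2 ℕ.* j ℕ.+ 1) ℕ.^ k))) (upTo (suc n)))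
RHSc-coeff n i j = cong ((+ 1 / (n !)) ⦃ n !≢0 ⦄ ℚ.*_)
  (trans (P2-sum-eval (λ k → P2.scale (fromℕ (e n k)) (term k)) (upTo (suc n)) i j)
         (sumℚ-cong (λ k → cong (fromℕ (e n k) ℚ.*_) (trans (term≈ k i j) (inS-*-inT (odd k) (odd k) i j))) (upTo (suc n))))
  where
  odd : ℕ → PS1
  odd k m = fromℕ ((2 ℕ.* m ℕ.+ 1) ℕ.^ k)
  term : ℕ → PS2
  term k = (P2.inS (B k) P2.* P2.inT (B k))
           P2.* P2.inv (((P2.const 1ℚ P2.- P2.s) P2.^ suc k) P2.* ((P2.const 1ℚ P2.- P2.t) P2.^ suc k))
  open import Algebra.Properties.CommutativeSemigroup R2.*-commutativeSemigroup using (interchange)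
  B-inv : ∀ k → B k P1.* (ones P1.^ suc k) R1.≈ odd k
  B-inv k = begin
    ((1-x P1.^ suc k) P1.* odd k) P1.* (ones P1.^ suc k)
      ≈⟨ R1.*-congʳ {ones P1.^ suc k} (R1.*-comm (1-x P1.^ suc k) (odd k)) ⟩
    (odd k P1.* (1-x P1.^ suc k)) P1.* (ones P1.^ suc k)
      ≈⟨ R1.*-assoc (odd k) (1-x P1.^ suc k) (ones P1.^ suc k) ⟩
    odd k P1.* ((1-x P1.^ suc k) P1.* (ones P1.^ suc k))
      ≈⟨ R1.*-congˡ {odd k} (Pow1.^-inverse 1-x ones (suc k) ones-inverse) ⟩
    odd k P1.* P1.const 1ℚ
      ≈⟨ R1.*-identityʳ (odd k) ⟩
    odd k ∎
    where open import Relation.Binary.Reasoning.Setoid R1.setoid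
  term≈ : ∀ k → term k R2.≈ (P2.inS (odd k) P2.* P2.inT (odd k))
  term≈ k = R2.trans (R2.*-congˡ {P2.inS (B k) P2.* P2.inT (B k)} (inv-[1-s]^k[1-t]^k (suc k)))
    (R2.trans (interchange (P2.inS (B k)) (P2.inT (B k)) (P2.inS y) (P2.inT y))
    (R2.*-cong (R2.trans (R2.sym (inS-homo-* (B k) y)) (inS-cong (B-inv k)))
               (R2.trans (R2.sym (inT-homo-* (B k) y)) (inT-cong (B-inv k)))))
    where
    y : PS1
    y = ones P1.^ suc k

fromℕ-homo-+ : ∀ m n → fromℕ (m ℕ.+ n) ≡ fromℕ m ℚ.+ fromℕ n
fromℕ-homo-+ m n = ℚ.toℚᵘ-injective (begin
  ℚ.toℚᵘ (fromℕ (m ℕ.+ n))                       ≈⟨ ℚ.toℚᵘ-fromℚᵘ (ι (m ℕ.+ n)) ⟩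
  ι (m ℕ.+ n)                                    ≈⟨ ℚᵘ.*≡* (cong (ℤ._* + 1) (sym (cong₂ ℤ._+_ (ℤ.*-identityʳ (+ m)) (ℤ.*-identityʳ (+ n))))) ⟩
  ι m ℚᵘ.+ ι n                                   ≈⟨ ℚᵘ.+-cong (ℚ.toℚᵘ-fromℚᵘ (ι m)) (ℚ.toℚᵘ-fromℚᵘ (ι n)) ⟨
  ℚ.toℚᵘ (fromℕ m) ℚᵘ.+ ℚ.toℚᵘ (fromℕ n)         ≈⟨ ℚ.toℚᵘ-homo-+ (fromℕ m) (fromℕ n) ⟨
  ℚ.toℚᵘ (fromℕ m ℚ.+ fromℕ n)                   ∎)
  where
  open ℚᵘ.≃-Reasoning

  ι : ℕ → ℚᵘ.ℚᵘ
  ι k = ℚᵘ.mkℚᵘ (+ k) 0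

fromℕ-homo-* : ∀ m n → fromℕ (m ℕ.* n) ≡ fromℕ m ℚ.* fromℕ n
fromℕ-homo-* m n = ℚ.toℚᵘ-injective (begin
  ℚ.toℚᵘ (fromℕ (m ℕ.* n))                       ≈⟨ ℚ.toℚᵘ-fromℚᵘ (ι (m ℕ.* n)) ⟩
  ι (m ℕ.* n)                                    ≈⟨ ℚᵘ.*≡* (cong (ℤ._* + 1) (ℤ.pos-* m n)) ⟩
  ι m ℚᵘ.* ι n                                   ≈⟨ ℚᵘ.*-cong (ℚ.toℚᵘ-fromℚᵘ (ι m)) (ℚ.toℚᵘ-fromℚᵘ (ι n)) ⟨
  ℚ.toℚᵘ (fromℕ m) ℚᵘ.* ℚ.toℚᵘ (fromℕ n)         ≈⟨ ℚ.toℚᵘ-homo-* (fromℕ m) (fromℕ n) ⟨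
  ℚ.toℚᵘ (fromℕ m ℚ.* fromℕ n)                   ∎)
  where
  open ℚᵘ.≃-Reasoning

  ι : ℕ → ℚᵘ.ℚᵘ
  ι k = ℚᵘ.mkℚᵘ (+ k) 0

fromℕ-sum : ∀ {A : Set} (f : A → ℕ) xs → fromℕ (sumℕ (map f xs)) ≡ sumℚ (map (fromℕ ∘ f) xs)
fromℕ-sum f []       = refl
fromℕ-sum f (x ∷ xs) = trans (fromℕ-homo-+ (f x) _) (cong (fromℕ (f x) ℚ.+_) (fromℕ-sum f xs))

-- Delannoy numbers as the right sides of (a) and (b)

Delannoy : ℕ → ℕ → ℕ
Delannoy zero    n       = 1
Delannoy (suc m) zero    = 1
Delannoy (suc m) (suc n) = Delannoy (suc m) n ℕ.+ Delannoy m (suc n) ℕ.+ Delannoy m n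

Delannoy-0 : ∀ m → Delannoy m 0 ≡ 1
Delannoy-0 zero    = refl
Delannoy-0 (suc m) = refl

ones-*-zero : ∀ h → (ones P1.* h) 0 ≡ h 0
ones-*-zero h = trans (PSℚ.⊛-zero ones h) (ℚ.*-identityˡ (h 0))

ones-*-suc : ∀ h n → (ones P1.* h) (suc n) ≡ h (suc n) ℚ.+ (ones P1.* h) n
ones-*-suc h n = trans (PSℚ.⊛-suc ones h n) (cong (ℚ._+ (ones P1.* h) n) (ℚ.*-identityˡ (h (suc n))))

-- Over an arbitrary commutative ring the operations stay opaque to the solver. A factor `a * z`
-- stands for `1+x` times its reciprocal. That this product is 1 is no ring identity, so the factor
-- is inserted before the identity is applied.
module RingIdentities {c ℓ} (R : CommutativeRing c ℓ) where
  open CommutativeRing R using (_≈_; _+_; _*_; 1#; commutativeSemiring) renaming (refl to ≈-refl)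
  open import Algebra.Solver.Ring.NaturalCoefficients.Default commutativeSemiring using (solve; con; _:=_; _:+_; _:*_)

  G-sucˡ-identity : ∀ a b o c q → (a * b) * ((o * c) * q) ≈ o * (a * (b * (c * q)))
  G-sucˡ-identity = solve 5 (λ a b o c q → (a :* b) :* ((o :* c) :* q) := o :* (a :* (b :* (c :* q)))) ≈-refl

  G-sucʳ-identity : ∀ a b q c → a * (b * (q * c)) ≈ q * (a * (b * c))
  G-sucʳ-identity = solve 4 (λ a b q c → a :* (b :* (q :* c)) := q :* (a :* (b :* c))) ≈-refl

  ascent-ascent-identity : ∀ o g x → o * (g + x * g) ≈ o * ((1# + x) * g)
  ascent-ascent-identity = solve 3 (λ o g x → o :* (g :+ x :* g) := o :* ((con 1 :+ x) :* g)) ≈-refl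

  ascent-descent-identity : ∀ a z o g → (a * z) * (o * (g + g)) ≈ ((1# + 1#) * z) * (o * (a * g))
  ascent-descent-identity = solve 4 (λ a z o g → (a :* z) :* (o :* (g :+ g)) := ((con 1 :+ con 1) :* z) :* (o :* (a :* g))) ≈-refl

  descent-ascent-identity : ∀ a z o x g → (a * z) * (o * (x * (((1# + 1#) * z) * g) + x * (((1# + 1#) * z) * g))) ≈ (((x + x) + x) + x) * (z * (z * 1#)) * (o * (a * g))
  descent-ascent-identity = solve 5 (λ a z o x g → (a :* z) :* (o :* (x :* (((con 1 :+ con 1) :* z) :* g) :+ x :* (((con 1 :+ con 1) :* z) :* g))) := (((x :+ x) :+ x) :+ x) :* (z :* (z :* con 1)) :* (o :* (a :* g))) ≈-refl

  descent-descent-identity : ∀ o x t g → o * (x * (t * g) + t * g) ≈ t * (o * ((1# + x) * g))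
  descent-descent-identity = solve 4 (λ o x t g → o :* (x :* (t :* g) :+ t :* g) := t :* (o :* ((con 1 :+ x) :* g))) ≈-refl

module Id = RingIdentities P1-ring

G-sucˡ : ∀ n p → G (suc n) p R1.≈ (ones P1.* (1+x P1.* G n p))
G-sucˡ n p = Id.G-sucˡ-identity 1+x (1+x P1.^ n) ones (ones P1.^ suc n) (Q₄ P1.^ p)

-- The Delannoy recursion is `(1-x) · G (suc m) 0 = (1+x) · G m 0` read coefficient by coefficient.
Delannoy-G : ∀ m n → G m 0 n ≡ fromℕ (Delannoy m n)
Delannoy-G zero n = trans (R1.*-identityˡ ((ones P1.^ 1) P1.* P1.const 1ℚ) n) (trans (R1.*-identityʳ (ones P1.^ 1) n) (R1.*-identityʳ ones n))
Delannoy-G (suc m) zero = trans (G-sucˡ m 0 0) (trans (ones-*-zero (1+x P1.* G m 0)) (trans (1+x-*-zero (G m 0)) (trans (Delannoy-G m 0) (cong fromℕ (Delannoy-0 m)))))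
Delannoy-G (suc m) (suc n) = begin
  G (suc m) 0 (suc n)
    ≡⟨ G-sucˡ m 0 (suc n) ⟩
  (ones P1.* (1+x P1.* G m 0)) (suc n)
    ≡⟨ ones-*-suc (1+x P1.* G m 0) n ⟩
  (1+x P1.* G m 0) (suc n) ℚ.+ (ones P1.* (1+x P1.* G m 0)) n
    ≡⟨ cong₂ ℚ._+_ (1+x-*-suc (G m 0) n) (sym (G-sucˡ m 0 n)) ⟩
  (G m 0 (suc n) ℚ.+ G m 0 n) ℚ.+ G (suc m) 0 n
    ≡⟨ cong₂ ℚ._+_ (cong₂ ℚ._+_ (Delannoy-G m (suc n)) (Delannoy-G m n)) (Delannoy-G (suc m) n) ⟩
  (fromℕ (Delannoy m (suc n)) ℚ.+ fromℕ (Delannoy m n)) ℚ.+ fromℕ (Delannoy (suc m) n)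
    ≡⟨ cong (ℚ._+ fromℕ (Delannoy (suc m) n)) (fromℕ-homo-+ (Delannoy m (suc n)) (Delannoy m n)) ⟨
  fromℕ (Delannoy m (suc n) ℕ.+ Delannoy m n) ℚ.+ fromℕ (Delannoy (suc m) n)
    ≡⟨ fromℕ-homo-+ (Delannoy m (suc n) ℕ.+ Delannoy m n) (Delannoy (suc m) n) ⟨
  fromℕ (Delannoy m (suc n) ℕ.+ Delannoy m n ℕ.+ Delannoy (suc m) n)
    ≡⟨ cong fromℕ (trans (ℕ.+-comm _ (Delannoy (suc m) n)) (sym (ℕ.+-assoc (Delannoy (suc m) n) _ _))) ⟩
  fromℕ (Delannoy (suc m) (suc n)) ∎
  where open ≡-Reasoning

P1-inv-[1-x]^k : ∀ k → P1.inv (1-x P1.^ k) R1.≈ (ones P1.^ k)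
P1-inv-[1-x]^k k = inverse-unique P1-ring (1-x P1.^ k) (P1.inv (1-x P1.^ k)) (ones P1.^ k)
  (P1-inverseʳ (1-x P1.^ k) (^-const 1-x k refl)) (Pow1.^-inverse 1-x ones k ones-inverse)

RHSaCoeff-Delannoy : ∀ m n → RHSaCoeff m n ≡ fromℕ (Delannoy m n)
RHSaCoeff-Delannoy m n = trans
  (R1.*-congˡ {1+x P1.^ m} (R1.trans (P1-inv-[1-x]^k (suc m)) (R1.sym (R1.*-identityʳ (ones P1.^ suc m)))) n)
  (Delannoy-G m n)

[1+x]^m-coeff : ∀ m k → (1+x P1.^ m) k ≡ fromℕ (m C k)
[1+x]^m-coeff zero    zero    = refl
[1+x]^m-coeff zero    (suc k) = cong fromℕ (sym (k>n⇒nCk≡0 {0} {suc k} (s≤s z≤n)))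
[1+x]^m-coeff (suc m) zero    = trans (1+x-*-zero (1+x P1.^ m)) ([1+x]^m-coeff m 0)
[1+x]^m-coeff (suc m) (suc k) = begin
  (1+x P1.* (1+x P1.^ m)) (suc k)               ≡⟨ 1+x-*-suc (1+x P1.^ m) k ⟩
  (1+x P1.^ m) (suc k) ℚ.+ (1+x P1.^ m) k       ≡⟨ cong₂ ℚ._+_ ([1+x]^m-coeff m (suc k)) ([1+x]^m-coeff m k) ⟩
  fromℕ (m C suc k) ℚ.+ fromℕ (m C k)           ≡⟨ fromℕ-homo-+ (m C suc k) (m C k) ⟨
  fromℕ (m C suc k ℕ.+ m C k)                   ≡⟨ cong fromℕ (trans (ℕ.+-comm (m C suc k) (m C k)) (nCk+nC[k+1]≡[n+1]C[k+1] m k)) ⟩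
  fromℕ (suc m C suc k)                         ∎
  where open ≡-Reasoning

ones^-coeff : ∀ m k → (ones P1.^ suc m) k ≡ fromℕ ((m ℕ.+ k) C k)
ones^-coeff zero    k    = trans (R1.*-identityʳ ones k) (cong fromℕ (sym (nCn≡1 k)))
ones^-coeff (suc m) zero = trans (ones-*-zero (ones P1.^ suc m)) (ones^-coeff m 0)
ones^-coeff (suc m) (suc k) = begin
  (ones P1.* (ones P1.^ suc m)) (suc k)
    ≡⟨ ones-*-suc (ones P1.^ suc m) k ⟩
  (ones P1.^ suc m) (suc k) ℚ.+ (ones P1.^ suc (suc m)) k
    ≡⟨ cong₂ ℚ._+_ (ones^-coeff m (suc k)) (ones^-coeff (suc m) k) ⟩
  fromℕ ((m ℕ.+ suc k) C suc k) ℚ.+ fromℕ ((suc m ℕ.+ k) C k)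
    ≡⟨ fromℕ-homo-+ ((m ℕ.+ suc k) C suc k) ((suc m ℕ.+ k) C k) ⟨
  fromℕ ((m ℕ.+ suc k) C suc k ℕ.+ (suc m ℕ.+ k) C k)
    ≡⟨ cong fromℕ pascal ⟩
  fromℕ ((suc m ℕ.+ suc k) C suc k) ∎
  where
  open ≡-Reasoning
  pascal : (m ℕ.+ suc k) C suc k ℕ.+ (suc m ℕ.+ k) C k ≡ (suc m ℕ.+ suc k) C suc k
  pascal = trans (ℕ.+-comm ((m ℕ.+ suc k) C suc k) _)
    (trans (cong (λ q → q C k ℕ.+ (m ℕ.+ suc k) C suc k) (sym (ℕ.+-suc m k))) (nCk+nC[k+1]≡[n+1]C[k+1] (m ℕ.+ suc k) k))

-- The sum over `k` is the Cauchy product of `(1+x)^m` and `1/(1-x)^(m+1)`, so (b) is (a) with the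
-- coefficient of xⁿ written out.
RHSb-Delannoy : ∀ n i j → RHSb n i j ≡ fromℕ (Delannoy (μ i j) n)
RHSb-Delannoy n i j = begin
  RHSb n i j
    ≡⟨ fromℕ-sum (λ k → (m C k) ℕ.* ((m ℕ.+ (n ∸ k)) C (n ∸ k))) (upTo (suc n)) ⟩
  sumℚ (map (λ k → fromℕ ((m C k) ℕ.* ((m ℕ.+ (n ∸ k)) C (n ∸ k)))) (upTo (suc n)))
    ≡⟨ sumℚ-cong (λ k → trans (fromℕ-homo-* (m C k) ((m ℕ.+ (n ∸ k)) C (n ∸ k))) (cong₂ ℚ._*_ (sym ([1+x]^m-coeff m k)) (sym (ones^-coeff m (n ∸ k))))) (upTo (suc n)) ⟩
  ((1+x P1.^ m) P1.* (ones P1.^ suc m)) n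
    ≡⟨ R1.*-congˡ {1+x P1.^ m} (P1-inv-[1-x]^k (suc m)) n ⟨
  RHSaCoeff m n
    ≡⟨ RHSaCoeff-Delannoy m n ⟩
  fromℕ (Delannoy m n) ∎
  where
  open ≡-Reasoning
  m : ℕ
  m = μ i j

-- Compatible words and the peaks of the pattern

even : ℕ → Bool
even zero          = true
even (suc zero)    = false
even (suc (suc k)) = even k

∑< : ℕ → (ℕ → ℕ) → ℕ
∑< zero    f = 0
∑< (suc n) f = ∑< n f ℕ.+ f n

_==_ : Bool → Bool → Bool
true  == b = b
false == b = not b

-- true stands for an ascent, false for a descent.
peaks : List Bool → ℕ
peaks []                 = 0
peaks (false ∷ l)        = peaks l
peaks (true ∷ [])        = 0
peaks (true ∷ true ∷ l)  = peaks (true ∷ l)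
peaks (true ∷ false ∷ l) = suc (peaks l)

-- The number of ways to continue a compatible weakly increasing word along the pattern ds when r letters of the alphabet
-- lie above the current one; in an alphabet 0, …, 2i, r has the parity of the current letter.
chains : List Bool → ℕ → ℕ
chains []       r = 1
chains (d ∷ ds) r = ∑< r (chains ds) ℕ.+ (if even r == d then chains ds r else 0)

even-2* : ∀ i → even (i ℕ.* 2) ≡ true
even-2* zero    = refl
even-2* (suc i) = even-2* i

odd-2* : ∀ i → even (suc (i ℕ.* 2)) ≡ false
odd-2* zero    = refl
odd-2* (suc i) = odd-2* i

chains-true-even : ∀ l i → chains (true ∷ l) (i ℕ.* 2) ≡ ∑< (suc (i ℕ.* 2)) (chains l)
chains-true-even l i rewrite even-2* i = refl

chains-true-odd : ∀ l i → chains (true ∷ l) (suc (i ℕ.* 2)) ≡ ∑< (suc (i ℕ.* 2)) (chains l)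
chains-true-odd l i rewrite odd-2* i = ℕ.+-identityʳ _

chains-false-even : ∀ l i → chains (false ∷ l) (i ℕ.* 2) ≡ ∑< (i ℕ.* 2) (chains l)
chains-false-even l i rewrite even-2* i = ℕ.+-identityʳ _

chains-false-odd : ∀ l i → chains (false ∷ l) (suc (i ℕ.* 2)) ≡ ∑< (suc (suc (i ℕ.* 2))) (chains l)
chains-false-odd l i rewrite odd-2* i = refl

-- Whether the current letter may repeat depends on the parity of `r`. Split by this parity, the
-- counts form two series on which each entry of the pattern acts linearly.
evens odds : List Bool → PS1
evens l i = fromℕ (chains l (i ℕ.* 2))
odds  l i = fromℕ (chains l (suc (i ℕ.* 2)))

-- `S i` is the interleaved partial sum `a 0 + b 0 + a 1 + … + a i`. The terms of `b` lag one index
-- behind, whence the factor `P1.var`.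
prefix-series : (a b : ℕ → ℕ) (S : ℕ → ℕ) → S 0 ≡ a 0 → (∀ i → S (suc i) ≡ S i ℕ.+ b i ℕ.+ a (suc i)) →
  ∀ i → fromℕ (S i) ≡ (ones P1.* ((fromℕ ∘ a) P1.+ (P1.var P1.* (fromℕ ∘ b)))) i
prefix-series a b S S0 Ssuc zero = begin
  fromℕ (S 0)                       ≡⟨ cong fromℕ S0 ⟩
  fromℕ (a 0)                       ≡⟨ ℚ.+-identityʳ _ ⟨
  fromℕ (a 0) ℚ.+ 0ℚ                ≡⟨ cong (fromℕ (a 0) ℚ.+_) (var-*-zero (fromℕ ∘ b)) ⟨
  fromℕ (a 0) ℚ.+ (P1.var P1.* (fromℕ ∘ b)) 0 ≡⟨ ones-*-zero ((fromℕ ∘ a) P1.+ (P1.var P1.* (fromℕ ∘ b))) ⟨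
  (ones P1.* ((fromℕ ∘ a) P1.+ (P1.var P1.* (fromℕ ∘ b)))) 0 ∎
  where open ≡-Reasoning
prefix-series a b S S0 Ssuc (suc i) = begin
  fromℕ (S (suc i))
    ≡⟨ cong fromℕ (Ssuc i) ⟩
  fromℕ (S i ℕ.+ b i ℕ.+ a (suc i))
    ≡⟨ cong fromℕ (trans (ℕ.+-comm (S i ℕ.+ b i) _) (trans (cong (a (suc i) ℕ.+_) (ℕ.+-comm (S i) (b i))) (sym (ℕ.+-assoc (a (suc i)) (b i) (S i))))) ⟩
  fromℕ (a (suc i) ℕ.+ b i ℕ.+ S i)
    ≡⟨ fromℕ-homo-+ (a (suc i) ℕ.+ b i) (S i) ⟩
  fromℕ (a (suc i) ℕ.+ b i) ℚ.+ fromℕ (S i)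
    ≡⟨ cong₂ ℚ._+_ (trans (fromℕ-homo-+ (a (suc i)) (b i)) (cong (fromℕ (a (suc i)) ℚ.+_) (sym (var-*-suc (fromℕ ∘ b) i)))) (prefix-series a b S S0 Ssuc i) ⟩
  H (suc i) ℚ.+ (ones P1.* H) i
    ≡⟨ ones-*-suc H i ⟨
  (ones P1.* H) (suc i) ∎
  where
  open ≡-Reasoning
  H : PS1
  H = (fromℕ ∘ a) P1.+ (P1.var P1.* (fromℕ ∘ b))

evens-true : ∀ l → evens (true ∷ l) R1.≈ (ones P1.* (evens l P1.+ (P1.var P1.* odds l)))
evens-true l i = trans (cong fromℕ (chains-true-even l i))
  (prefix-series (λ i → chains l (i ℕ.* 2)) (λ i → chains l (suc (i ℕ.* 2))) (λ i → ∑< (suc (i ℕ.* 2)) (chains l)) refl (λ _ → refl) i)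

odds-true : ∀ l → odds (true ∷ l) R1.≈ evens (true ∷ l)
odds-true l i = cong fromℕ (trans (chains-true-odd l i) (sym (chains-true-even l i)))

odds-false : ∀ l → odds (false ∷ l) R1.≈ (ones P1.* (evens l P1.+ odds l))
odds-false l i = trans (cong fromℕ (chains-false-odd l i)) (go i)
  where
  open ≡-Reasoning
  S : ℕ → ℕ
  S i = ∑< (suc (suc (i ℕ.* 2))) (chains l)
  go : ∀ i → fromℕ (S i) ≡ (ones P1.* (evens l P1.+ odds l)) i
  go zero = trans (fromℕ-homo-+ (chains l 0) (chains l 1)) (sym (ones-*-zero (evens l P1.+ odds l)))
  go (suc i) = begin
    fromℕ (S i ℕ.+ a ℕ.+ b)                         ≡⟨ cong fromℕ (trans (ℕ.+-assoc (S i) a b) (ℕ.+-comm (S i) (a ℕ.+ b))) ⟩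
    fromℕ (a ℕ.+ b ℕ.+ S i)                         ≡⟨ fromℕ-homo-+ (a ℕ.+ b) (S i) ⟩
    fromℕ (a ℕ.+ b) ℚ.+ fromℕ (S i)                 ≡⟨ cong₂ ℚ._+_ (fromℕ-homo-+ a b) (go i) ⟩
    (evens l P1.+ odds l) (suc i) ℚ.+ (ones P1.* (evens l P1.+ odds l)) i  ≡⟨ ones-*-suc (evens l P1.+ odds l) i ⟨
    (ones P1.* (evens l P1.+ odds l)) (suc i)       ∎
    where
    a b : ℕ
    a = chains l (suc i ℕ.* 2)
    b = chains l (suc (suc i ℕ.* 2))

evens-false : ∀ l → evens (false ∷ l) R1.≈ (P1.var P1.* odds (false ∷ l))
evens-false l zero    = trans (cong fromℕ (chains-false-even l 0)) (sym (var-*-zero (odds (false ∷ l))))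
evens-false l (suc i) = trans (cong fromℕ (trans (chains-false-even l (suc i)) (sym (chains-false-odd l i)))) (sym (var-*-suc (odds (false ∷ l)) i))

2/[1+x] : PS1
2/[1+x] = (P1.const 1ℚ P1.+ P1.const 1ℚ) P1.* 1+x⁻¹

4x≈ : 4x R1.≈ (((P1.var P1.+ P1.var) P1.+ P1.var) P1.+ P1.var)
4x≈ zero          = refl
4x≈ (suc zero)    = refl
4x≈ (suc (suc n)) = refl

G-sucʳ : ∀ n p → G n (suc p) R1.≈ (Q₄ P1.* G n p)
G-sucʳ n p = Id.G-sucʳ-identity (1+x P1.^ n) (ones P1.^ suc n) Q₄ (Q₄ P1.^ p)

-- The only two shapes that occur, the pattern being built up from its end. Relative to the factor
-- `(1+x)/(1-x)` of every step, passing to a descent from an ascent or the empty pattern costs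
-- `2/(1+x)` and passing back costs `2x/(1+x)`. The product is `4x/(1+x)²`, one peak.
ascentState descentState : ℕ → ℕ → List Bool → Set
ascentState  n p l = (evens l R1.≈ G n p) × (odds l R1.≈ G n p)
descentState n p l = (odds l R1.≈ (2/[1+x] P1.* G n p)) × (evens l R1.≈ (P1.var P1.* odds l))

State : List Bool → Set
State []          = ascentState 0 0 []
State (true  ∷ l) = ascentState (length (true ∷ l)) (peaks (true ∷ l)) (true ∷ l)
State (false ∷ l) = descentState (length (false ∷ l)) (peaks (false ∷ l)) (false ∷ l)

module _ where
  open import Relation.Binary.Reasoning.Setoid R1.setoid

  ascent-ascent : ∀ n p l → ascentState n p l → ascentState (suc n) p (true ∷ l)
  ascent-ascent n p l (E , O) = eq , R1.trans (odds-true l) eq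
    where
    eq : evens (true ∷ l) R1.≈ G (suc n) p
    eq = begin
      evens (true ∷ l)                                     ≈⟨ evens-true l ⟩
      ones P1.* (evens l P1.+ (P1.var P1.* odds l))        ≈⟨ R1.*-congˡ {ones} (R1.+-cong E (R1.*-congˡ {P1.var} O)) ⟩
      ones P1.* (G n p P1.+ (P1.var P1.* G n p))           ≈⟨ Id.ascent-ascent-identity ones (G n p) P1.var ⟩
      ones P1.* ((R1.1# P1.+ P1.var) P1.* G n p)           ≈⟨ G-sucˡ n p ⟨
      G (suc n) p                                          ∎

  ascent-descent : ∀ n p l → ascentState n p l → descentState (suc n) p (false ∷ l)
  ascent-descent n p l (E , O) = eq , evens-false l
    where
    eq : odds (false ∷ l) R1.≈ (2/[1+x] P1.* G (suc n) p)
    eq = begin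
      odds (false ∷ l)                                     ≈⟨ odds-false l ⟩
      ones P1.* (evens l P1.+ odds l)                      ≈⟨ R1.*-congˡ {ones} (R1.+-cong E O) ⟩
      ones P1.* (G n p P1.+ G n p)                         ≈⟨ R1.*-identityˡ (ones P1.* (G n p P1.+ G n p)) ⟨
      R1.1# P1.* (ones P1.* (G n p P1.+ G n p))            ≈⟨ R1.*-congʳ {ones P1.* (G n p P1.+ G n p)} 1+x-inverse ⟨
      (1+x P1.* 1+x⁻¹) P1.* (ones P1.* (G n p P1.+ G n p)) ≈⟨ Id.ascent-descent-identity 1+x 1+x⁻¹ ones (G n p) ⟩
      2/[1+x] P1.* (ones P1.* (1+x P1.* G n p))            ≈⟨ R1.*-congˡ {2/[1+x]} (G-sucˡ n p) ⟨
      2/[1+x] P1.* G (suc n) p                             ∎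

  descent-ascent : ∀ n p l → descentState n p l → ascentState (suc n) (suc p) (true ∷ l)
  descent-ascent n p l (O , E) = eq , R1.trans (odds-true l) eq
    where
    V : PS1
    V = 2/[1+x] P1.* G n p
    eq : evens (true ∷ l) R1.≈ G (suc n) (suc p)
    eq = begin
      evens (true ∷ l)                                     ≈⟨ evens-true l ⟩
      ones P1.* (evens l P1.+ (P1.var P1.* odds l))        ≈⟨ R1.*-congˡ {ones} (R1.+-cong (R1.trans E (R1.*-congˡ {P1.var} O)) (R1.*-congˡ {P1.var} O)) ⟩
      ones P1.* ((P1.var P1.* V) P1.+ (P1.var P1.* V))     ≈⟨ R1.*-identityˡ (ones P1.* ((P1.var P1.* V) P1.+ (P1.var P1.* V))) ⟨
      R1.1# P1.* (ones P1.* ((P1.var P1.* V) P1.+ (P1.var P1.* V)))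
        ≈⟨ R1.*-congʳ {ones P1.* ((P1.var P1.* V) P1.+ (P1.var P1.* V))} 1+x-inverse ⟨
      (1+x P1.* 1+x⁻¹) P1.* (ones P1.* ((P1.var P1.* V) P1.+ (P1.var P1.* V)))
        ≈⟨ Id.descent-ascent-identity 1+x 1+x⁻¹ ones P1.var (G n p) ⟩
      ((((P1.var P1.+ P1.var) P1.+ P1.var) P1.+ P1.var) P1.* (1+x⁻¹ P1.^ 2)) P1.* (ones P1.* (1+x P1.* G n p))
        ≈⟨ R1.*-cong (R1.*-congʳ {1+x⁻¹ P1.^ 2} 4x≈) (G-sucˡ n p) ⟨
      Q₄ P1.* G (suc n) p                                  ≈⟨ G-sucʳ (suc n) p ⟨
      G (suc n) (suc p)                                    ∎

  descent-descent : ∀ n p l → descentState n p l → descentState (suc n) p (false ∷ l)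
  descent-descent n p l (O , E) = eq , evens-false l
    where
    V : PS1
    V = 2/[1+x] P1.* G n p
    eq : odds (false ∷ l) R1.≈ (2/[1+x] P1.* G (suc n) p)
    eq = begin
      odds (false ∷ l)                                     ≈⟨ odds-false l ⟩
      ones P1.* (evens l P1.+ odds l)                      ≈⟨ R1.*-congˡ {ones} (R1.+-cong (R1.trans E (R1.*-congˡ {P1.var} O)) O) ⟩
      ones P1.* ((P1.var P1.* V) P1.+ V)                   ≈⟨ Id.descent-descent-identity ones P1.var 2/[1+x] (G n p) ⟩
      2/[1+x] P1.* (ones P1.* ((R1.1# P1.+ P1.var) P1.* G n p)) ≈⟨ R1.*-congˡ {2/[1+x]} (G-sucˡ n p) ⟨
      2/[1+x] P1.* G (suc n) p                             ∎

transfer : ∀ l → State l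
transfer [] = R1.sym G00 , R1.sym G00
  where
  G00 : G 0 0 R1.≈ ones
  G00 n = Delannoy-G 0 n
transfer (true ∷ [])         = ascent-ascent 0 0 [] (transfer [])
transfer (true ∷ true ∷ l)   = ascent-ascent (length (true ∷ l)) (peaks (true ∷ l)) (true ∷ l) (transfer (true ∷ l))
transfer (true ∷ false ∷ l)  = descent-ascent (length (false ∷ l)) (peaks (false ∷ l)) (false ∷ l) (transfer (false ∷ l))
transfer (false ∷ [])        = ascent-descent 0 0 [] (transfer [])
transfer (false ∷ true ∷ l)  = ascent-descent (length (true ∷ l)) (peaks (true ∷ l)) (true ∷ l) (transfer (true ∷ l))
transfer (false ∷ false ∷ l) = descent-descent (length (false ∷ l)) (peaks (false ∷ l)) (false ∷ l) (transfer (false ∷ l))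

-- The leading `true` is the ascent from π(0) = 0, which turns left peaks into peaks. On the side of
-- words it prepends a letter 0, after which any of the `2i + 1` letters may come.
G-coeff : ∀ l i → G (suc (length l)) (peaks (true ∷ l)) i ≡ fromℕ (chains (true ∷ l) (i ℕ.* 2))
G-coeff l i = sym (proj₁ (transfer (true ∷ l)) i)

-- Sums over lists

∑ : ∀ {A : Set} → List A → (A → ℕ) → ℕ
∑ xs f = sumℕ (map f xs)

∑-cong-∈ : ∀ {A : Set} (xs : List A) {f g : A → ℕ} → (∀ {x} → x ∈ xs → f x ≡ g x) → ∑ xs f ≡ ∑ xs g
∑-cong-∈ []       e = refl
∑-cong-∈ (x ∷ xs) e = cong₂ ℕ._+_ (e (here refl)) (∑-cong-∈ xs (e ∘ there))

∑-cong : ∀ {A : Set} (xs : List A) {f g : A → ℕ} → (∀ x → f x ≡ g x) → ∑ xs f ≡ ∑ xs g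
∑-cong xs e = ∑-cong-∈ xs (λ {x} _ → e x)

∑-+ : ∀ {A : Set} (xs : List A) (f g : A → ℕ) → ∑ xs (λ x → f x ℕ.+ g x) ≡ ∑ xs f ℕ.+ ∑ xs g
∑-+ []       f g = refl
∑-+ (x ∷ xs) f g = trans (cong (f x ℕ.+ g x ℕ.+_) (∑-+ xs f g)) (interchange (f x) (g x) (∑ xs f) (∑ xs g))
  where open import Algebra.Properties.CommutativeSemigroup ℕ.+-commutativeSemigroup using (interchange)

∑-*ˡ : ∀ {A : Set} (xs : List A) c (f : A → ℕ) → ∑ xs (λ x → c ℕ.* f x) ≡ c ℕ.* ∑ xs f
∑-*ˡ []       c f = sym (ℕ.*-zeroʳ c)
∑-*ˡ (x ∷ xs) c f = trans (cong (c ℕ.* f x ℕ.+_) (∑-*ˡ xs c f)) (sym (ℕ.*-distribˡ-+ c (f x) (∑ xs f)))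

∑-zero : ∀ {A : Set} (xs : List A) → ∑ xs (λ _ → 0) ≡ 0
∑-zero []       = refl
∑-zero (x ∷ xs) = ∑-zero xs

∑-const : ∀ {A : Set} (xs : List A) c → ∑ xs (λ _ → c) ≡ length xs ℕ.* c
∑-const []       c = refl
∑-const (x ∷ xs) c = cong (c ℕ.+_) (∑-const xs c)

∑-swap : ∀ {A B : Set} (xs : List A) (ys : List B) (f : A → B → ℕ) →
  ∑ xs (λ x → ∑ ys (f x)) ≡ ∑ ys (λ y → ∑ xs (λ x → f x y))
∑-swap []       ys f = sym (∑-zero ys)
∑-swap (x ∷ xs) ys f = trans (cong (∑ ys (f x) ℕ.+_) (∑-swap xs ys f)) (sym (∑-+ ys (f x) _))

∑-++ : ∀ {A : Set} (xs ys : List A) (f : A → ℕ) → ∑ (xs ++ ys) f ≡ ∑ xs f ℕ.+ ∑ ys f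
∑-++ []       ys f = refl
∑-++ (x ∷ xs) ys f = trans (cong (f x ℕ.+_) (∑-++ xs ys f)) (sym (ℕ.+-assoc (f x) _ _))

∑-map : ∀ {A B : Set} (g : A → B) (xs : List A) (f : B → ℕ) → ∑ (map g xs) f ≡ ∑ xs (f ∘ g)
∑-map g []       f = refl
∑-map g (x ∷ xs) f = cong (f (g x) ℕ.+_) (∑-map g xs f)

∑-product : ∀ {A B C : Set} (h : A → B → C) (xs : List A) (ys : List B) (f : C → ℕ) →
  ∑ (cartesianProductWith h xs ys) f ≡ ∑ xs (λ x → ∑ ys (λ y → f (h x y)))
∑-product h []       ys f = refl
∑-product h (x ∷ xs) ys f = trans (∑-++ (map (h x) ys) _ f)
  (cong₂ ℕ._+_ (∑-map (h x) ys f) (∑-product h xs ys f))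

𝟙 : Bool → ℕ
𝟙 b = if b then 1 else 0

∑-filter : ∀ {A : Set} (p : A → Bool) (xs : List A) (f : A → ℕ) →
  ∑ (filter (λ x → p x Bool.≟ true) xs) f ≡ ∑ xs (λ x → 𝟙 (p x) ℕ.* f x)
∑-filter p []       f = refl
∑-filter p (x ∷ xs) f with p x
... | true  = cong₂ ℕ._+_ (sym (ℕ.+-identityʳ (f x))) (∑-filter p xs f)
... | false = ∑-filter p xs f

length-filter : ∀ {A : Set} (p : A → Bool) (xs : List A) →
  length (filter (λ x → p x Bool.≟ true) xs) ≡ ∑ xs (𝟙 ∘ p)
length-filter p []       = refl
length-filter p (x ∷ xs) with p x
... | true  = cong suc (length-filter p xs)
... | false = length-filter p xs

unique-map : ∀ {A B : Set} {f : A → B} (xs : List A) →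
  (∀ {x y} → x ∈ xs → y ∈ xs → f x ≡ f y → x ≡ y) → Unique xs → Unique (map f xs)
unique-map []       inj []       = []
unique-map {f = f} (x ∷ xs) inj (x∉ ∷ u) =
  All.tabulate (λ {z} z∈ fx≡z → let (y , y∈ , z≡fy) = ∈-map⁻ f z∈
    in All.lookup x∉ y∈ (inj (here refl) (there y∈) (trans fx≡z z≡fy)))
  ∷ unique-map xs (λ p q → inj (there p) (there q)) u

-- Lists without repetition that have the same elements are permutations of each other, and a sum
-- does not depend on the order.
∑-bijection : ∀ {A B : Set} {xs : List A} {ys : List B} (f : A → B) (φ : B → ℕ) → Unique xs → Unique ys →
  (∀ {x} → x ∈ xs → f x ∈ ys) →
  (∀ {x y} → x ∈ xs → y ∈ xs → f x ≡ f y → x ≡ y) →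
  (∀ {y} → y ∈ ys → ∃ λ x → x ∈ xs × f x ≡ y) →
  ∑ xs (φ ∘ f) ≡ ∑ ys φ
∑-bijection {xs = xs} {ys} f φ uxs uys into inj onto = trans (sym (∑-map f xs φ)) (sum-↭ (↭-map⁺ φ perm))
  where
  to : ∀ {z} → z ∈ map f xs → z ∈ ys
  to z∈ with ∈-map⁻ f z∈
  ... | x , x∈ , refl = into x∈
  from : ∀ {z} → z ∈ ys → z ∈ map f xs
  from z∈ with onto z∈
  ... | x , x∈ , refl = ∈-map⁺ f x∈
  perm : map f xs ↭ ys
  perm = ∼bag⇒↭ (unique∧set⇒bag (unique-map xs inj uxs) uys (mk⇔ to from))

-- Permutations as injective words

allWords-product : ∀ n m → allWords n (suc m) ≡ cartesianProductWith (λ w a → a ∷ w) (allWords n m) (allFin n)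
allWords-product n m = go (allWords n m)
  where
  go : ∀ ws → concatMap (λ w → map (λ a → a ∷ w) (allFin n)) ws ≡ cartesianProductWith (λ w a → a ∷ w) ws (allFin n)
  go []       = refl
  go (w ∷ ws) = cong (map (λ a → a ∷ w) (allFin n) ++_) (go ws)

∈-allWords : ∀ {n m} (w : Vec (Fin n) m) → w ∈ allWords n m
∈-allWords         []      = here refl
∈-allWords {n} {suc m} (a ∷ w) = subst (a ∷ w ∈_) (sym (allWords-product n m))
  (∈-cartesianProductWith⁺ (λ w a → a ∷ w) (∈-allWords w) (∈-allFin a))

unique-allWords : ∀ n m → Unique (allWords n m)
unique-allWords n zero    = [] ∷ []
unique-allWords n (suc m) = subst Unique (sym (allWords-product n m))
  (Unique.cartesianProductWith⁺ (λ w a → a ∷ w) (λ { refl → refl , refl }) (unique-allWords n m) (Unique.allFin⁺ n))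

∑-allWords : ∀ n m (f : Vec (Fin n) (suc m) → ℕ) →
  ∑ (allWords n (suc m)) f ≡ ∑ (allFin n) (λ a → ∑ (allWords n m) (λ w → f (a ∷ w)))
∑-allWords n m f = trans (cong (λ ws → ∑ ws f) (allWords-product n m))
  (trans (∑-product (λ w a → a ∷ w) (allWords n m) (allFin n) f) (∑-swap (allWords n m) (allFin n) (λ w a → f (a ∷ w))))

IsPerm : ∀ {n} → Vec (Fin n) n → Set
IsPerm w = Injective _≡_ _≡_ (lookup w)

all-∈ : ∀ {A : Set} (p : A → Bool) xs → all p xs ≡ true → ∀ {x} → x ∈ xs → p x ≡ true
all-∈ p (y ∷ xs) e x∈ with p y in eq
all-∈ p (y ∷ xs) e (here refl) | true = eq
all-∈ p (y ∷ xs) e (there x∈)  | true = all-∈ p xs e x∈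

all-true : ∀ {A : Set} (p : A → Bool) xs → (∀ {x} → x ∈ xs → p x ≡ true) → all p xs ≡ true
all-true p []       h = refl
all-true p (y ∷ xs) h rewrite h (here refl) = all-true p xs (h ∘ there)

≡ᵇ-refl : ∀ k → (k ≡ᵇ k) ≡ true
≡ᵇ-refl zero    = refl
≡ᵇ-refl (suc k) = ≡ᵇ-refl k

≡ᵇ⇒≡ : ∀ m n → (m ≡ᵇ n) ≡ true → m ≡ n
≡ᵇ⇒≡ m n e = ℕ.≡ᵇ⇒≡ m n (Equivalence.from T-≡ e)

≢⇒≡ᵇ : ∀ {m n} → m ≢ n → (m ≡ᵇ n) ≡ false
≢⇒≡ᵇ {m} {n} m≢n with m ≡ᵇ n in eq
... | true  = contradiction (≡ᵇ⇒≡ m n eq) m≢n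
... | false = refl

<⇒<ᵇ : ∀ {m n} → m < n → (m <ᵇ n) ≡ true
<⇒<ᵇ m<n = Equivalence.to T-≡ (ℕ.<⇒<ᵇ m<n)

<ᵇ⇒< : ∀ m n → (m <ᵇ n) ≡ true → m < n
<ᵇ⇒< m n e = ℕ.<ᵇ⇒< m n (Equivalence.from T-≡ e)

≮⇒<ᵇ : ∀ {m n} → ¬ m < n → (m <ᵇ n) ≡ false
≮⇒<ᵇ {m} {n} m≮n with m <ᵇ n in eq
... | true  = contradiction (<ᵇ⇒< m n eq) m≮n
... | false = refl

isInjective-sound : ∀ {n} (w : Vec (Fin n) n) → isInjective w ≡ true → IsPerm w
isInjective-sound {n} w e {i} {j} wi≡wj = Fin.toℕ-injective (≡ᵇ⇒≡ (toℕ i) (toℕ j) (clause (toℕ i ≡ᵇ toℕ j) row))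
  where
  row : (not (toℕ (lookup w i) ≡ᵇ toℕ (lookup w j)) ∨ (toℕ i ≡ᵇ toℕ j)) ≡ true
  row = all-∈ _ (allFin n) (all-∈ _ (allFin n) e (∈-allFin i)) (∈-allFin j)
  clause : ∀ b → (not (toℕ (lookup w i) ≡ᵇ toℕ (lookup w j)) ∨ b) ≡ true → b ≡ true
  clause b p rewrite wi≡wj | ≡ᵇ-refl (toℕ (lookup w j)) = p

isInjective-complete : ∀ {n} (w : Vec (Fin n) n) → IsPerm w → isInjective w ≡ true
isInjective-complete {n} w inj = all-true _ (allFin n) λ {i} _ → all-true _ (allFin n) λ {j} _ → entry i j
  where
  entry : ∀ i j → (not (toℕ (lookup w i) ≡ᵇ toℕ (lookup w j)) ∨ (toℕ i ≡ᵇ toℕ j)) ≡ true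
  entry i j with toℕ (lookup w i) ≡ᵇ toℕ (lookup w j) in eq
  ... | false = refl
  ... | true  rewrite inj (Fin.toℕ-injective (≡ᵇ⇒≡ (toℕ (lookup w i)) (toℕ (lookup w j)) eq)) = ≡ᵇ-refl (toℕ j)

∈-Sym⁺ : ∀ {n} {w : Vec (Fin n) n} → IsPerm w → w ∈ Sym n
∈-Sym⁺ {w = w} inj = ∈-filter⁺ (λ w → isInjective w Bool.≟ true) (∈-allWords w) (isInjective-complete w inj)

∈-Sym⁻ : ∀ {n} {w : Vec (Fin n) n} → w ∈ Sym n → IsPerm w
∈-Sym⁻ {n} {w} w∈ = isInjective-sound w (proj₂ (∈-filter⁻ (λ w → isInjective w Bool.≟ true) {xs = allWords n n} w∈))

unique-Sym : ∀ n → Unique (Sym n)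
unique-Sym n = Unique.filter⁺ (λ w → isInjective w Bool.≟ true) (unique-allWords n n)

-- A missed value could be punched out, which would leave an injection of `Fin (suc n)` into
-- `Fin n`.
injective⇒surjective : ∀ {n} (f : Fin n → Fin n) → Injective _≡_ _≡_ f → ∀ j → ∃ λ i → f i ≡ j
injective⇒surjective {suc n} f inj j with any? (λ i → f i Fin.≟ j)
... | yes p = p
... | no ¬p = contradiction (Fin.injective⇒≤ {f = λ i → punchOut (j≢f i)}
                (λ {x} {y} e → inj (Fin.punchOut-injective (j≢f x) (j≢f y) e))) ℕ.1+n≰n
  where
  j≢f : ∀ i → j ≢ f i
  j≢f i j≡fi = ¬p (i , sym j≡fi)

-- The helper functions of inverse, val, cycleLength and oddCycles are local to those definitions.
-- In the mutual blocks, the _ in the signature of an auxiliary lemma is solved by unification to such a helper.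
mutual
  lookup-inverse : ∀ {n} (w : Vec (Fin n) n) → IsPerm w → ∀ j → lookup w (lookup (inverse w) j) ≡ j
  lookup-inverse w inj j = trans (cong (lookup w) (Vec.lookup∘tabulate _ j)) (lookup-search w inj j)

  lookup-search : ∀ {n} (w : Vec (Fin n) n) → IsPerm w → ∀ j → lookup w _ ≡ j
  lookup-search w inj j with any? (λ i → lookup w i Fin.≟ j)
  ... | yes (i , e) = e
  ... | no ¬p = contradiction (injective⇒surjective (lookup w) inj j) ¬p

inverse-lookup : ∀ {n} (w : Vec (Fin n) n) → IsPerm w → ∀ k → lookup (inverse w) (lookup w k) ≡ k
inverse-lookup w inj k = inj (lookup-inverse w inj (lookup w k))

inverse-isPerm : ∀ {n} (w : Vec (Fin n) n) → IsPerm w → IsPerm (inverse w)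
inverse-isPerm w inj {i} {j} e = trans (sym (lookup-inverse w inj i)) (trans (cong (lookup w) e) (lookup-inverse w inj j))

-- Ascent words and left peaks

ascents : ∀ {A : Set} {m} → (A → A → Bool) → Vec A m → List Bool
ascents r []          = []
ascents r (x ∷ [])    = []
ascents r (x ∷ y ∷ w) = r x y ∷ ascents r (y ∷ w)

length-ascents : ∀ {A : Set} {m} (r : A → A → Bool) (w : Vec A (suc m)) → length (ascents r w) ≡ m
length-ascents r (x ∷ [])    = refl
length-ascents r (x ∷ y ∷ w) = cong suc (length-ascents r (y ∷ w))

_<F_ : ∀ {n} → Fin n → Fin n → Bool
i <F j = toℕ i <ᵇ toℕ j

nth : ∀ {n} → List (Fin n) → ℕ → ℕ
nth []       _             = 0
nth (x ∷ xs) zero          = 0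
nth (x ∷ xs) (suc zero)    = suc (toℕ x)
nth (x ∷ xs) (suc (suc k)) = nth xs (suc k)

mutual
  val-nth : ∀ {n} (w : Vec (Fin n) n) i → val w i ≡ nth (Vec.toList w) i
  val-nth w i with Vec.toList w | i
  ... | xs | k = val-nth-aux w i xs k

  val-nth-aux : ∀ {n} (w : Vec (Fin n) n) (i : ℕ) (xs : List (Fin n)) (k : ℕ) → _ ≡ nth xs k
  val-nth-aux w i []       k             = refl
  val-nth-aux w i (x ∷ xs) zero          = refl
  val-nth-aux w i (x ∷ xs) (suc zero)    = refl
  val-nth-aux w i (x ∷ xs) (suc (suc k)) = val-nth-aux w i xs (suc k)

nth-lookup : ∀ {n m} (w : Vec (Fin n) m) k → nth (Vec.toList w) (suc (toℕ k)) ≡ suc (toℕ (lookup w k))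
nth-lookup (x ∷ w)     zero    = refl
nth-lookup (x ∷ w)     (suc k) = nth-lookup w k

ascents-nth : ∀ {n m} (w : Vec (Fin n) (suc m)) →
  ascents _<F_ w ≡ applyUpTo (λ i → nth (Vec.toList w) (suc i) <ᵇ nth (Vec.toList w) (suc (suc i))) m
ascents-nth (x ∷ [])    = refl
ascents-nth (x ∷ y ∷ w) = cong ((x <F y) ∷_) (ascents-nth (y ∷ w))

-- `p` is the entry in front of `a 0`; with `p = true`, index `i` stands for a left peak at position
-- `i + 1`.
isPeak : Bool → (ℕ → Bool) → ℕ → Bool
isPeak p a zero    = p ∧ not (a 0)
isPeak p a (suc i) = a i ∧ not (a (suc i))

peaks-cons : ∀ p q l → peaks (p ∷ q ∷ l) ≡ 𝟙 (p ∧ not q) ℕ.+ peaks (q ∷ l)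
peaks-cons true  true  l = refl
peaks-cons true  false l = refl
peaks-cons false q     l = refl

∑-upTo-suc : ∀ m (f : ℕ → ℕ) → ∑ (upTo (suc m)) f ≡ f 0 ℕ.+ ∑ (upTo m) (f ∘ suc)
∑-upTo-suc m f = cong (λ l → f 0 ℕ.+ sumℕ l) (trans (List.map-applyUpTo suc f m) (sym (List.map-upTo (f ∘ suc) m)))

peaks-applyUpTo : ∀ p a m → peaks (p ∷ applyUpTo a m) ≡ ∑ (upTo m) (𝟙 ∘ isPeak p a)
peaks-applyUpTo true  a zero = refl
peaks-applyUpTo false a zero = refl
peaks-applyUpTo p a (suc m) = begin
  peaks (p ∷ a 0 ∷ applyUpTo (a ∘ suc) m)
    ≡⟨ peaks-cons p (a 0) _ ⟩
  𝟙 (isPeak p a 0) ℕ.+ peaks (a 0 ∷ applyUpTo (a ∘ suc) m)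
    ≡⟨ cong (𝟙 (isPeak p a 0) ℕ.+_) (peaks-applyUpTo (a 0) (a ∘ suc) m) ⟩
  𝟙 (isPeak p a 0) ℕ.+ ∑ (upTo m) (𝟙 ∘ isPeak (a 0) (a ∘ suc))
    ≡⟨ cong (𝟙 (isPeak p a 0) ℕ.+_) (∑-cong (upTo m) (λ { zero → refl ; (suc i) → refl })) ⟩
  𝟙 (isPeak p a 0) ℕ.+ ∑ (upTo m) (𝟙 ∘ isPeak p a ∘ suc)
    ≡⟨ ∑-upTo-suc m (𝟙 ∘ isPeak p a) ⟨
  ∑ (upTo (suc m)) (𝟙 ∘ isPeak p a) ∎
  where open ≡-Reasoning

<ᵇ-flip : ∀ {m n} → m ≢ n → (n <ᵇ m) ≡ not (m <ᵇ n)
<ᵇ-flip {m} {n} m≢n with m <ᵇ n in eq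
... | true  = ≮⇒<ᵇ (ℕ.<-asym (<ᵇ⇒< m n eq))
... | false = <⇒<ᵇ (ℕ.≤∧≢⇒< (ℕ.≮⇒≥ λ m<n → contradiction (trans (sym (<⇒<ᵇ m<n)) eq) λ ()) (m≢n ∘ sym))

-- Values of a permutation are distinct, so the second comparison in the definition of a left peak
-- is the negation of an ascent. The prepended `true` accounts for position 1.
lpk-peaks : ∀ {m} (w : Vec (Fin (suc m)) (suc m)) → IsPerm w → lpk w ≡ peaks (true ∷ ascents _<F_ w)
lpk-peaks {m} w inj = begin
  lpk w
    ≡⟨ length-filter (isLeftPeak w) (map suc (upTo m)) ⟩
  ∑ (map suc (upTo m)) (𝟙 ∘ isLeftPeak w)
    ≡⟨ ∑-map suc (upTo m) (𝟙 ∘ isLeftPeak w) ⟩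
  ∑ (upTo m) (𝟙 ∘ isLeftPeak w ∘ suc)
    ≡⟨ ∑-cong-∈ (upTo m) (λ {i} i∈ → cong 𝟙 (leftPeak i (∈-upTo⁻ i∈))) ⟩
  ∑ (upTo m) (𝟙 ∘ isPeak true a)
    ≡⟨ peaks-applyUpTo true a m ⟨
  peaks (true ∷ applyUpTo a m)
    ≡⟨ cong (λ l → peaks (true ∷ l)) (ascents-nth w) ⟨
  peaks (true ∷ ascents _<F_ w) ∎
  where
  open ≡-Reasoning
  v : ℕ → ℕ
  v = nth (Vec.toList w)
  a : ℕ → Bool
  a i = v (suc i) <ᵇ v (suc (suc i))
  v-lookup : ∀ {i} (i<1+m : i < suc m) → v (suc i) ≡ suc (toℕ (lookup w (Fin.fromℕ< i<1+m)))
  v-lookup i<1+m = trans (cong (v ∘ suc) (sym (Fin.toℕ-fromℕ< i<1+m))) (nth-lookup w (Fin.fromℕ< i<1+m))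
  v-distinct : ∀ i → i < m → v (suc i) ≢ v (suc (suc i))
  v-distinct i i<m e = ℕ.1+n≢n (sym (trans (sym (Fin.toℕ-fromℕ< i<1+m)) (trans (cong toℕ same) (Fin.toℕ-fromℕ< (s≤s i<m)))))
    where
    i<1+m : i < suc m
    i<1+m = ℕ.m<n⇒m<1+n i<m
    same : Fin.fromℕ< i<1+m ≡ Fin.fromℕ< (s≤s i<m)
    same = inj (Fin.toℕ-injective (ℕ.suc-injective (trans (sym (v-lookup i<1+m)) (trans e (v-lookup (s≤s i<m))))))
  leftPeak : ∀ i → i < m → isLeftPeak w (suc i) ≡ isPeak true a i
  leftPeak zero    i<m rewrite val-nth w 1 | val-nth w 2 =
    trans (∨-identityʳ (v 2 <ᵇ v 1)) (<ᵇ-flip (v-distinct 0 i<m))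
  leftPeak (suc i) i<m rewrite val-nth w (suc i) | val-nth w (suc (suc i)) | val-nth w (suc (suc (suc i))) | <⇒<ᵇ i<m =
    cong (a i ∧_) (<ᵇ-flip (v-distinct (suc i) i<m))

-- Counting the words compatible with a pattern

∑<-cong : ∀ n {f g : ℕ → ℕ} → (∀ k → k < n → f k ≡ g k) → ∑< n f ≡ ∑< n g
∑<-cong zero    e = refl
∑<-cong (suc n) e = cong₂ ℕ._+_ (∑<-cong n (λ k k<n → e k (ℕ.m<n⇒m<1+n k<n))) (e n ℕ.≤-refl)

∑<-sucˡ : ∀ n f → ∑< (suc n) f ≡ f 0 ℕ.+ ∑< n (f ∘ suc)
∑<-sucˡ zero    f = sym (ℕ.+-identityʳ (f 0))
∑<-sucˡ (suc n) f = trans (cong (ℕ._+ f (suc n)) (∑<-sucˡ n f)) (ℕ.+-assoc (f 0) _ _)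

∑<-+ : ∀ m n f → ∑< (m ℕ.+ n) f ≡ ∑< m f ℕ.+ ∑< n (f ∘ (m ℕ.+_))
∑<-+ m zero    f rewrite ℕ.+-identityʳ m = sym (ℕ.+-identityʳ _)
∑<-+ m (suc n) f rewrite ℕ.+-suc m n = trans (cong (ℕ._+ f (m ℕ.+ n)) (∑<-+ m n f)) (ℕ.+-assoc (∑< m f) _ _)

∑<-reverse : ∀ n f → ∑< (suc n) f ≡ ∑< (suc n) (λ k → f (n ∸ k))
∑<-reverse zero    f = refl
∑<-reverse (suc n) f = begin
  ∑< (suc n) f ℕ.+ f (suc n)                    ≡⟨ ℕ.+-comm _ (f (suc n)) ⟩
  f (suc n) ℕ.+ ∑< (suc n) f                    ≡⟨ cong (f (suc n) ℕ.+_) (∑<-reverse n f) ⟩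
  f (suc n) ℕ.+ ∑< (suc n) (λ k → f (n ∸ k))    ≡⟨ ∑<-sucˡ (suc n) (λ k → f (suc n ∸ k)) ⟨
  ∑< (suc (suc n)) (λ k → f (suc n ∸ k))        ∎
  where open ≡-Reasoning

∑-allFin-suc : ∀ n (f : Fin (suc n) → ℕ) → ∑ (allFin (suc n)) f ≡ f zero ℕ.+ ∑ (allFin n) (f ∘ suc)
∑-allFin-suc n f = cong (λ l → f zero ℕ.+ sumℕ l) (trans (List.map-tabulate suc f) (sym (List.map-tabulate id (f ∘ suc))))

∑-allFin : ∀ n (f : ℕ → ℕ) → ∑ (allFin n) (f ∘ toℕ) ≡ ∑< n f
∑-allFin zero    f = refl
∑-allFin (suc n) f = trans (∑-allFin-suc n (f ∘ toℕ)) (trans (cong (f 0 ℕ.+_) (∑-allFin n (f ∘ suc))) (sym (∑<-sucˡ n f)))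

even-suc : ∀ n → even (suc n) ≡ not (even n)
even-suc zero          = refl
even-suc (suc zero)    = refl
even-suc (suc (suc n)) = even-suc n

even-+ : ∀ m n → even (m ℕ.+ n) ≡ (even m == even n)
even-+ zero    n = refl
even-+ (suc m) n rewrite even-suc (m ℕ.+ n) | even-+ m n | even-suc m with even m | even n
... | true  | _     = refl
... | false | true  = refl
... | false | false = refl

==-true⇒≡ : ∀ p q → (p == q) ≡ true → p ≡ q
==-true⇒≡ true  true  e = refl
==-true⇒≡ false false e = refl

bool-ext : ∀ {b c : Bool} → (b ≡ true → c ≡ true) → (c ≡ true → b ≡ true) → b ≡ c
bool-ext {true}  {c}     f g = sym (f refl)
bool-ext {false} {true}  f g = g refl
bool-ext {false} {false} f g = refl

<ᵇ-cong : ∀ {m n p q} → (m < n → p < q) → (p < q → m < n) → (m <ᵇ n) ≡ (p <ᵇ q)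
<ᵇ-cong {m} {n} {p} {q} f g = bool-ext (λ e → <⇒<ᵇ (f (<ᵇ⇒< m n e))) (λ e → <⇒<ᵇ (g (<ᵇ⇒< p q e)))

≡ᵇ-cong : ∀ {m n p q} → (m ≡ n → p ≡ q) → (p ≡ q → m ≡ n) → (m ≡ᵇ n) ≡ (p ≡ᵇ q)
≡ᵇ-cong {m} {n} {p} {q} f g = bool-ext
  (λ e → trans (cong (p ≡ᵇ_) (sym (f (≡ᵇ⇒≡ m n e)))) (≡ᵇ-refl p))
  (λ e → trans (cong (m ≡ᵇ_) (sym (g (≡ᵇ⇒≡ p q e)))) (≡ᵇ-refl m))

-- The condition for `b` to come right after `a` in a compatible word, where `d` tells whether the
-- pattern has an ascent there. For pairs of words `d` is itself a value of `link`.
link : Bool → ℕ → ℕ → Bool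
link d a b = (a <ᵇ b) ∨ ((a ≡ᵇ b) ∧ (even a == d))

compat : ∀ {M m} → List Bool → Vec (Fin M) m → Bool
compat []       h           = true
compat (d ∷ ds) []          = true
compat (d ∷ ds) (a ∷ [])    = true
compat (d ∷ ds) (a ∷ b ∷ h) = link d (toℕ a) (toℕ b) ∧ compat ds (b ∷ h)

-- The count of `chains` indexed by the current letter instead of the number of letters above it. In
-- this form letters can be renumbered, as the product alphabet requires.
chainsFrom : ℕ → List Bool → ℕ → ℕ
chainsFrom M []       a = 1
chainsFrom M (d ∷ ds) a = ∑< M (λ b → 𝟙 (link d a b) ℕ.* chainsFrom M ds b)

𝟙-∧ : ∀ b c → 𝟙 (b ∧ c) ≡ 𝟙 b ℕ.* 𝟙 c
𝟙-∧ true  c = sym (ℕ.+-identityʳ (𝟙 c))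
𝟙-∧ false c = refl

∑<-select : ∀ n r c (g : ℕ → ℕ) → r < n →
  ∑< n (λ k → 𝟙 ((k <ᵇ r) ∨ ((k ≡ᵇ r) ∧ c)) ℕ.* g k) ≡ ∑< r g ℕ.+ (if c then g r else 0)
∑<-select (suc n) r c g (s≤s r≤n) with ℕ.m≤n⇒m<n∨m≡n r≤n
... | inj₁ r<n rewrite ≮⇒<ᵇ {n} {r} (ℕ.<-asym r<n) | ≢⇒≡ᵇ {n} {r} (ℕ.<⇒≢ r<n ∘ sym) =
  trans (ℕ.+-identityʳ _) (∑<-select n r c g r<n)
... | inj₂ refl rewrite ≮⇒<ᵇ {r} {r} (ℕ.<-irrefl refl) | ≡ᵇ-refl r =
  cong₂ ℕ._+_ (∑<-cong r λ k k<r → trans (cong (λ b → 𝟙 (b ∨ ((k ≡ᵇ r) ∧ c)) ℕ.* g k) (<⇒<ᵇ k<r)) (ℕ.+-identityʳ (g k))) (last c)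
  where
  last : ∀ c → 𝟙 c ℕ.* g r ≡ (if c then g r else 0)
  last true  = ℕ.+-identityʳ (g r)
  last false = refl

-- Substitute `b = 2j - k`. The top letter `2j` is even, so a letter has the same parity as the
-- number of letters above it, and the repetition rules agree.
chainsFrom-chains : ∀ j ds a → a < suc (j ℕ.* 2) → chainsFrom (suc (j ℕ.* 2)) ds a ≡ chains ds (j ℕ.* 2 ∸ a)
chainsFrom-chains j []       a a<M = refl
chainsFrom-chains j (d ∷ ds) a a<M@(s≤s a≤2j) = begin
  ∑< M (λ b → 𝟙 (link d a b) ℕ.* chainsFrom M ds b)
    ≡⟨ ∑<-cong M (λ b b<M → cong (𝟙 (link d a b) ℕ.*_) (chainsFrom-chains j ds b b<M)) ⟩
  ∑< M (λ b → 𝟙 (link d a b) ℕ.* chains ds (2j ∸ b))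
    ≡⟨ ∑<-reverse 2j _ ⟩
  ∑< M (λ k → 𝟙 (link d a (2j ∸ k)) ℕ.* chains ds (2j ∸ (2j ∸ k)))
    ≡⟨ ∑<-cong M (λ { k (s≤s k≤2j) → cong₂ ℕ._*_ (cong 𝟙 (flip k k≤2j)) (cong (chains ds) (ℕ.m∸[m∸n]≡n k≤2j)) }) ⟩
  ∑< M (λ k → 𝟙 ((k <ᵇ r) ∨ ((k ≡ᵇ r) ∧ (even r == d))) ℕ.* chains ds k)
    ≡⟨ ∑<-select M r (even r == d) (chains ds) (s≤s (ℕ.m∸n≤m 2j a)) ⟩
  chains (d ∷ ds) r ∎
  where
  open ≡-Reasoning
  2j M r : ℕ
  2j = j ℕ.* 2
  M = suc 2j
  r = 2j ∸ a
  even-r : even a ≡ even r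
  even-r = ==-true⇒≡ _ _ (trans (sym (even-+ a r)) (trans (cong even (ℕ.m+[n∸m]≡n a≤2j)) (even-2* j)))
  swap : ∀ {x y} → x ≤ 2j → y < 2j ∸ x → x < 2j ∸ y
  swap {x} {y} x≤ y< = ℕ.m+n≤o⇒m≤o∸n (suc x) (subst (_≤ 2j) (cong suc (ℕ.+-comm y x))
    (subst (suc y ℕ.+ x ≤_) (ℕ.m∸n+n≡m x≤) (ℕ.+-monoˡ-≤ x y<)))
  flip : ∀ k → k ≤ 2j → link d a (2j ∸ k) ≡ ((k <ᵇ r) ∨ ((k ≡ᵇ r) ∧ (even r == d)))
  flip k k≤ = cong₂ _∨_ (<ᵇ-cong (swap k≤) (swap a≤2j))
    (cong₂ _∧_ (≡ᵇ-cong {a} {2j ∸ k} {k} {r} (λ e → trans (sym (ℕ.m∸[m∸n]≡n k≤)) (cong (2j ∸_) (sym e)))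
                        (λ e → trans (sym (ℕ.m∸[m∸n]≡n a≤2j)) (cong (2j ∸_) (sym e))))
               (cong (_== d) even-r))

∑-compat : ∀ M m ds (a : Fin M) → length ds ≡ m →
  ∑ (allWords M m) (λ h → 𝟙 (compat ds (a ∷ h))) ≡ chainsFrom M ds (toℕ a)
∑-compat M zero    []       a e = refl
∑-compat M (suc m) (d ∷ ds) a e = begin
  ∑ (allWords M (suc m)) (λ h → 𝟙 (compat (d ∷ ds) (a ∷ h)))
    ≡⟨ ∑-allWords M m _ ⟩
  ∑ (allFin M) (λ b → ∑ (allWords M m) (λ h → 𝟙 (link d (toℕ a) (toℕ b) ∧ compat ds (b ∷ h))))
    ≡⟨ ∑-cong (allFin M) (λ b → trans (∑-cong (allWords M m) (λ h → 𝟙-∧ (link d (toℕ a) (toℕ b)) (compat ds (b ∷ h))))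
         (trans (∑-*ˡ (allWords M m) (𝟙 (link d (toℕ a) (toℕ b))) _)
                (cong (𝟙 (link d (toℕ a) (toℕ b)) ℕ.*_) (∑-compat M m ds b (ℕ.suc-injective e))))) ⟩
  ∑ (allFin M) (λ b → 𝟙 (link d (toℕ a) (toℕ b)) ℕ.* chainsFrom M ds (toℕ b))
    ≡⟨ ∑-allFin M (λ b → 𝟙 (link d (toℕ a) b) ℕ.* chainsFrom M ds b) ⟩
  chainsFrom M (d ∷ ds) (toℕ a) ∎
  where open ≡-Reasoning

∑<-chainsFrom : ∀ j ds → ∑< (suc (j ℕ.* 2)) (chainsFrom (suc (j ℕ.* 2)) ds) ≡ chains (true ∷ ds) (j ℕ.* 2)
∑<-chainsFrom j ds = begin
  ∑< (suc (j ℕ.* 2)) (chainsFrom (suc (j ℕ.* 2)) ds)       ≡⟨ ∑<-cong (suc (j ℕ.* 2)) (chainsFrom-chains j ds) ⟩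
  ∑< (suc (j ℕ.* 2)) (λ a → chains ds (j ℕ.* 2 ∸ a))       ≡⟨ ∑<-reverse (j ℕ.* 2) (chains ds) ⟨
  ∑< (suc (j ℕ.* 2)) (chains ds)                           ≡⟨ chains-true-even ds j ⟨
  chains (true ∷ ds) (j ℕ.* 2)                             ∎
  where open ≡-Reasoning

compat-count : ∀ j m ds → length ds ≡ m →
  ∑ (allWords (suc (j ℕ.* 2)) (suc m)) (𝟙 ∘ compat ds) ≡ chains (true ∷ ds) (j ℕ.* 2)
compat-count j m ds e = begin
  ∑ (allWords M (suc m)) (𝟙 ∘ compat ds)
    ≡⟨ ∑-allWords M m (𝟙 ∘ compat ds) ⟩
  ∑ (allFin M) (λ a → ∑ (allWords M m) (λ h → 𝟙 (compat ds (a ∷ h))))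
    ≡⟨ ∑-cong (allFin M) (λ a → ∑-compat M m ds a e) ⟩
  ∑ (allFin M) (chainsFrom M ds ∘ toℕ)
    ≡⟨ ∑-allFin M (chainsFrom M ds) ⟩
  ∑< M (chainsFrom M ds)
    ≡⟨ ∑<-chainsFrom j ds ⟩
  chains (true ∷ ds) (j ℕ.* 2) ∎
  where
  open ≡-Reasoning
  M : ℕ
  M = suc (j ℕ.* 2)

-- Pairs of letters as letters of one alphabet

-- Odd rows are traversed backwards, so that snake 2j a b is even exactly when the biletter (a , b) may repeat.
snake : ℕ → ℕ → ℕ → ℕ
snake 2j a b = a ℕ.* suc 2j ℕ.+ (if even a then b else 2j ∸ b)

-- Forwards or backwards, row `a` fills the `suc 2j` consecutive values from `a * suc 2j` on.
∑<-snake : ∀ A 2j (φ : ℕ → ℕ) → ∑< A (λ a → ∑< (suc 2j) (λ b → φ (snake 2j a b))) ≡ ∑< (A ℕ.* suc 2j) φ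
∑<-snake zero    2j φ = refl
∑<-snake (suc A) 2j φ = begin
  ∑< A (λ a → ∑< (suc 2j) (λ b → φ (snake 2j a b))) ℕ.+ ∑< (suc 2j) (λ b → φ (snake 2j A b))
    ≡⟨ cong₂ ℕ._+_ (∑<-snake A 2j φ) (row (even A)) ⟩
  ∑< (A ℕ.* suc 2j) φ ℕ.+ ∑< (suc 2j) (λ b → φ (A ℕ.* suc 2j ℕ.+ b))
    ≡⟨ ∑<-+ (A ℕ.* suc 2j) (suc 2j) φ ⟨
  ∑< (A ℕ.* suc 2j ℕ.+ suc 2j) φ
    ≡⟨ cong (λ N → ∑< N φ) (ℕ.+-comm (A ℕ.* suc 2j) (suc 2j)) ⟩
  ∑< (suc A ℕ.* suc 2j) φ ∎
  where
  open ≡-Reasoning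
  row : ∀ c → ∑< (suc 2j) (λ b → φ (A ℕ.* suc 2j ℕ.+ (if c then b else 2j ∸ b))) ≡ ∑< (suc 2j) (λ b → φ (A ℕ.* suc 2j ℕ.+ b))
  row true  = refl
  row false = sym (∑<-reverse 2j (λ b → φ (A ℕ.* suc 2j ℕ.+ b)))

link-< : ∀ d {a b} → a < b → link d a b ≡ true
link-< d a<b rewrite <⇒<ᵇ a<b = refl

link-> : ∀ d {a b} → b < a → link d a b ≡ false
link-> d {a} {b} b<a rewrite ≮⇒<ᵇ {a} {b} (ℕ.<-asym b<a) | ≢⇒≡ᵇ {a} {b} (ℕ.<⇒≢ b<a ∘ sym) = refl

link-refl : ∀ d a → link d a a ≡ (even a == d)
link-refl d a rewrite ≮⇒<ᵇ {a} {a} (ℕ.<-irrefl refl) | ≡ᵇ-refl a = refl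

==-true : ∀ b → (b == true) ≡ b
==-true true  = refl
==-true false = refl

module Snake (j : ℕ) where
  2j : ℕ
  2j = j ℕ.* 2

  snake-< : ∀ {a a′} b b′ → b < suc 2j → a < a′ → snake 2j a b < snake 2j a′ b′
  snake-< {a} {a′} b b′ (s≤s b≤) a<a′ = begin-strict
    a ℕ.* suc 2j ℕ.+ (if even a then b else 2j ∸ b)
      <⟨ ℕ.+-monoʳ-< (a ℕ.* suc 2j) (s≤s (bound (even a))) ⟩
    a ℕ.* suc 2j ℕ.+ suc 2j
      ≡⟨ ℕ.+-comm (a ℕ.* suc 2j) (suc 2j) ⟩
    suc a ℕ.* suc 2j
      ≤⟨ ℕ.*-monoˡ-≤ (suc 2j) a<a′ ⟩
    a′ ℕ.* suc 2j
      ≤⟨ ℕ.m≤m+n _ _ ⟩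
    snake 2j a′ b′ ∎
    where
    open ℕ.≤-Reasoning
    bound : ∀ c → (if c then b else 2j ∸ b) ≤ 2j
    bound true  = b≤
    bound false = ℕ.m∸n≤m 2j b

  even-a*M : ∀ a → even (a ℕ.* suc 2j) ≡ even a
  even-a*M zero    = refl
  even-a*M (suc a) rewrite even-+ (suc 2j) (a ℕ.* suc 2j) | odd-2* j | even-a*M a = sym (even-suc a)

  even-2j∸ : ∀ b → b ≤ 2j → even (2j ∸ b) ≡ even b
  even-2j∸ b b≤ = sym (==-true⇒≡ _ _ (trans (sym (even-+ b (2j ∸ b))) (trans (cong even (ℕ.m+[n∸m]≡n b≤)) (even-2* j))))

  -- On an odd row the left side is the negation of `link true b b′`: the strict order is reversed
  -- and odd letters repeat instead of even ones. Reading the row backwards reverses the order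
  -- again. Since `suc 2j` is odd, the row starts at a value with the parity of `a`, which settles
  -- the repetitions.
  snake-row : ∀ a b b′ → b < suc 2j → b′ < suc 2j →
    (even a == link true b b′) ≡ link true (snake 2j a b) (snake 2j a b′)
  snake-row a b b′ (s≤s b≤) (s≤s b′≤) with even a in ea | ℕ.<-cmp b b′
  ... | true  | tri< b<b′ _ _ = trans (link-< true b<b′) (sym (link-< true (ℕ.+-monoʳ-< (a ℕ.* suc 2j) b<b′)))
  ... | true  | tri> _ _ b′<b = trans (link-> true b′<b) (sym (link-> true (ℕ.+-monoʳ-< (a ℕ.* suc 2j) b′<b)))
  ... | true  | tri≈ _ refl _ = trans (link-refl true b) (trans (cong (_== true) (sym (trans (even-+ (a ℕ.* suc 2j) b)
          (cong (_== even b) (trans (even-a*M a) ea))))) (sym (link-refl true (a ℕ.* suc 2j ℕ.+ b))))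
  ... | false | tri< b<b′ _ _ = trans (cong not (link-< true b<b′)) (sym (link-> true (ℕ.+-monoʳ-< (a ℕ.* suc 2j) (ℕ.∸-monoʳ-< b<b′ b′≤))))
  ... | false | tri> _ _ b′<b = trans (cong not (link-> true b′<b)) (sym (link-< true (ℕ.+-monoʳ-< (a ℕ.* suc 2j) (ℕ.∸-monoʳ-< b′<b b≤))))
  ... | false | tri≈ _ refl _ = begin
    not (link true b b)                         ≡⟨ cong not (trans (link-refl true b) (==-true (even b))) ⟩
    not (even b)                                ≡⟨ cong not (even-2j∸ b b≤) ⟨
    not (even (2j ∸ b))                         ≡⟨ cong (_== even (2j ∸ b)) (trans (even-a*M a) ea) ⟨
    even (a ℕ.* suc 2j) == even (2j ∸ b)        ≡⟨ even-+ (a ℕ.* suc 2j) (2j ∸ b) ⟨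
    even (a ℕ.* suc 2j ℕ.+ (2j ∸ b))            ≡⟨ ==-true _ ⟨
    even (a ℕ.* suc 2j ℕ.+ (2j ∸ b)) == true    ≡⟨ link-refl true (a ℕ.* suc 2j ℕ.+ (2j ∸ b)) ⟨
    link true (a ℕ.* suc 2j ℕ.+ (2j ∸ b)) (a ℕ.* suc 2j ℕ.+ (2j ∸ b)) ∎
    where open ≡-Reasoning

  -- The purpose of the snake order: the condition on `a` and `a′`, which itself depends on `b` and
  -- `b′`, becomes the ascent condition on two letters of a single alphabet.
  link-snake : ∀ a a′ b b′ → b < suc 2j → b′ < suc 2j →
    link (link true b b′) a a′ ≡ link true (snake 2j a b) (snake 2j a′ b′)
  link-snake a a′ b b′ b< b′< with ℕ.<-cmp a a′
  ... | tri< a<a′ _ _ = trans (link-< (link true b b′) a<a′) (sym (link-< true (snake-< b b′ b< a<a′)))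
  ... | tri> _ _ a′<a = trans (link-> (link true b b′) a′<a) (sym (link-> true (snake-< b′ b b′< a′<a)))
  ... | tri≈ _ refl _ = trans (link-refl (link true b b′) a) (snake-row a b b′ b< b′<)

link₊ : ∀ {M} → Fin M → Fin M → Bool
link₊ b b′ = link true (toℕ b) (toℕ b′)

module Biwords (A j : ℕ) where
  open Snake j
  M N : ℕ
  M = suc 2j
  N = A ℕ.* M

  -- The pattern imposed on `g` is made by `u`, so neither sum can be evaluated alone; both words
  -- are extended by one letter at a time.
  biwords-from : ∀ m (a : Fin A) (b : Fin M) →
    ∑ (allWords M m) (λ u → ∑ (allWords A m) (λ g → 𝟙 (compat (ascents link₊ (b ∷ u)) (a ∷ g))))
    ≡ chainsFrom N (replicate m true) (snake 2j (toℕ a) (toℕ b))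
  biwords-from zero    a b = refl
  biwords-from (suc m) a b = begin
    ∑ (allWords M (suc m)) (λ u → ∑ (allWords A (suc m)) (λ g → 𝟙 (compat (ascents link₊ (b ∷ u)) (a ∷ g))))
      ≡⟨ ∑-allWords M m _ ⟩
    ∑ (allFin M) (λ b′ → ∑ (allWords M m) (λ u → ∑ (allWords A (suc m)) (λ g → 𝟙 (compat (ascents link₊ (b ∷ b′ ∷ u)) (a ∷ g)))))
      ≡⟨ ∑-cong (allFin M) (λ b′ → trans (∑-cong (allWords M m) (λ u → ∑-allWords A m _)) (∑-swap (allWords M m) (allFin A) _)) ⟩
    ∑ (allFin M) (λ b′ → ∑ (allFin A) (λ a′ → ∑ (allWords M m) (λ u → ∑ (allWords A m) (λ g →
      𝟙 (link (link₊ b b′) (toℕ a) (toℕ a′) ∧ compat (ascents link₊ (b′ ∷ u)) (a′ ∷ g))))))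
      ≡⟨ ∑-cong (allFin M) (λ b′ → ∑-cong (allFin A) (λ a′ → factor a′ b′)) ⟩
    ∑ (allFin M) (λ b′ → ∑ (allFin A) (λ a′ → φ (snake 2j (toℕ a′) (toℕ b′))))
      ≡⟨ ∑-swap (allFin M) (allFin A) _ ⟩
    ∑ (allFin A) (λ a′ → ∑ (allFin M) (λ b′ → φ (snake 2j (toℕ a′) (toℕ b′))))
      ≡⟨ ∑-cong (allFin A) (λ a′ → ∑-allFin M (λ b′ → φ (snake 2j (toℕ a′) b′))) ⟩
    ∑ (allFin A) (λ a′ → ∑< M (λ b′ → φ (snake 2j (toℕ a′) b′)))
      ≡⟨ ∑-allFin A (λ a′ → ∑< M (λ b′ → φ (snake 2j a′ b′))) ⟩
    ∑< A (λ a′ → ∑< M (λ b′ → φ (snake 2j a′ b′)))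
      ≡⟨ ∑<-snake A 2j φ ⟩
    ∑< N φ ∎
    where
    open ≡-Reasoning
    φ : ℕ → ℕ
    φ y = 𝟙 (link true (snake 2j (toℕ a) (toℕ b)) y) ℕ.* chainsFrom N (replicate m true) y
    factor : ∀ a′ b′ → ∑ (allWords M m) (λ u → ∑ (allWords A m) (λ g →
      𝟙 (link (link₊ b b′) (toℕ a) (toℕ a′) ∧ compat (ascents link₊ (b′ ∷ u)) (a′ ∷ g)))) ≡ φ (snake 2j (toℕ a′) (toℕ b′))
    factor a′ b′ = begin
      ∑ (allWords M m) (λ u → ∑ (allWords A m) (λ g → 𝟙 (l ∧ c u g)))
        ≡⟨ ∑-cong (allWords M m) (λ u → trans (∑-cong (allWords A m) (λ g → 𝟙-∧ l (c u g))) (∑-*ˡ (allWords A m) (𝟙 l) (𝟙 ∘ c u))) ⟩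
      ∑ (allWords M m) (λ u → 𝟙 l ℕ.* ∑ (allWords A m) (𝟙 ∘ c u))
        ≡⟨ ∑-*ˡ (allWords M m) (𝟙 l) (λ u → ∑ (allWords A m) (𝟙 ∘ c u)) ⟩
      𝟙 l ℕ.* ∑ (allWords M m) (λ u → ∑ (allWords A m) (𝟙 ∘ c u))
        ≡⟨ cong₂ ℕ._*_ (cong 𝟙 (link-snake (toℕ a) (toℕ a′) (toℕ b) (toℕ b′) (Fin.toℕ<n b) (Fin.toℕ<n b′))) (biwords-from m a′ b′) ⟩
      φ (snake 2j (toℕ a′) (toℕ b′)) ∎
      where
      l : Bool
      l = link (link₊ b b′) (toℕ a) (toℕ a′)
      c : Vec (Fin M) m → Vec (Fin A) m → Bool
      c u g = compat (ascents link₊ (b′ ∷ u)) (a′ ∷ g)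

  biwords : ∀ m → ∑ (allWords M (suc m)) (λ u → ∑ (allWords A (suc m)) (λ g → 𝟙 (compat (ascents link₊ u) g)))
    ≡ ∑< N (chainsFrom N (replicate m true))
  biwords m = begin
    ∑ (allWords M (suc m)) (λ u → ∑ (allWords A (suc m)) (λ g → 𝟙 (compat (ascents link₊ u) g)))
      ≡⟨ ∑-allWords M m _ ⟩
    ∑ (allFin M) (λ b → ∑ (allWords M m) (λ u → ∑ (allWords A (suc m)) (λ g → 𝟙 (compat (ascents link₊ (b ∷ u)) g))))
      ≡⟨ ∑-cong (allFin M) (λ b → trans (∑-cong (allWords M m) (λ u → ∑-allWords A m _)) (∑-swap (allWords M m) (allFin A) _)) ⟩
    ∑ (allFin M) (λ b → ∑ (allFin A) (λ a → ∑ (allWords M m) (λ u → ∑ (allWords A m) (λ g → 𝟙 (compat (ascents link₊ (b ∷ u)) (a ∷ g))))))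
      ≡⟨ ∑-cong (allFin M) (λ b → ∑-cong (allFin A) (λ a → biwords-from m a b)) ⟩
    ∑ (allFin M) (λ b → ∑ (allFin A) (λ a → φ (snake 2j (toℕ a) (toℕ b))))
      ≡⟨ ∑-swap (allFin M) (allFin A) _ ⟩
    ∑ (allFin A) (λ a → ∑ (allFin M) (λ b → φ (snake 2j (toℕ a) (toℕ b))))
      ≡⟨ ∑-cong (allFin A) (λ a → ∑-allFin M (λ b → φ (snake 2j (toℕ a) b))) ⟩
    ∑ (allFin A) (λ a → ∑< M (λ b → φ (snake 2j (toℕ a) b)))
      ≡⟨ ∑-allFin A (λ a → ∑< M (λ b → φ (snake 2j a b))) ⟩
    ∑< A (λ a → ∑< M (λ b → φ (snake 2j a b)))
      ≡⟨ ∑<-snake A 2j φ ⟩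
    ∑< N φ ∎
    where
    open ≡-Reasoning
    φ : ℕ → ℕ
    φ = chainsFrom N (replicate m true)

Delannoy-sym : ∀ m n → Delannoy m n ≡ Delannoy n m
Delannoy-sym zero    n       = sym (Delannoy-0 n)
Delannoy-sym (suc m) zero    = refl
Delannoy-sym (suc m) (suc n) rewrite Delannoy-sym (suc m) n | Delannoy-sym m (suc n) | Delannoy-sym m n =
  cong (ℕ._+ Delannoy n m) (ℕ.+-comm (Delannoy n (suc m)) (Delannoy (suc n) m))

-- With ascents only, even letters alone repeat. Passing from `i` to `suc i` adds the terms at
-- `2i + 1` and `2i + 2`, and the odd term equals the one at `2i`; this is the Delannoy recursion.
chains-Delannoy : ∀ n i → chains (replicate n true) (i ℕ.* 2) ≡ Delannoy n i
chains-odd-Delannoy : ∀ n i → chains (replicate n true) (suc (i ℕ.* 2)) ≡ Delannoy n i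
chains-Delannoy zero    i = refl
chains-Delannoy (suc n) zero = trans (chains-Delannoy n 0) (Delannoy-0 n)
chains-Delannoy (suc n) (suc i) = begin
  chains (replicate (suc n) true) (suc i ℕ.* 2)
    ≡⟨ chains-true-even l (suc i) ⟩
  ∑< (suc (i ℕ.* 2)) (chains l) ℕ.+ chains l (suc (i ℕ.* 2)) ℕ.+ chains l (suc i ℕ.* 2)
    ≡⟨ cong₂ ℕ._+_ (cong₂ ℕ._+_ (trans (sym (chains-true-even l i)) (chains-Delannoy (suc n) i)) (chains-odd-Delannoy n i)) (chains-Delannoy n (suc i)) ⟩
  Delannoy (suc n) i ℕ.+ Delannoy n i ℕ.+ Delannoy n (suc i)
    ≡⟨ trans (ℕ.+-assoc (Delannoy (suc n) i) _ _) (trans (cong (Delannoy (suc n) i ℕ.+_) (ℕ.+-comm (Delannoy n i) _)) (sym (ℕ.+-assoc (Delannoy (suc n) i) _ _))) ⟩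
  Delannoy (suc n) (suc i) ∎
  where
  open ≡-Reasoning
  l : List Bool
  l = replicate n true
chains-odd-Delannoy zero    i = refl
chains-odd-Delannoy (suc n) i = trans (chains-true-odd (replicate n true) i)
  (trans (sym (chains-true-even (replicate n true) i)) (chains-Delannoy (suc n) i))

biwords-Delannoy : ∀ i j m →
  ∑ (allWords (suc (j ℕ.* 2)) (suc m)) (λ u → ∑ (allWords (suc (i ℕ.* 2)) (suc m)) (λ g → 𝟙 (compat (ascents link₊ u) g)))
  ≡ Delannoy (μ i j) (suc m)
biwords-Delannoy i j m = begin
  _ ≡⟨ Biwords.biwords (suc (i ℕ.* 2)) j m ⟩
  ∑< N (chainsFrom N (replicate m true))
    ≡⟨ cong (λ N → ∑< N (chainsFrom N (replicate m true))) N≡ ⟩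
  ∑< (suc (μ i j ℕ.* 2)) (chainsFrom (suc (μ i j ℕ.* 2)) (replicate m true))
    ≡⟨ ∑<-chainsFrom (μ i j) (replicate m true) ⟩
  chains (replicate (suc m) true) (μ i j ℕ.* 2)
    ≡⟨ chains-Delannoy (suc m) (μ i j) ⟩
  Delannoy (suc m) (μ i j)
    ≡⟨ Delannoy-sym (suc m) (μ i j) ⟩
  Delannoy (μ i j) (suc m) ∎
  where
  open ≡-Reasoning
  N : ℕ
  N = suc (i ℕ.* 2) ℕ.* suc (j ℕ.* 2)
  N≡ : N ≡ suc (μ i j ℕ.* 2)
  N≡ = solve 2 (λ i j → (con 1 :+ i :* con 2) :* (con 1 :+ j :* con 2) := con 1 :+ (con 2 :* i :* j :+ i :+ j) :* con 2) refl i j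
    where open +-*-Solver

-- Standardization

-- Prec is the order in which standardization numbers the occurrences (letter, position) of a word.
Ord : Bool → ℕ → ℕ → Set
Ord true  x y = x < y
Ord false x y = y < x

Prec : ℕ → ℕ → ℕ → ℕ → Set
Prec a x b y = a < b ⊎ (a ≡ b × Ord (even a) x y)

Ord-trans : ∀ c {x y z} → Ord c x y → Ord c y z → Ord c x z
Ord-trans true  p q = ℕ.<-trans p q
Ord-trans false p q = ℕ.<-trans q p

Ord-asym : ∀ c {x y} → Ord c x y → Ord c y x → ⊥
Ord-asym true  = ℕ.<-asym
Ord-asym false = ℕ.<-asym

Ord-total : ∀ c {x y} → x ≢ y → Ord c x y ⊎ Ord c y x
Ord-total c {x} {y} x≢y with ℕ.<-cmp x y | c
... | tri< x<y _ _ | true  = inj₁ x<y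
... | tri< x<y _ _ | false = inj₂ x<y
... | tri> _ _ y<x | true  = inj₂ y<x
... | tri> _ _ y<x | false = inj₁ y<x
... | tri≈ _ x≡y _ | _     = contradiction x≡y x≢y

Prec-trans : ∀ {a x b y c z} → Prec a x b y → Prec b y c z → Prec a x c z
Prec-trans (inj₁ p) (inj₁ q) = inj₁ (ℕ.<-trans p q)
Prec-trans (inj₁ p) (inj₂ (refl , _)) = inj₁ p
Prec-trans (inj₂ (refl , _)) (inj₁ q) = inj₁ q
Prec-trans {a} (inj₂ (refl , p)) (inj₂ (refl , q)) = inj₂ (refl , Ord-trans (even a) p q)

Prec-asym : ∀ {a x b y} → Prec a x b y → Prec b y a x → ⊥
Prec-asym (inj₁ p) (inj₁ q) = ℕ.<-asym p q
Prec-asym (inj₁ p) (inj₂ (refl , _)) = ℕ.<-irrefl refl p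
Prec-asym (inj₂ (refl , _)) (inj₁ q) = ℕ.<-irrefl refl q
Prec-asym {a} (inj₂ (refl , p)) (inj₂ (_ , q)) = Ord-asym (even a) p q

Prec-total : ∀ a {x} b {y} → x ≢ y → Prec a x b y ⊎ Prec b y a x
Prec-total a b x≢y with ℕ.<-cmp a b
... | tri< a<b _ _ = inj₁ (inj₁ a<b)
... | tri> _ _ b<a = inj₂ (inj₁ b<a)
... | tri≈ _ refl _ with Ord-total (even a) x≢y
...   | inj₁ p = inj₁ (inj₂ (refl , p))
...   | inj₂ p = inj₂ (inj₂ (refl , p))

link⇒Prec : ∀ {a x b y} → x ≢ y → link (x <ᵇ y) a b ≡ true → Prec a x b y
link⇒Prec {a} {x} {b} {y} x≢y e with ℕ.<-cmp a b
... | tri< a<b _ _ = inj₁ a<b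
... | tri> _ _ b<a with () ← trans (sym e) (link-> (x <ᵇ y) b<a)
... | tri≈ _ refl _ = inj₂ (refl , ord (even a) (trans (sym (link-refl (x <ᵇ y) a)) e))
  where
  ord : ∀ c → (c == (x <ᵇ y)) ≡ true → Ord c x y
  ord true  e = <ᵇ⇒< x y e
  ord false e = <ᵇ⇒< y x (trans (<ᵇ-flip x≢y) e)

Prec⇒link : ∀ {a x b y} → x ≢ y → Prec a x b y → link (x <ᵇ y) a b ≡ true
Prec⇒link {x = x} {y = y} x≢y (inj₁ a<b) = link-< (x <ᵇ y) a<b
Prec⇒link {a} {x} {_} {y} x≢y (inj₂ (refl , o)) = trans (link-refl (x <ᵇ y) a) (ord (even a) o)
  where
  ord : ∀ c → Ord c x y → (c == (x <ᵇ y)) ≡ true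
  ord true  x<y = <⇒<ᵇ x<y
  ord false y<x = trans (sym (<ᵇ-flip x≢y)) (<⇒<ᵇ y<x)

∧-true : ∀ b {c} → (b ∧ c) ≡ true → b ≡ true × c ≡ true
∧-true true e = refl , e

PrecAt : ∀ {n M m} → Vec (Fin n) m → Vec (Fin M) m → Fin m → Fin m → Set
PrecAt σ h v v′ = Prec (toℕ (lookup h v)) (toℕ (lookup σ v)) (toℕ (lookup h v′)) (toℕ (lookup σ v′))

toℕ-≢ : ∀ {n} {i j : Fin n} → i ≢ j → toℕ i ≢ toℕ j
toℕ-≢ i≢j e = i≢j (Fin.toℕ-injective e)

tail-injective : ∀ {n m} x (σ : Vec (Fin n) m) → Injective _≡_ _≡_ (lookup (x ∷ σ)) → Injective _≡_ _≡_ (lookup σ)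
tail-injective x σ inj {i} {j} e = Fin.suc-injective (inj {suc i} {suc j} e)

heads-distinct : ∀ {n m} x y (σ : Vec (Fin n) m) → Injective _≡_ _≡_ (lookup (x ∷ y ∷ σ)) → toℕ x ≢ toℕ y
heads-distinct x y σ inj = toℕ-≢ (λ e → contradiction (inj {zero} {suc zero} e) λ ())

-- `compat` compares neighbours only; transitivity of `Prec` extends it to all pairs of positions.
compat⇒Prec : ∀ {n M m} (σ : Vec (Fin n) m) (h : Vec (Fin M) m) → Injective _≡_ _≡_ (lookup σ) →
  compat (ascents _<F_ σ) h ≡ true → ∀ {v v′} → v Fin.< v′ → PrecAt σ h v v′
compat⇒Prec (x ∷ [])    (a ∷ [])    inj e {zero}  {zero}  ()
compat⇒Prec (x ∷ y ∷ σ) (a ∷ b ∷ h) inj e {v} {v′} v<v′ with ∧-true (link (x <F y) (toℕ a) (toℕ b)) e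
compat⇒Prec (x ∷ y ∷ σ) (a ∷ b ∷ h) inj e {zero}  {suc zero}     v<v′       | l , c = link⇒Prec (heads-distinct x y σ inj) l
compat⇒Prec (x ∷ y ∷ σ) (a ∷ b ∷ h) inj e {zero}  {suc (suc v′)} v<v′       | l , c =
  Prec-trans (link⇒Prec (heads-distinct x y σ inj) l)
             (compat⇒Prec (y ∷ σ) (b ∷ h) (tail-injective x (y ∷ σ) inj) c {zero} {suc v′} (s≤s z≤n))
compat⇒Prec (x ∷ y ∷ σ) (a ∷ b ∷ h) inj e {suc v} {suc v′}       (s≤s v<v′) | l , c =
  compat⇒Prec (y ∷ σ) (b ∷ h) (tail-injective x (y ∷ σ) inj) c {v} {v′} v<v′

Prec⇒compat : ∀ {n M m} (σ : Vec (Fin n) m) (h : Vec (Fin M) m) → Injective _≡_ _≡_ (lookup σ) →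
  (∀ {v v′} → v Fin.< v′ → PrecAt σ h v v′) → compat (ascents _<F_ σ) h ≡ true
Prec⇒compat []          []          inj p = refl
Prec⇒compat (x ∷ [])    (a ∷ [])    inj p = refl
Prec⇒compat (x ∷ y ∷ σ) (a ∷ b ∷ h) inj p = cong₂ _∧_
  (Prec⇒link {toℕ a} {toℕ x} {toℕ b} {toℕ y} (heads-distinct x y σ inj) (p {zero} {suc zero} (s≤s z≤n)))
  (Prec⇒compat (y ∷ σ) (b ∷ h) (tail-injective x (y ∷ σ) inj) (λ {v} {v′} v<v′ → p {suc v} {suc v′} (s≤s v<v′)))

ascents-cong : ∀ {A B : Set} {m} (r : A → A → Bool) (r′ : B → B → Bool) (w : Vec A m) (w′ : Vec B m) →
  (∀ k l → toℕ l ≡ suc (toℕ k) → r (lookup w k) (lookup w l) ≡ r′ (lookup w′ k) (lookup w′ l)) →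
  ascents r w ≡ ascents r′ w′
ascents-cong r r′ []          []            e = refl
ascents-cong r r′ (x ∷ [])    (x′ ∷ [])     e = refl
ascents-cong r r′ (x ∷ y ∷ w) (x′ ∷ y′ ∷ w′) e = cong₂ _∷_ (e zero (suc zero) refl)
  (ascents-cong r r′ (y ∷ w) (y′ ∷ w′) (λ k l l≡ → e (suc k) (suc l) (cong suc l≡)))

mono⇒≤ : ∀ {n} (f : Fin n → Fin n) → (∀ {i j} → i Fin.< j → f i Fin.< f j) → ∀ i → toℕ i ≤ toℕ (f i)
mono⇒≤ {n} f mono i = subst (λ k → toℕ k ≤ toℕ (f k)) (Fin.fromℕ<-toℕ i (Fin.toℕ<n i)) (go (toℕ i) (Fin.toℕ<n i))
  where
  go : ∀ k (k<n : k < n) → toℕ (Fin.fromℕ< k<n) ≤ toℕ (f (Fin.fromℕ< k<n))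
  go zero    k<n = subst (_≤ toℕ (f (Fin.fromℕ< k<n))) (sym (Fin.toℕ-fromℕ< k<n)) z≤n
  go (suc k) k<n = begin
    toℕ (Fin.fromℕ< k<n)          ≡⟨ Fin.toℕ-fromℕ< k<n ⟩
    suc k                         ≡⟨ cong suc (Fin.toℕ-fromℕ< k<n′) ⟨
    suc (toℕ (Fin.fromℕ< k<n′))   ≤⟨ s≤s (go k k<n′) ⟩
    suc (toℕ (f (Fin.fromℕ< k<n′))) ≤⟨ mono (subst₂ _<_ (sym (Fin.toℕ-fromℕ< k<n′)) (sym (Fin.toℕ-fromℕ< k<n)) ℕ.≤-refl) ⟩
    toℕ (f (Fin.fromℕ< k<n))      ∎
    where
    open ℕ.≤-Reasoning
    k<n′ : k < n
    k<n′ = ℕ.<⇒≤ k<n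

∑-mono-≤ : ∀ {A : Set} (xs : List A) {f g : A → ℕ} → (∀ x → f x ≤ g x) → ∑ xs f ≤ ∑ xs g
∑-mono-≤ []       p = z≤n
∑-mono-≤ (x ∷ xs) p = ℕ.+-mono-≤ (p x) (∑-mono-≤ xs p)

∑-mono-< : ∀ {A : Set} {xs : List A} {f g : A → ℕ} {x} → (∀ x → f x ≤ g x) → x ∈ xs → f x < g x → ∑ xs f < ∑ xs g
∑-mono-< {xs = y ∷ xs} p (here refl) q = ℕ.+-mono-<-≤ q (∑-mono-≤ xs p)
∑-mono-< {xs = y ∷ xs} p (there x∈)  q = ℕ.+-mono-≤-< (p y) (∑-mono-< p x∈ q)

𝟙≤1 : ∀ b → 𝟙 b ≤ 1
𝟙≤1 true  = ℕ.≤-refl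
𝟙≤1 false = z≤n

module Standardization {n M : ℕ} (u : Vec (Fin M) n) where
  _≺_ : Fin n → Fin n → Set
  k ≺ l = Prec (toℕ (lookup u k)) (toℕ k) (toℕ (lookup u l)) (toℕ l)

  -- The test for distinct positions matters: `k <F k` is false and odd letters repeat on false, so
  -- `link` alone would put an odd letter before itself.
  before : Fin n → Fin n → Bool
  before k l = not (toℕ k ≡ᵇ toℕ l) ∧ link (k <F l) (toℕ (lookup u k)) (toℕ (lookup u l))

  before-sound : ∀ {k l} → before k l ≡ true → k ≺ l
  before-sound {k} {l} e with toℕ k ≡ᵇ toℕ l in eq
  ... | false = link⇒Prec (λ k≡l → contradiction (trans (sym (trans (cong (_≡ᵇ toℕ l) k≡l) (≡ᵇ-refl (toℕ l)))) eq) λ ()) e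

  before-complete : ∀ {k l} → k ≺ l → before k l ≡ true
  before-complete {k} {l} p = cong₂ _∧_ (cong not (≢⇒≡ᵇ k≢l)) (Prec⇒link k≢l p)
    where
    k≢l : toℕ k ≢ toℕ l
    k≢l e with refl ← Fin.toℕ-injective {i = k} {j = l} e = Prec-asym p p

  ≺-irrefl : ∀ k → before k k ≡ false
  ≺-irrefl k rewrite ≡ᵇ-refl (toℕ k) = refl

  rank : Fin n → ℕ
  rank k = ∑ (allFin n) (λ l → 𝟙 (before l k))

  rank<n : ∀ k → rank k < n
  rank<n k = subst (rank k <_) (trans (∑-const (allFin n) 1) (trans (ℕ.*-identityʳ _) (List.length-tabulate id)))
    (∑-mono-< (λ l → 𝟙≤1 (before l k)) (∈-allFin k) (subst (λ b → 𝟙 b < 1) (sym (≺-irrefl k)) (s≤s z≤n)))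

  rank-mono : ∀ {k l} → k ≺ l → rank k < rank l
  rank-mono {k} {l} p = ∑-mono-< le (∈-allFin k)
    (subst₂ (λ b c → 𝟙 b < 𝟙 c) (sym (≺-irrefl k)) (sym (before-complete p)) (s≤s z≤n))
    where
    le : ∀ x → 𝟙 (before x k) ≤ 𝟙 (before x l)
    le x with before x k in eq
    ... | false = z≤n
    ... | true  rewrite before-complete {x} {l} (Prec-trans (before-sound eq) p) = ℕ.≤-refl

  std : Vec (Fin n) n
  std = tabulate (λ k → Fin.fromℕ< (rank<n k))

  toℕ-std : ∀ k → toℕ (lookup std k) ≡ rank k
  toℕ-std k = trans (cong toℕ (Vec.lookup∘tabulate (λ k → Fin.fromℕ< (rank<n k)) k)) (Fin.toℕ-fromℕ< (rank<n k))

  std-isPerm : IsPerm std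
  std-isPerm {k} {l} e with k Fin.≟ l
  ... | yes k≡l = k≡l
  ... | no  k≢l with Prec-total (toℕ (lookup u k)) (toℕ (lookup u l)) (toℕ-≢ k≢l)
  ...   | inj₁ p = contradiction (trans (sym (toℕ-std k)) (trans (cong toℕ e) (toℕ-std l))) (ℕ.<⇒≢ (rank-mono p))
  ...   | inj₂ p = contradiction (trans (sym (toℕ-std l)) (trans (cong toℕ (sym e)) (toℕ-std k))) (ℕ.<⇒≢ (rank-mono p))

  std-< : ∀ {k l} → lookup std k Fin.< lookup std l → k ≺ l
  std-< {k} {l} lt with k Fin.≟ l
  ... | yes refl = contradiction refl (ℕ.<⇒≢ lt)
  ... | no  k≢l with Prec-total (toℕ (lookup u k)) (toℕ (lookup u l)) (toℕ-≢ k≢l)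
  ...   | inj₁ p = p
  ...   | inj₂ p = contradiction lt (ℕ.<-asym (subst₂ _<_ (sym (toℕ-std l)) (sym (toℕ-std k)) (rank-mono p)))

vec-ext : ∀ {A : Set} {m} (v w : Vec A m) → (∀ k → lookup v k ≡ lookup w k) → v ≡ w
vec-ext v w e = trans (sym (Vec.tabulate∘lookup v)) (trans (Vec.tabulate-cong e) (Vec.tabulate∘lookup w))

-- `h` lists the letters of a word in weakly increasing order, and the inverse of `π` tells where
-- each of them came from. Compatibility says that occurrences of equal letters are taken in the
-- order `Prec`.
compatPairs : ∀ n M → List (Vec (Fin n) n × Vec (Fin M) n)
compatPairs n M = filter (λ πh → compat (ascents _<F_ (inverse (proj₁ πh))) (proj₂ πh) Bool.≟ true)
  (cartesianProduct (Sym n) (allWords M n))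

module _ {n M : ℕ} where
  compose : Vec (Fin n) n × Vec (Fin M) n → Vec (Fin M) n
  compose (π , h) = tabulate (λ k → lookup h (lookup π k))

  ∈-compatPairs⁻ : ∀ {π h} → (π , h) ∈ compatPairs n M →
    IsPerm π × compat (ascents _<F_ (inverse π)) h ≡ true
  ∈-compatPairs⁻ p∈ with ∈-filter⁻ (λ πh → compat (ascents _<F_ (inverse (proj₁ πh))) (proj₂ πh) Bool.≟ true)
                           {xs = cartesianProduct (Sym n) (allWords M n)} p∈
  ... | p∈′ , c = ∈-Sym⁻ (proj₁ (∈-cartesianProduct⁻ (Sym n) (allWords M n) p∈′)) , c

  ∈-compatPairs⁺ : ∀ {π h} → IsPerm π → compat (ascents _<F_ (inverse π)) h ≡ true → (π , h) ∈ compatPairs n M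
  ∈-compatPairs⁺ {π} {h} inj c = ∈-filter⁺ (λ πh → compat (ascents _<F_ (inverse (proj₁ πh))) (proj₂ πh) Bool.≟ true)
    (∈-cartesianProduct⁺ (∈-Sym⁺ inj) (∈-allWords h)) c

  pair-< : ∀ {π h} → (π , h) ∈ compatPairs n M → ∀ {k l} →
    lookup π k Fin.< lookup π l → Standardization._≺_ (compose (π , h)) k l
  pair-< {π} {h} p∈ {k} {l} lt with ∈-compatPairs⁻ p∈
  ... | inj , c = subst₂ (λ a b → Prec a (toℕ k) b (toℕ l)) (letter k) (letter l)
      (subst₂ (λ x y → Prec (toℕ (lookup h (lookup π k))) x (toℕ (lookup h (lookup π l))) y)
        (cong toℕ (inverse-lookup π inj k)) (cong toℕ (inverse-lookup π inj l))
        (compat⇒Prec (inverse π) h (inverse-isPerm π inj) c lt))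
    where
    letter : ∀ k → toℕ (lookup h (lookup π k)) ≡ toℕ (lookup (compose (π , h)) k)
    letter k = cong toℕ (sym (Vec.lookup∘tabulate (λ k → lookup h (lookup π k)) k))

  pair-≺ : ∀ {π h} → (π , h) ∈ compatPairs n M → ∀ {k l} →
    Standardization._≺_ (compose (π , h)) k l → lookup π k Fin.< lookup π l
  pair-≺ {π} {h} p∈ {k} {l} p with ℕ.<-cmp (toℕ (lookup π k)) (toℕ (lookup π l))
  ... | tri< lt _ _ = lt
  ... | tri> _ _ gt = ⊥-elim (Prec-asym p (pair-< p∈ gt))
  ... | tri≈ _ e _ with refl ← proj₁ (∈-compatPairs⁻ p∈) {k} {l} (Fin.toℕ-injective e) = ⊥-elim (Prec-asym p p)

  -- For neighbouring positions `k < l` the order `Prec` is the condition `link true`, so the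
  -- ascents of `π` can be read from the composed word alone.
  pair-ascents : ∀ {π h} → (π , h) ∈ compatPairs n M → ascents _<F_ π ≡ ascents link₊ (compose (π , h))
  pair-ascents {π} {h} p∈ = ascents-cong _<F_ link₊ π u adjacent
    where
    u : Vec (Fin M) n
    u = compose (π , h)
    adjacent : ∀ k l → toℕ l ≡ suc (toℕ k) → (lookup π k <F lookup π l) ≡ link₊ (lookup u k) (lookup u l)
    adjacent k l l≡1+k = bool-ext
      (λ e → subst (λ b → L b ≡ true) k<l (Prec⇒link k≢l (pair-< p∈ {k} {l} (<ᵇ⇒< _ _ e))))
      (λ e → <⇒<ᵇ (pair-≺ p∈ {k} {l} (link⇒Prec k≢l (subst (λ b → L b ≡ true) (sym k<l) e))))
      where
      L : Bool → Bool
      L b = link b (toℕ (lookup u k)) (toℕ (lookup u l))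
      k≢l : toℕ k ≢ toℕ l
      k≢l e = ℕ.1+n≢n (trans (sym l≡1+k) (sym e))
      k<l : (k <F l) ≡ true
      k<l = <⇒<ᵇ (ℕ.≤-reflexive (sym l≡1+k))

  -- Both permutations order the positions of the same word by `≺`, so `π′ ∘ π⁻¹` is increasing and
  -- lies above the identity. Exchanging the two gives equality.
  compose-≤ : ∀ {π h π′ h′} → (π , h) ∈ compatPairs n M → (π′ , h′) ∈ compatPairs n M →
    compose (π , h) ≡ compose (π′ , h′) → ∀ k → toℕ (lookup π k) ≤ toℕ (lookup π′ k)
  compose-≤ {π} {h} {π′} {h′} p∈ p′∈ e k = subst (λ k′ → toℕ (lookup π k) ≤ toℕ (lookup π′ k′)) (inverse-lookup π inj k)
    (mono⇒≤ (λ v → lookup π′ (lookup (inverse π) v)) mono (lookup π k))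
    where
    inj : IsPerm π
    inj = proj₁ (∈-compatPairs⁻ p∈)
    mono : ∀ {i j} → i Fin.< j → lookup π′ (lookup (inverse π) i) Fin.< lookup π′ (lookup (inverse π) j)
    mono {i} {j} i<j = pair-≺ p′∈ (subst (λ u → Standardization._≺_ u (lookup (inverse π) i) (lookup (inverse π) j)) e
      (pair-< p∈ (subst₂ Fin._<_ (sym (lookup-inverse π inj i)) (sym (lookup-inverse π inj j)) i<j)))

  compose-injective : ∀ {p q} → p ∈ compatPairs n M → q ∈ compatPairs n M → compose p ≡ compose q → p ≡ q
  compose-injective {π , h} {π′ , h′} p∈ q∈ e with vec-ext π π′ (λ k → Fin.toℕ-injective
    (ℕ.≤-antisym (compose-≤ p∈ q∈ e k) (compose-≤ q∈ p∈ (sym e) k)))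
  ... | refl = cong (π ,_) (vec-ext h h′ λ v → trans (sym (at h v)) (trans (cong (λ u → lookup u (lookup (inverse π) v)) e) (at h′ v)))
    where
    inj : IsPerm π
    inj = proj₁ (∈-compatPairs⁻ p∈)
    at : ∀ h v → lookup (compose (π , h)) (lookup (inverse π) v) ≡ lookup h v
    at h v = trans (Vec.lookup∘tabulate (λ k → lookup h (lookup π k)) (lookup (inverse π) v)) (cong (lookup h) (lookup-inverse π inj v))

  -- The preimage is the standardization of `u` together with the letters of `u` in sorted order.
  compose-surjective : ∀ u → ∃ λ p → p ∈ compatPairs n M × compose p ≡ u
  compose-surjective u = (std , h) , ∈-compatPairs⁺ std-isPerm (Prec⇒compat (inverse std) h (inverse-isPerm std std-isPerm) prec) ,
      vec-ext _ u (λ k → trans (Vec.lookup∘tabulate (λ k → lookup h (lookup std k)) k) (trans (lookup-h (lookup std k)) (cong (lookup u) (inverse-lookup std std-isPerm k))))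
    where
    open Standardization u
    h : Vec (Fin M) n
    h = tabulate (λ v → lookup u (lookup (inverse std) v))
    lookup-h : ∀ v → lookup h v ≡ lookup u (lookup (inverse std) v)
    lookup-h = Vec.lookup∘tabulate (λ v → lookup u (lookup (inverse std) v))
    prec : ∀ {v v′} → v Fin.< v′ → PrecAt (inverse std) h v v′
    prec {v} {v′} v<v′ = subst₂ (λ a b → Prec a (toℕ (lookup (inverse std) v)) b (toℕ (lookup (inverse std) v′)))
      (cong toℕ (sym (lookup-h v))) (cong toℕ (sym (lookup-h v′)))
      (std-< (subst₂ Fin._<_ (sym (lookup-inverse std std-isPerm v)) (sym (lookup-inverse std std-isPerm v′)) v<v′))

-- `Φ` sees `π` only through its ascents, which the word `h ∘ π` retains. Replacing each pair by
-- this word removes the permutations from the sum.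
standardization : ∀ n M (Φ : List Bool → ℕ) →
  ∑ (Sym n) (λ π → Φ (ascents _<F_ π) ℕ.* ∑ (allWords M n) (𝟙 ∘ compat (ascents _<F_ (inverse π))))
  ≡ ∑ (allWords M n) (Φ ∘ ascents link₊)
standardization n M Φ = begin
  ∑ (Sym n) (λ π → Φ (ascents _<F_ π) ℕ.* ∑ (allWords M n) (𝟙 ∘ c π))
    ≡⟨ ∑-cong (Sym n) (λ π → trans (sym (∑-*ˡ (allWords M n) (Φ (ascents _<F_ π)) (𝟙 ∘ c π)))
         (∑-cong (allWords M n) (λ h → ℕ.*-comm (Φ (ascents _<F_ π)) (𝟙 (c π h))))) ⟩
  ∑ (Sym n) (λ π → ∑ (allWords M n) (λ h → 𝟙 (c π h) ℕ.* Φ (ascents _<F_ π)))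
    ≡⟨ ∑-product _,_ (Sym n) (allWords M n) (λ πh → 𝟙 (c (proj₁ πh) (proj₂ πh)) ℕ.* Φ (ascents _<F_ (proj₁ πh))) ⟨
  ∑ (cartesianProduct (Sym n) (allWords M n)) (λ πh → 𝟙 (c (proj₁ πh) (proj₂ πh)) ℕ.* Φ (ascents _<F_ (proj₁ πh)))
    ≡⟨ ∑-filter (λ πh → c (proj₁ πh) (proj₂ πh)) (cartesianProduct (Sym n) (allWords M n)) (λ πh → Φ (ascents _<F_ (proj₁ πh))) ⟨
  ∑ (compatPairs n M) (λ πh → Φ (ascents _<F_ (proj₁ πh)))
    ≡⟨ ∑-cong-∈ (compatPairs n M) (λ p∈ → cong Φ (pair-ascents p∈)) ⟩
  ∑ (compatPairs n M) (λ πh → Φ (ascents link₊ (compose πh)))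
    ≡⟨ ∑-bijection compose (Φ ∘ ascents link₊) unique-pairs (unique-allWords M n)
         (λ {p} _ → ∈-allWords (compose p)) compose-injective (λ {u} _ → compose-surjective u) ⟩
  ∑ (allWords M n) (Φ ∘ ascents link₊) ∎
  where
  open ≡-Reasoning
  c : Vec (Fin n) n → Vec (Fin M) n → Bool
  c π = compat (ascents _<F_ (inverse π))
  unique-pairs : Unique (compatPairs n M)
  unique-pairs = Unique.filter⁺ (λ πh → compat (ascents _<F_ (inverse (proj₁ πh))) (proj₂ πh) Bool.≟ true)
    (Unique.cartesianProduct⁺ (unique-Sym n) (unique-allWords M n))

two-sided-count : ∀ m i j →
  ∑ (Sym (suc m)) (λ π → chains (true ∷ ascents _<F_ π) (i ℕ.* 2) ℕ.* chains (true ∷ ascents _<F_ (inverse π)) (j ℕ.* 2))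
  ≡ Delannoy (μ i j) (suc m)
two-sided-count m i j = begin
  ∑ (Sym (suc m)) (λ π → Φ (ascents _<F_ π) ℕ.* chains (true ∷ ascents _<F_ (inverse π)) (j ℕ.* 2))
    ≡⟨ ∑-cong (Sym (suc m)) (λ π → cong (Φ (ascents _<F_ π) ℕ.*_) (compat-count j m (ascents _<F_ (inverse π)) (length-ascents _<F_ (inverse π)))) ⟨
  ∑ (Sym (suc m)) (λ π → Φ (ascents _<F_ π) ℕ.* ∑ (allWords (suc (j ℕ.* 2)) (suc m)) (𝟙 ∘ compat (ascents _<F_ (inverse π))))
    ≡⟨ standardization (suc m) (suc (j ℕ.* 2)) Φ ⟩
  ∑ (allWords (suc (j ℕ.* 2)) (suc m)) (Φ ∘ ascents link₊)
    ≡⟨ ∑-cong (allWords (suc (j ℕ.* 2)) (suc m)) (λ u → compat-count i m (ascents link₊ u) (length-ascents link₊ u)) ⟨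
  ∑ (allWords (suc (j ℕ.* 2)) (suc m)) (λ u → ∑ (allWords (suc (i ℕ.* 2)) (suc m)) (𝟙 ∘ compat (ascents link₊ u)))
    ≡⟨ biwords-Delannoy i j m ⟩
  Delannoy (μ i j) (suc m) ∎
  where
  open ≡-Reasoning
  Φ : List Bool → ℕ
  Φ l = chains (true ∷ l) (i ℕ.* 2)

-- Decomposition of permutations

cons : ∀ {n} → Fin (suc n) × Vec (Fin n) n → Vec (Fin (suc n)) (suc n)
cons (v , w) = v ∷ Vec.map (punchIn v) w

cons-isPerm : ∀ {n} v (w : Vec (Fin n) n) → IsPerm w → IsPerm (cons (v , w))
cons-isPerm v w inj {zero}  {zero}  e = refl
cons-isPerm v w inj {zero}  {suc j} e = contradiction (sym (trans e (Vec.lookup-map j (punchIn v) w))) (Fin.punchInᵢ≢i v (lookup w j))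
cons-isPerm v w inj {suc i} {zero}  e = contradiction (trans (sym (Vec.lookup-map i (punchIn v) w)) e) (Fin.punchInᵢ≢i v (lookup w i))
cons-isPerm v w inj {suc i} {suc j} e = cong suc (inj (Fin.punchIn-injective v _ _
  (trans (sym (Vec.lookup-map i (punchIn v) w)) (trans e (Vec.lookup-map j (punchIn v) w)))))

cons-injective : ∀ {n} {p q : Fin (suc n) × Vec (Fin n) n} → cons p ≡ cons q → p ≡ q
cons-injective {p = v , w} {v′ , w′} e with Vec.∷-injective e
... | refl , e′ = cong (v ,_) (vec-ext w w′ λ k → Fin.punchIn-injective v _ _
  (trans (sym (Vec.lookup-map k (punchIn v) w)) (trans (cong (λ t → lookup t k) e′) (Vec.lookup-map k (punchIn v) w′))))

cons-surjective : ∀ {n} (w : Vec (Fin (suc n)) (suc n)) → IsPerm w → ∃ λ p → IsPerm (proj₂ p) × cons p ≡ w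
cons-surjective {n} (v ∷ t) inj = (v , t′) , t′-isPerm , cong (v ∷_) (vec-ext _ t λ k → trans (Vec.lookup-map k (punchIn v) t′) (lookup-t′ k))
  where
  v≢ : ∀ k → v ≢ lookup t k
  v≢ k e = contradiction (inj {zero} {suc k} e) λ ()
  t′ : Vec (Fin n) n
  t′ = tabulate (λ k → punchOut (v≢ k))
  lookup-t′ : ∀ k → punchIn v (lookup t′ k) ≡ lookup t k
  lookup-t′ k = trans (cong (punchIn v) (Vec.lookup∘tabulate (λ k → punchOut (v≢ k)) k)) (Fin.punchIn-punchOut (v≢ k))
  t′-isPerm : IsPerm t′
  t′-isPerm {i} {j} e = Fin.suc-injective (inj {suc i} {suc j} (trans (sym (lookup-t′ i)) (trans (cong (punchIn v) e) (lookup-t′ j))))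

∑-Sym-suc : ∀ n (φ : Vec (Fin (suc n)) (suc n) → ℕ) →
  ∑ (Sym (suc n)) φ ≡ ∑ (allFin (suc n)) (λ v → ∑ (Sym n) (λ w → φ (cons (v , w))))
∑-Sym-suc n φ = trans (sym (∑-bijection cons φ (Unique.cartesianProduct⁺ (Unique.allFin⁺ (suc n)) (unique-Sym n)) (unique-Sym (suc n))
    (λ {p} p∈ → ∈-Sym⁺ (cons-isPerm (proj₁ p) (proj₂ p) (∈-Sym⁻ (proj₂ (∈-cartesianProduct⁻ (allFin (suc n)) (Sym n) p∈)))))
    (λ _ _ → cons-injective)
    (λ {w} w∈ → let (p , perm , e) = cons-surjective w (∈-Sym⁻ w∈) in p , ∈-cartesianProduct⁺ (∈-allFin (proj₁ p)) (∈-Sym⁺ perm) , e)))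
  (∑-product _,_ (allFin (suc n)) (Sym n) (φ ∘ cons))

-- To insert `suc a` right after `zero` in a cycle, the old image of `zero` has to end up at
-- position `suc a`. `cons` leaves it at position 1, the first entry of the tail; `move` carries it
-- to place `a` of the tail, bijectively for each `a`.
module Move {k : ℕ} (a : Fin (suc k)) where
  ρ : Fin (suc k) → Fin (suc k)
  ρ zero    = a
  ρ (suc j) = punchIn a j

  ρ-injective : Injective _≡_ _≡_ ρ
  ρ-injective {zero}  {zero}  e = refl
  ρ-injective {zero}  {suc j} e = contradiction (sym e) (Fin.punchInᵢ≢i a j)
  ρ-injective {suc i} {zero}  e = contradiction e (Fin.punchInᵢ≢i a i)
  ρ-injective {suc i} {suc j} e = cong suc (Fin.punchIn-injective a i j e)

  move unmove : Vec (Fin (suc k)) (suc k) → Vec (Fin (suc k)) (suc k)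
  move (x ∷ w) = Vec.insertAt w a x
  unmove w = tabulate (lookup w ∘ ρ)

  lookup-move : ∀ w i → lookup (move w) (ρ i) ≡ lookup w i
  lookup-move (x ∷ w) zero    = Vec.insertAt-lookup w a x
  lookup-move (x ∷ w) (suc j) = Vec.insertAt-punchIn w a x j

  move-isPerm : ∀ w → IsPerm w → IsPerm (move w)
  move-isPerm w inj {i} {j} e with injective⇒surjective ρ ρ-injective i | injective⇒surjective ρ ρ-injective j
  ... | x , refl | y , refl = cong ρ (inj (trans (sym (lookup-move w x)) (trans e (lookup-move w y))))

  move-injective : ∀ {w w′} → move w ≡ move w′ → w ≡ w′
  move-injective {w} {w′} e = vec-ext w w′ λ i → trans (sym (lookup-move w i)) (trans (cong (λ t → lookup t (ρ i)) e) (lookup-move w′ i))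

  unmove-isPerm : ∀ w → IsPerm w → IsPerm (unmove w)
  unmove-isPerm w inj {i} {j} e = ρ-injective (inj (trans (sym (Vec.lookup∘tabulate (lookup w ∘ ρ) i)) (trans e (Vec.lookup∘tabulate (lookup w ∘ ρ) j))))

  move-unmove : ∀ w → move (unmove w) ≡ w
  move-unmove w = vec-ext _ w eq
    where
    eq : ∀ i → lookup (move (unmove w)) i ≡ lookup w i
    eq i with injective⇒surjective ρ ρ-injective i
    ... | x , refl = trans (lookup-move (unmove w) x) (Vec.lookup∘tabulate (lookup w ∘ ρ) x)

  ∑-move : ∀ φ → ∑ (Sym (suc k)) φ ≡ ∑ (Sym (suc k)) (φ ∘ move)
  ∑-move φ = sym (∑-bijection move φ (unique-Sym (suc k)) (unique-Sym (suc k))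
    (λ {w} w∈ → ∈-Sym⁺ (move-isPerm w (∈-Sym⁻ w∈))) (λ _ _ → move-injective)
    (λ {w} w∈ → unmove w , ∈-Sym⁺ (unmove-isPerm w (∈-Sym⁻ w∈)) , move-unmove w))

∑-allFin-punchIn : ∀ {k} (a : Fin (suc k)) (f : Fin (suc k) → ℕ) →
  ∑ (allFin (suc k)) f ≡ f a ℕ.+ ∑ (allFin k) (f ∘ punchIn a)
∑-allFin-punchIn {k}     zero    f = ∑-allFin-suc k f
∑-allFin-punchIn {suc k} (suc a) f = begin
  ∑ (allFin (suc (suc k))) f
    ≡⟨ ∑-allFin-suc (suc k) f ⟩
  f zero ℕ.+ ∑ (allFin (suc k)) (f ∘ suc)
    ≡⟨ cong (f zero ℕ.+_) (∑-allFin-punchIn a (f ∘ suc)) ⟩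
  f zero ℕ.+ (f (suc a) ℕ.+ ∑ (allFin k) (f ∘ suc ∘ punchIn a))
    ≡⟨ x∙yz≈y∙xz (f zero) (f (suc a)) _ ⟩
  f (suc a) ℕ.+ (f zero ℕ.+ ∑ (allFin k) (f ∘ suc ∘ punchIn a))
    ≡⟨ cong (f (suc a) ℕ.+_) (∑-allFin-suc k (f ∘ punchIn (suc a))) ⟨
  f (suc a) ℕ.+ ∑ (allFin (suc k)) (f ∘ punchIn (suc a)) ∎
  where
  open ≡-Reasoning
  open import Algebra.Properties.CommutativeSemigroup ℕ.+-commutativeSemigroup using (x∙yz≈y∙xz)

-- Cycles

firstReturn : ∀ {n} (w : Vec (Fin n) n) (i : Fin n) → List ℕ → ℕ
firstReturn w i []       = 0
firstReturn w i (m ∷ ms) = if toℕ (iter w m i) ≡ᵇ toℕ i then m else firstReturn w i ms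

mutual
  cycleLength-firstReturn : ∀ {n} (w : Vec (Fin n) n) i → cycleLength w i ≡ firstReturn w i (map suc (upTo n))
  cycleLength-firstReturn {n} w i with map ℕ.suc (upTo n)
  ... | ms = firstReturn-aux w i ms

  firstReturn-aux : ∀ {n} (w : Vec (Fin n) n) (i : Fin n) (ms : List ℕ) → _ ≡ firstReturn w i ms
  firstReturn-aux w i []       = refl
  firstReturn-aux w i (m ∷ ms) with toℕ (iter w m i) ≡ᵇ toℕ i
  ... | true  = refl
  ... | false = firstReturn-aux w i ms

firstReturn-applyUpTo : ∀ {n} (w : Vec (Fin n) n) i (f : ℕ → ℕ) j N → j < N →
  iter w (f j) i ≡ i → (∀ x → x < j → iter w (f x) i ≢ i) → firstReturn w i (applyUpTo f N) ≡ f j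
firstReturn-applyUpTo w i f zero    (suc N) j<N hit miss rewrite hit | ≡ᵇ-refl (toℕ i) = refl
firstReturn-applyUpTo w i f (suc j) (suc N) (s≤s j<N) hit miss rewrite ≢⇒≡ᵇ (toℕ-≢ (miss 0 (s≤s z≤n))) =
  firstReturn-applyUpTo w i (f ∘ suc) j N j<N hit (λ x x<j → miss (suc x) (s≤s x<j))

-- The cycle length is suc L, not L.
IsCycleLength : ∀ {n} → Vec (Fin n) n → Fin n → ℕ → Set
IsCycleLength w i L = iter w (suc L) i ≡ i × (∀ x → x < L → iter w (suc x) i ≢ i)

iter-+ : ∀ {n} (w : Vec (Fin n) n) m l i → iter w (m ℕ.+ l) i ≡ iter w m (iter w l i)
iter-+ w zero    l i = refl
iter-+ w (suc m) l i = cong (lookup w) (iter-+ w m l i)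

iter-injective : ∀ {n} (w : Vec (Fin n) n) → IsPerm w → ∀ m {i j} → iter w m i ≡ iter w m j → i ≡ j
iter-injective w inj zero    e = e
iter-injective w inj (suc m) e = iter-injective w inj m (inj e)

least : (P : ℕ → Set) → (∀ m → Dec (P m)) → ∀ m → P m → ∃ λ l → l ≤ m × P l × (∀ x → x < l → ¬ P x)
least P P? m pm with P? 0
... | yes p0 = 0 , z≤n , p0 , λ _ ()
least P P? zero    pm | no ¬p0 = contradiction pm ¬p0
least P P? (suc m) pm | no ¬p0 with least (P ∘ suc) (P? ∘ suc) m pm
... | l , l≤m , pl , min = suc l , s≤s l≤m , pl , λ { zero _ → ¬p0 ; (suc x) (s≤s x<l) → min x x<l }

-- Two of the first `n + 1` iterates coincide, and injectivity cancels the earlier one to give a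
-- return to `i`. The least return is the cycle length.
cycleLength-exists : ∀ {n} (w : Vec (Fin n) n) → IsPerm w → ∀ i → ∃ λ L → L < n × IsCycleLength w i L
cycleLength-exists {n} w inj i with Fin.pigeonhole (ℕ.n<1+n n) (λ (x : Fin (suc n)) → iter w (toℕ x) i)
... | x , y , x<y , e with least (λ m → iter w (suc m) i ≡ i) (λ m → iter w (suc m) i Fin.≟ i) d returns
  where
  d : ℕ
  d = toℕ y ∸ suc (toℕ x)
  x+1+d≡y : toℕ x ℕ.+ suc d ≡ toℕ y
  x+1+d≡y = trans (ℕ.+-suc (toℕ x) d) (ℕ.m+[n∸m]≡n x<y)
  returns : iter w (suc d) i ≡ i
  returns = sym (iter-injective w inj (toℕ x) (trans e (trans (cong (λ m → iter w m i) (sym x+1+d≡y)) (iter-+ w (toℕ x) (suc d) i))))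
... | L , L≤d , ret , min = L , ℕ.≤-<-trans L≤d d<n , ret , min
  where
  d<n : toℕ y ∸ suc (toℕ x) < n
  d<n = ℕ.≤-trans (ℕ.∸-monoʳ-< {toℕ y} {suc (toℕ x)} {0} (s≤s z≤n) x<y) (ℕ.≤-pred (Fin.toℕ<n y))

isCycleLength-unique : ∀ {n} (w : Vec (Fin n) n) i {L L′} → IsCycleLength w i L → IsCycleLength w i L′ → L ≡ L′
isCycleLength-unique w i {L} {L′} (r , m) (r′ , m′) with ℕ.<-cmp L L′
... | tri< L<L′ _ _ = contradiction r (m′ L L<L′)
... | tri≈ _ e _    = e
... | tri> _ _ L′<L = contradiction r′ (m L′ L′<L)

cycleLength≡ : ∀ {n} (w : Vec (Fin n) n) → IsPerm w → ∀ i {L} → IsCycleLength w i L → cycleLength w i ≡ suc L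
cycleLength≡ {n} w inj i {L} isL with cycleLength-exists w inj i
... | L′ , L′<n , isL′ with refl ← isCycleLength-unique w i isL isL′ =
  trans (cycleLength-firstReturn w i) (trans (cong (firstReturn w i) (List.map-upTo suc n))
    (firstReturn-applyUpTo w i suc L n L′<n (proj₁ isL) (proj₂ isL)))

-- `isCycleMin` inspects the iterates below `n` only. An exponent that reaches `n` is lowered by one
-- full cycle, so these cover the orbit.
iter-bounded : ∀ {n} (w : Vec (Fin n) n) → IsPerm w → ∀ i m → ∃ λ m′ → m′ < n × iter w m i ≡ iter w m′ i
iter-bounded w inj i zero = 0 , ℕ.≤-<-trans z≤n (Fin.toℕ<n i) , refl
iter-bounded {n} w inj i (suc m) with iter-bounded w inj i m
... | m′ , m′<n , e with ℕ.m≤n⇒m<n∨m≡n m′<n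
...   | inj₁ 1+m′<n = suc m′ , 1+m′<n , cong (lookup w) e
...   | inj₂ 1+m′≡n with cycleLength-exists w inj i
...     | L , L<n , ret , _ = n ∸ suc L , ℕ.∸-monoʳ-< (s≤s z≤n) L<n , (begin
  lookup w (iter w m i)                 ≡⟨ cong (lookup w) e ⟩
  iter w (suc m′) i                     ≡⟨ cong (λ k → iter w k i) (trans 1+m′≡n (sym (ℕ.m∸n+n≡m L<n))) ⟩
  iter w ((n ∸ suc L) ℕ.+ suc L) i      ≡⟨ iter-+ w (n ∸ suc L) (suc L) i ⟩
  iter w (n ∸ suc L) (iter w (suc L) i) ≡⟨ cong (iter w (n ∸ suc L)) ret ⟩
  iter w (n ∸ suc L) i                  ∎)
  where open ≡-Reasoning

≤ᵇ⇒≤ : ∀ m n → (m ≤ᵇ n) ≡ true → m ≤ n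
≤ᵇ⇒≤ m n e = ℕ.≤ᵇ⇒≤ m n (Equivalence.from T-≡ e)

≤⇒≤ᵇ : ∀ {m n} → m ≤ n → (m ≤ᵇ n) ≡ true
≤⇒≤ᵇ m≤n = Equivalence.to T-≡ (ℕ.≤⇒≤ᵇ m≤n)

isCycleMin⁻ : ∀ {n} (w : Vec (Fin n) n) → IsPerm w → ∀ i → isCycleMin w i ≡ true → ∀ m → i Fin.≤ iter w m i
isCycleMin⁻ {n} w inj i e m with iter-bounded w inj i m
... | m′ , m′<n , eq = subst (i Fin.≤_) (sym eq) (≤ᵇ⇒≤ _ _ (all-∈ _ (upTo n) e (∈-upTo⁺ m′<n)))

isCycleMin⁺ : ∀ {n} (w : Vec (Fin n) n) i → (∀ m → i Fin.≤ iter w m i) → isCycleMin w i ≡ true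
isCycleMin⁺ {n} w i le = all-true _ (upTo n) (λ {m} _ → ≤⇒≤ᵇ (le m))

oddMin : ∀ {n} → Vec (Fin n) n → Fin n → Bool
oddMin w i = isCycleMin w i ∧ not (even (cycleLength w i))

∑-𝟙-filter-cong : ∀ {A : Set} (P Q : A → Bool) → (∀ x → P x ≡ Q x) → ∀ xs →
  length (filter (λ x → P x Bool.≟ true) xs) ≡ ∑ xs (𝟙 ∘ Q)
∑-𝟙-filter-cong P Q e xs = trans (length-filter P xs) (∑-cong xs (cong 𝟙 ∘ e))

mutual
  oddCycles-∑ : ∀ {n} (w : Vec (Fin n) n) → oddCycles w ≡ ∑ (allFin n) (𝟙 ∘ oddMin w)
  oddCycles-∑ {n} w = ∑-𝟙-filter-cong _ (oddMin w) (oddMin-aux w) (allFin n)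

  oddMin-aux : ∀ {n} (w : Vec (Fin n) n) (i : Fin n) → _ ≡ oddMin w i
  oddMin-aux w i with isCycleMin w i | cycleLength w i
  ... | b | m = cong (λ c → b ∧ not c) (even-aux w m)

  even-aux : ∀ {n} (w : Vec (Fin n) n) (m : ℕ) → _ ≡ even m
  even-aux w zero          = refl
  even-aux w (suc zero)    = refl
  even-aux w (suc (suc m)) = even-aux w m

-- The orbits of y and e y need to agree only if one of the two is a cycle minimum: otherwise neither is counted.
module Embed {n n′ : ℕ} (p : Vec (Fin n) n) (q : Vec (Fin n′) n′) (p-perm : IsPerm p) (q-perm : IsPerm q)
  (e : Fin n → Fin n′) (e-inj : Injective _≡_ _≡_ e)
  (e-mono : ∀ {x y} → x Fin.≤ y → e x Fin.≤ e y) (e-cancel : ∀ {x y} → e x Fin.≤ e y → x Fin.≤ y)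
  (y : Fin n)
  (sync-p : (∀ m → y Fin.≤ iter p m y) → ∀ m → iter q m (e y) ≡ e (iter p m y))
  (sync-q : (∀ m → e y Fin.≤ iter q m (e y)) → ∀ m → iter q m (e y) ≡ e (iter p m y)) where

  oddMin-embed : oddMin q (e y) ≡ oddMin p y
  oddMin-embed with isCycleMin p y in eq | isCycleMin q (e y) in eq′
  ... | false | false = refl
  ... | true  | false = contradiction (trans (sym eq′) (isCycleMin⁺ q (e y) λ m →
          subst (e y Fin.≤_) (sym (sync-p (isCycleMin⁻ p p-perm y eq) m)) (e-mono (isCycleMin⁻ p p-perm y eq m)))) λ ()
  ... | false | true  = contradiction (trans (sym eq) (isCycleMin⁺ p y λ m →
          e-cancel (subst (e y Fin.≤_) (sync-q (isCycleMin⁻ q q-perm (e y) eq′) m) (isCycleMin⁻ q q-perm (e y) eq′ m)))) λ ()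
  ... | true  | true  with cycleLength-exists p p-perm y
  ...   | L , _ , isL@(ret , min) = cong (not ∘ even) (trans (cycleLength≡ q q-perm (e y)
            (trans (sync (suc L)) (cong e ret) , λ x x<L eq → min x x<L (e-inj (trans (sym (sync (suc x))) eq))))
            (sym (cycleLength≡ p p-perm y isL)))
    where
    sync : ∀ m → iter q m (e y) ≡ e (iter p m y)
    sync = sync-p (isCycleMin⁻ p p-perm y eq)

module Fixed {n : ℕ} (w : Vec (Fin n) n) (perm : IsPerm w) where
  w⁺ : Vec (Fin (suc n)) (suc n)
  w⁺ = cons (zero , w)

  w⁺-isPerm : IsPerm w⁺
  w⁺-isPerm = cons-isPerm zero w perm

  iter-suc : ∀ m y → iter w⁺ m (suc y) ≡ suc (iter w m y)
  iter-suc zero    y = refl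
  iter-suc (suc m) y = trans (cong (lookup w⁺) (iter-suc m y)) (Vec.lookup-map (iter w m y) suc w)

  oddMin-suc : ∀ y → oddMin w⁺ (suc y) ≡ oddMin w y
  oddMin-suc y = Embed.oddMin-embed w w⁺ perm w⁺-isPerm suc Fin.suc-injective s≤s ℕ.≤-pred y
    (λ _ m → iter-suc m y) (λ _ m → iter-suc m y)

  cycleLength-zero : cycleLength w⁺ zero ≡ 1
  cycleLength-zero = cycleLength≡ w⁺ w⁺-isPerm zero {0} (refl , λ _ ())

-- In cycle notation `w⁺` is `w`, relabelled by `ι`, with `suc a` inserted right after `zero`.
module Inserted {k : ℕ} (a : Fin (suc k)) (w : Vec (Fin (suc k)) (suc k)) (perm : IsPerm w) where
  open Move a

  w⁺ : Vec (Fin (suc (suc k))) (suc (suc k))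
  w⁺ = cons (suc a , move w)

  w⁺-isPerm : IsPerm w⁺
  w⁺-isPerm = cons-isPerm (suc a) (move w) (move-isPerm w perm)

  ι : Fin (suc k) → Fin (suc (suc k))
  ι = punchIn (suc a)

  ι-inj : Injective _≡_ _≡_ ι
  ι-inj {x} {y} = Fin.punchIn-injective (suc a) x y

  lookup-a : lookup w⁺ (suc a) ≡ ι (lookup w zero)
  lookup-a = trans (Vec.lookup-map a ι (move w)) (cong ι (lookup-move w zero))

  lookup-ι : ∀ {y} → y ≢ zero → lookup w⁺ (ι y) ≡ ι (lookup w y)
  lookup-ι {zero}  y≢0 = contradiction refl y≢0
  lookup-ι {suc y} y≢0 = trans (Vec.lookup-map (punchIn a y) ι (move w)) (cong ι (lookup-move w (suc y)))

  -- The extra step is the visit to `suc a`. `lookup-ι` fails at `zero` only, so the agreement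
  -- reaches up to and including the first return.
  iter-zero : ∀ m → (∀ x → x < m → iter w (suc x) zero ≢ zero) → iter w⁺ (suc (suc m)) zero ≡ ι (iter w (suc m) zero)
  iter-zero zero    miss = lookup-a
  iter-zero (suc m) miss = trans (cong (lookup w⁺) (iter-zero m (λ x x<m → miss x (ℕ.m<n⇒m<1+n x<m)))) (lookup-ι (miss m ℕ.≤-refl))

  isCycleLength-zero : ∀ {L} → IsCycleLength w zero L → IsCycleLength w⁺ zero (suc L)
  isCycleLength-zero {L} (ret , min) = trans (iter-zero L min) (cong ι ret) , λ
    { zero    _         → λ ()
    ; (suc x) (s≤s x<L) → λ eq → min x x<L (ι-inj (trans (sym (iter-zero x (λ z z<x → min z (ℕ.<-trans z<x x<L)))) eq)) }

  even-cycleLength-zero : even (cycleLength w⁺ zero) ≡ not (even (cycleLength w zero))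
  even-cycleLength-zero with cycleLength-exists w perm zero
  ... | L , _ , isL = trans (cong even (cycleLength≡ w⁺ w⁺-isPerm zero (isCycleLength-zero isL)))
    (trans (even-suc (suc L)) (cong (not ∘ even) (sym (cycleLength≡ w perm zero isL))))

  1≰0 : ∀ {n} {z : Fin n} → ¬ (Fin.suc z Fin.≤ Fin.zero {n})
  1≰0 ()

  iter-a : ∀ {L} → IsCycleLength w zero L → iter w⁺ (suc L) (suc a) ≡ zero
  iter-a {L} isL = trans (sym (iter-+ w⁺ (suc L) 1 zero))
    (trans (cong (λ m → iter w⁺ m zero) (ℕ.+-comm (suc L) 1)) (proj₁ (isCycleLength-zero isL)))

  oddMin-a : oddMin w⁺ (suc a) ≡ false
  oddMin-a with isCycleMin w⁺ (suc a) in eq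
  ... | false = refl
  ... | true with cycleLength-exists w perm zero
  ...   | L , _ , isL = contradiction (subst (suc a Fin.≤_) (iter-a isL) (isCycleMin⁻ w⁺ w⁺-isPerm (suc a) eq (suc L))) 1≰0

  -- `avoid` receives the agreement reached so far: minimality in `w⁺` speaks about the orbit of
  -- `ι y`, and only through this agreement about that of `y`.
  sync : ∀ y → (∀ m → iter w⁺ m (ι y) ≡ ι (iter w m y) → iter w m y ≢ zero) → ∀ m → iter w⁺ m (ι y) ≡ ι (iter w m y)
  sync y avoid zero    = refl
  sync y avoid (suc m) = trans (cong (lookup w⁺) (sync y avoid m)) (lookup-ι (avoid m (sync y avoid m)))

  oddMin-ι : ∀ y → oddMin w⁺ (ι (suc y)) ≡ oddMin w (suc y)
  oddMin-ι y = Embed.oddMin-embed w w⁺ perm w⁺-isPerm ι ι-inj (Fin.punchIn-mono-≤ (suc a) _ _) (Fin.punchIn-cancel-≤ (suc a) _ _) (suc y)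
    (λ min → sync (suc y) (λ m _ hit → 1≰0 (subst (suc y Fin.≤_) hit (min m))))
    (λ min → sync (suc y) (λ m eq hit → 1≰0 (subst (ι (suc y) Fin.≤_) (trans eq (cong ι hit)) (min m))))

-- Counting permutations by odd cycles

zeroCycleEven : ∀ {k} → Vec (Fin (suc k)) (suc k) → Bool
zeroCycleEven w = even (cycleLength w zero)

otherOdd : ∀ {k} → Vec (Fin (suc k)) (suc k) → ℕ
otherOdd {k} w = ∑ (allFin k) (λ i → 𝟙 (oddMin w (suc i)))

oddCycles-split : ∀ {k} (w : Vec (Fin (suc k)) (suc k)) → oddCycles w ≡ 𝟙 (not (zeroCycleEven w)) ℕ.+ otherOdd w
oddCycles-split {k} w = trans (oddCycles-∑ w) (trans (∑-allFin-suc k (𝟙 ∘ oddMin w))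
  (cong (λ b → 𝟙 (b ∧ not (zeroCycleEven w)) ℕ.+ otherOdd w) (isCycleMin⁺ w zero (λ _ → z≤n))))

module OddCycles (N : ℕ) where
  weight : Bool → ℕ
  weight true  = 1
  weight false = N

  E : ℕ → ℕ
  E n = ∑ (Sym n) (λ w → N ℕ.^ oddCycles w)

  -- An insertion flips the parity of the cycle of `zero` and preserves the number of other odd
  -- cycles. With an arbitrary weight `c` for this parity, the flip is the passage to `c ∘ not`.
  marked : (Bool → ℕ) → ℕ → ℕ
  marked c k = ∑ (Sym (suc k)) (λ w → c (zeroCycleEven w) ℕ.* N ℕ.^ otherOdd w)

  E-marked : ∀ k → E (suc k) ≡ marked weight k
  E-marked k = ∑-cong (Sym (suc k)) λ w → trans (cong (N ℕ.^_) (oddCycles-split w)) (pow (zeroCycleEven w) (otherOdd w))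
    where
    pow : ∀ b o → N ℕ.^ (𝟙 (not b) ℕ.+ o) ≡ weight b ℕ.* N ℕ.^ o
    pow true  o = sym (ℕ.+-identityʳ _)
    pow false o = refl

  -- Either `zero` is fixed and its cycle has odd length 1, or its image is one of the `suc k`
  -- points that can be inserted.
  marked-suc : ∀ c k → marked c (suc k) ≡ c false ℕ.* E (suc k) ℕ.+ suc k ℕ.* marked (c ∘ not) k
  marked-suc c k = begin
    marked c (suc k)
      ≡⟨ ∑-Sym-suc (suc k) φ ⟩
    ∑ (allFin (suc (suc k))) (λ v → ∑ (Sym (suc k)) (λ w → φ (cons (v , w))))
      ≡⟨ ∑-allFin-suc (suc k) (λ v → ∑ (Sym (suc k)) (λ w → φ (cons (v , w)))) ⟩
    ∑ (Sym (suc k)) (λ w → φ (cons (zero , w))) ℕ.+ ∑ (allFin (suc k)) (λ a → ∑ (Sym (suc k)) (λ w → φ (cons (suc a , w))))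
      ≡⟨ cong₂ ℕ._+_ fixed (trans (∑-cong (allFin (suc k)) inserted) (trans (∑-const (allFin (suc k)) (marked (c ∘ not) k)) (cong (ℕ._* marked (c ∘ not) k) (List.length-tabulate {n = suc k} id)))) ⟩
    c false ℕ.* E (suc k) ℕ.+ suc k ℕ.* marked (c ∘ not) k ∎
    where
    open ≡-Reasoning
    φ : Vec (Fin (suc (suc k))) (suc (suc k)) → ℕ
    φ w = c (zeroCycleEven w) ℕ.* N ℕ.^ otherOdd w
    fixed : ∑ (Sym (suc k)) (λ w → φ (cons (zero , w))) ≡ c false ℕ.* E (suc k)
    fixed = trans (∑-cong-∈ (Sym (suc k)) (λ {w} w∈ → let open Fixed w (∈-Sym⁻ w∈) in
        cong₂ (λ b o → c b ℕ.* N ℕ.^ o) (cong even cycleLength-zero)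
          (trans (∑-cong (allFin (suc k)) (cong 𝟙 ∘ oddMin-suc)) (sym (oddCycles-∑ w)))))
      (∑-*ˡ (Sym (suc k)) (c false) (λ w → N ℕ.^ oddCycles w))
    inserted : ∀ a → ∑ (Sym (suc k)) (λ w → φ (cons (suc a , w))) ≡ marked (c ∘ not) k
    inserted a = trans (Move.∑-move a (λ w → φ (cons (suc a , w)))) (∑-cong-∈ (Sym (suc k)) (λ {w} w∈ → let open Inserted a w (∈-Sym⁻ w∈) in
        cong₂ (λ b o → c b ℕ.* N ℕ.^ o) even-cycleLength-zero
          (trans (∑-allFin-punchIn a (λ i → 𝟙 (oddMin w⁺ (suc i))))
            (cong₂ ℕ._+_ (cong 𝟙 oddMin-a) (∑-cong (allFin k) (cong 𝟙 ∘ oddMin-ι))))))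

  -- Under the flipped weight a fixed point weighs 1 and contributes one copy of `E`. For the
  -- insertions the second flip restores the original weight, and they contribute the remaining
  -- copies.
  marked-not : ∀ k → marked (weight ∘ not) k ≡ suc k ℕ.* E k
  marked-not zero    = refl
  marked-not (suc k) = trans (marked-suc (weight ∘ not) k) (cong₂ ℕ._+_ (ℕ.+-identityʳ (E (suc k)))
    (cong (suc k ℕ.*_) (trans (∑-cong (Sym (suc k)) (λ w → cong (λ b → b ℕ.* N ℕ.^ otherOdd w) (weight-not-not (zeroCycleEven w)))) (sym (E-marked k)))))
    where
    weight-not-not : ∀ b → weight (not (not b)) ≡ weight b
    weight-not-not true  = refl
    weight-not-not false = refl

  E-recurrence : ∀ k → E (suc (suc k)) ≡ N ℕ.* E (suc k) ℕ.+ suc k ℕ.* (suc k ℕ.* E k)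
  E-recurrence k = trans (E-marked (suc k)) (trans (marked-suc weight k) (cong (λ x → N ℕ.* E (suc k) ℕ.+ suc k ℕ.* x) (marked-not k)))

  E-one : E 1 ≡ N
  E-one = trans (ℕ.+-identityʳ (N ℕ.* 1)) (ℕ.*-identityʳ N)

-- The three-term recurrence of the Delannoy numbers

Delannoy-one : ∀ m → Delannoy m 1 ≡ suc (m ℕ.* 2)
Delannoy-one zero    = refl
Delannoy-one (suc m) rewrite Delannoy-one m | Delannoy-0 m | ℕ.+-comm (m ℕ.* 2) 1 = refl

-- For `F = (1+x)^m/(1-x)^(m+1)` this is the coefficient of `x^(n+1)` in `(1-x²)F′ = (2m+1+x)F`. It
-- is derived here from the defining recursion, by induction on `m` and `n`.
Delannoy-recurrence : ∀ m n →
  suc (suc n) ℕ.* Delannoy m (suc (suc n)) ≡ suc (m ℕ.* 2) ℕ.* Delannoy m (suc n) ℕ.+ suc n ℕ.* Delannoy m n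
Delannoy-recurrence zero n = solve 1 (λ n → (con 2 :+ n) :* con 1 := con 1 :* con 1 :+ (con 1 :+ n) :* con 1) refl n
  where open +-*-Solver
Delannoy-recurrence (suc m) zero = begin
  2 ℕ.* (p₁ ℕ.+ d₂ ℕ.+ d₁)
    ≡⟨ solve 3 (λ p d e → con 2 :* (p :+ d :+ e) := con 2 :* p :+ con 2 :* d :+ con 2 :* e) refl p₁ d₂ d₁ ⟩
  2 ℕ.* p₁ ℕ.+ 2 ℕ.* d₂ ℕ.+ 2 ℕ.* d₁
    ≡⟨ cong₂ (λ x y → 2 ℕ.* x ℕ.+ y ℕ.+ 2 ℕ.* d₁) (Delannoy-one (suc m)) (Delannoy-recurrence m 0) ⟩
  2 ℕ.* suc (suc m ℕ.* 2) ℕ.+ (suc (m ℕ.* 2) ℕ.* d₁ ℕ.+ 1 ℕ.* Delannoy m 0) ℕ.+ 2 ℕ.* d₁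
    ≡⟨ cong₂ (λ x y → 2 ℕ.* suc (suc m ℕ.* 2) ℕ.+ (suc (m ℕ.* 2) ℕ.* x ℕ.+ 1 ℕ.* y) ℕ.+ 2 ℕ.* x) (Delannoy-one m) (Delannoy-0 m) ⟩
  2 ℕ.* suc (suc m ℕ.* 2) ℕ.+ (suc (m ℕ.* 2) ℕ.* suc (m ℕ.* 2) ℕ.+ 1 ℕ.* 1) ℕ.+ 2 ℕ.* suc (m ℕ.* 2)
    ≡⟨ solve 1 (λ m → con 2 :* (con 1 :+ (con 1 :+ m) :* con 2) :+ ((con 1 :+ m :* con 2) :* (con 1 :+ m :* con 2) :+ con 1 :* con 1) :+ con 2 :* (con 1 :+ m :* con 2)
         := (con 1 :+ (con 1 :+ m) :* con 2) :* (con 1 :+ (con 1 :+ m) :* con 2) :+ con 1 :* con 1) refl m ⟩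
  suc (suc m ℕ.* 2) ℕ.* suc (suc m ℕ.* 2) ℕ.+ 1 ℕ.* 1
    ≡⟨ cong (λ x → suc (suc m ℕ.* 2) ℕ.* x ℕ.+ 1 ℕ.* 1) (Delannoy-one (suc m)) ⟨
  suc (suc m ℕ.* 2) ℕ.* p₁ ℕ.+ 1 ℕ.* 1 ∎
  where
  open ≡-Reasoning
  open +-*-Solver
  p₁ d₁ d₂ : ℕ
  p₁ = Delannoy (suc m) 1
  d₁ = Delannoy m 1
  d₂ = Delannoy m 2
Delannoy-recurrence (suc m) (suc n) = begin
  (3 ℕ.+ n) ℕ.* (p₂ ℕ.+ d₃ ℕ.+ d₂)
    ≡⟨ solve 4 (λ n p d e → (con 3 :+ n) :* (p :+ d :+ e) := (con 2 :+ n) :* p :+ (con 3 :+ n) :* d :+ (p :+ (con 3 :+ n) :* e)) refl n p₂ d₃ d₂ ⟩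
  (2 ℕ.+ n) ℕ.* p₂ ℕ.+ (3 ℕ.+ n) ℕ.* d₃ ℕ.+ (p₂ ℕ.+ (3 ℕ.+ n) ℕ.* d₂)
    ≡⟨ cong₂ (λ x y → x ℕ.+ y ℕ.+ (p₂ ℕ.+ (3 ℕ.+ n) ℕ.* d₂)) (Delannoy-recurrence (suc m) n) (Delannoy-recurrence m (suc n)) ⟩
  ((3 ℕ.+ c) ℕ.* p₁ ℕ.+ suc n ℕ.* p₀) ℕ.+ (suc c ℕ.* d₂ ℕ.+ (2 ℕ.+ n) ℕ.* d₁) ℕ.+ ((p₀ ℕ.+ d₁ ℕ.+ d₀ ℕ.+ d₂ ℕ.+ d₁) ℕ.+ (3 ℕ.+ n) ℕ.* d₂)
    ≡⟨ solve 7 (λ c n p₁ p₀ d₀ d₁ d₂ →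
         ((con 3 :+ c) :* p₁ :+ (con 1 :+ n) :* p₀) :+ ((con 1 :+ c) :* d₂ :+ (con 2 :+ n) :* d₁) :+ ((p₀ :+ d₁ :+ d₀ :+ d₂ :+ d₁) :+ (con 3 :+ n) :* d₂)
         := ((con 3 :+ c) :* p₁ :+ (con 2 :+ n) :* p₀ :+ (con 3 :+ c) :* d₂ :+ (con 4 :+ n) :* d₁ :+ d₀) :+ (con 2 :+ n) :* d₂)
         refl c n p₁ p₀ d₀ d₁ d₂ ⟩
  -- `(2 + n) d₂` is split off because it is the left side of the recurrence at `m` and `n`.
  X ℕ.+ (2 ℕ.+ n) ℕ.* d₂
    ≡⟨ cong (X ℕ.+_) (Delannoy-recurrence m n) ⟩
  X ℕ.+ (suc c ℕ.* d₁ ℕ.+ suc n ℕ.* d₀)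
    ≡⟨ solve 7 (λ c n p₁ p₀ d₀ d₁ d₂ →
         ((con 3 :+ c) :* p₁ :+ (con 2 :+ n) :* p₀ :+ (con 3 :+ c) :* d₂ :+ (con 4 :+ n) :* d₁ :+ d₀) :+ ((con 1 :+ c) :* d₁ :+ (con 1 :+ n) :* d₀)
         := (con 3 :+ c) :* (p₁ :+ d₂ :+ d₁) :+ (con 2 :+ n) :* (p₀ :+ d₁ :+ d₀))
         refl c n p₁ p₀ d₀ d₁ d₂ ⟩
  (3 ℕ.+ c) ℕ.* p₂ ℕ.+ (2 ℕ.+ n) ℕ.* p₁ ∎
  where
  open ≡-Reasoning
  open +-*-Solver
  c p₀ p₁ p₂ d₀ d₁ d₂ d₃ X : ℕ
  c = m ℕ.* 2
  p₀ = Delannoy (suc m) n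
  p₁ = Delannoy (suc m) (suc n)
  p₂ = Delannoy (suc m) (suc (suc n))
  d₀ = Delannoy m n
  d₁ = Delannoy m (suc n)
  d₂ = Delannoy m (suc (suc n))
  d₃ = Delannoy m (suc (suc (suc n)))
  X = (3 ℕ.+ c) ℕ.* p₁ ℕ.+ (2 ℕ.+ n) ℕ.* p₀ ℕ.+ (3 ℕ.+ c) ℕ.* d₂ ℕ.+ (4 ℕ.+ n) ℕ.* d₁ ℕ.+ d₀

oddCycles-Delannoy : ∀ m n → ∑ (Sym n) (λ w → suc (m ℕ.* 2) ℕ.^ oddCycles w) ≡ n ! ℕ.* Delannoy m n
oddCycles-Delannoy m zero = sym (trans (ℕ.+-identityʳ (Delannoy m 0)) (Delannoy-0 m))
oddCycles-Delannoy m (suc zero) = trans (OddCycles.E-one (suc (m ℕ.* 2))) (sym (trans (ℕ.+-identityʳ (Delannoy m 1)) (Delannoy-one m)))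
oddCycles-Delannoy m (suc (suc k)) = begin
  E (suc (suc k))
    ≡⟨ E-recurrence k ⟩
  N ℕ.* E (suc k) ℕ.+ suc k ℕ.* (suc k ℕ.* E k)
    ≡⟨ cong₂ (λ x y → N ℕ.* x ℕ.+ suc k ℕ.* (suc k ℕ.* y)) (oddCycles-Delannoy m (suc k)) (oddCycles-Delannoy m k) ⟩
  N ℕ.* (suc k ℕ.* k ! ℕ.* d₁) ℕ.+ suc k ℕ.* (suc k ℕ.* (k ! ℕ.* d₀))
    ≡⟨ solve 5 (λ N s f d₁ d₀ → N :* (s :* f :* d₁) :+ s :* (s :* (f :* d₀)) := (s :* f) :* (N :* d₁ :+ s :* d₀)) refl N (suc k) (k !) d₁ d₀ ⟩
  (suc k ℕ.* k !) ℕ.* (N ℕ.* d₁ ℕ.+ suc k ℕ.* d₀)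
    ≡⟨ cong ((suc k ℕ.* k !) ℕ.*_) (Delannoy-recurrence m k) ⟨
  (suc k ℕ.* k !) ℕ.* (suc (suc k) ℕ.* d₂)
    ≡⟨ solve 3 (λ g t d → g :* (t :* d) := t :* g :* d) refl (suc k ℕ.* k !) (suc (suc k)) d₂ ⟩
  suc (suc k) ! ℕ.* d₂ ∎
  where
  open ≡-Reasoning
  open +-*-Solver
  N d₀ d₁ d₂ : ℕ
  N = suc (m ℕ.* 2)
  d₀ = Delannoy m k
  d₁ = Delannoy m (suc k)
  d₂ = Delannoy m (suc (suc k))
  open OddCycles N

-- Comparison of coefficients

sumℚ-cong-∈ : ∀ {A : Set} (xs : List A) {f g : A → ℚ} → (∀ {x} → x ∈ xs → f x ≡ g x) → sumℚ (map f xs) ≡ sumℚ (map g xs)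
sumℚ-cong-∈ []       e = refl
sumℚ-cong-∈ (x ∷ xs) e = cong₂ ℚ._+_ (e (here refl)) (sumℚ-cong-∈ xs (e ∘ there))

G-lpk : ∀ {m} (w : Vec (Fin (suc m)) (suc m)) → IsPerm w → ∀ i →
  G (suc m) (lpk w) i ≡ fromℕ (chains (true ∷ ascents _<F_ w) (i ℕ.* 2))
G-lpk {m} w perm i = trans (cong₂ (λ n p → G (suc n) p i) (sym (length-ascents _<F_ w)) (lpk-peaks w perm))
                           (G-coeff (ascents _<F_ w) i)

LHS-Delannoy : ∀ m i j → LHS (suc m) i j ≡ fromℕ (Delannoy (μ i j) (suc m))
LHS-Delannoy m i j = begin
  LHS (suc m) i j
    ≡⟨ LHS-coeff (suc m) i j ⟩
  sumℚ (map (λ w → G (suc m) (lpk w) i ℚ.* G (suc m) (ilpk w) j) (Sym (suc m)))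
    ≡⟨ sumℚ-cong-∈ (Sym (suc m)) (λ {w} w∈ → trans
         (cong₂ ℚ._*_ (G-lpk w (∈-Sym⁻ w∈) i) (G-lpk (inverse w) (inverse-isPerm w (∈-Sym⁻ w∈)) j))
         (sym (fromℕ-homo-* (a w) (b w)))) ⟩
  sumℚ (map (λ w → fromℕ (a w ℕ.* b w)) (Sym (suc m)))
    ≡⟨ fromℕ-sum (λ w → a w ℕ.* b w) (Sym (suc m)) ⟨
  fromℕ (∑ (Sym (suc m)) (λ w → a w ℕ.* b w))
    ≡⟨ cong fromℕ (two-sided-count m i j) ⟩
  fromℕ (Delannoy (μ i j) (suc m)) ∎
  where
  open ≡-Reasoning
  a b : Vec (Fin (suc m)) (suc m) → ℕ
  a w = chains (true ∷ ascents _<F_ w) (i ℕ.* 2)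
  b w = chains (true ∷ ascents _<F_ (inverse w)) (j ℕ.* 2)

∑<-delta : ∀ n v (g : ℕ → ℕ) → v < n → ∑< n (λ k → 𝟙 (v ≡ᵇ k) ℕ.* g k) ≡ g v
∑<-delta (suc n) v g (s≤s v≤n) with ℕ.m≤n⇒m<n∨m≡n v≤n
... | inj₁ v<n rewrite ≢⇒≡ᵇ (ℕ.<⇒≢ v<n) = trans (ℕ.+-identityʳ _) (∑<-delta n v g v<n)
... | inj₂ refl rewrite ≡ᵇ-refl v = trans (cong₂ ℕ._+_ (zeros v ℕ.≤-refl) (ℕ.+-identityʳ (g v))) refl
  where
  zeros : ∀ n → n ≤ v → ∑< n (λ k → 𝟙 (v ≡ᵇ k) ℕ.* g k) ≡ 0
  zeros zero    n≤v = refl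
  zeros (suc n) n<v rewrite ≢⇒≡ᵇ (ℕ.<⇒≢ n<v ∘ sym) = trans (ℕ.+-identityʳ _) (zeros n (ℕ.<⇒≤ n<v))

∑-upTo : ∀ n (f : ℕ → ℕ) → ∑ (upTo n) f ≡ ∑< n f
∑-upTo zero    f = refl
∑-upTo (suc n) f = trans (∑-upTo-suc n f) (trans (cong (f 0 ℕ.+_) (∑-upTo n (f ∘ suc))) (sym (∑<-sucˡ n f)))

length-filter-≟ : ∀ {A : Set} (f : A → ℕ) k x xs →
  length (filter (λ w → f w ℕ.≟ k) (x ∷ xs)) ≡ 𝟙 (f x ≡ᵇ k) ℕ.+ length (filter (λ w → f w ℕ.≟ k) xs)
length-filter-≟ f k x xs with f x ≡ᵇ k
... | true  = refl
... | false = refl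

-- Turns the sum over `k` in (c), whose terms carry the sizes `e n k` of the fibres, into a sum over
-- permutations. The bound on `f` ensures that every permutation lies in one of the fibres.
∑-fibres : ∀ {A : Set} (xs : List A) n (f : A → ℕ) (g : ℕ → ℕ) → (∀ x → f x ≤ n) →
  ∑ (upTo (suc n)) (λ k → length (filter (λ w → f w ℕ.≟ k) xs) ℕ.* g k) ≡ ∑ xs (g ∘ f)
∑-fibres []       n f g f≤n = ∑-zero (upTo (suc n))
∑-fibres (x ∷ xs) n f g f≤n = begin
  ∑ (upTo (suc n)) (λ k → length (filter (λ w → f w ℕ.≟ k) (x ∷ xs)) ℕ.* g k)
    ≡⟨ ∑-cong (upTo (suc n)) (λ k → trans (cong (ℕ._* g k) (length-filter-≟ f k x xs)) (ℕ.*-distribʳ-+ (g k) (𝟙 (f x ≡ᵇ k)) _)) ⟩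
  ∑ (upTo (suc n)) (λ k → 𝟙 (f x ≡ᵇ k) ℕ.* g k ℕ.+ length (filter (λ w → f w ℕ.≟ k) xs) ℕ.* g k)
    ≡⟨ ∑-+ (upTo (suc n)) (λ k → 𝟙 (f x ≡ᵇ k) ℕ.* g k) (λ k → length (filter (λ w → f w ℕ.≟ k) xs) ℕ.* g k) ⟩
  ∑ (upTo (suc n)) (λ k → 𝟙 (f x ≡ᵇ k) ℕ.* g k) ℕ.+ ∑ (upTo (suc n)) (λ k → length (filter (λ w → f w ℕ.≟ k) xs) ℕ.* g k)
    ≡⟨ cong₂ ℕ._+_ (trans (∑-upTo (suc n) _) (∑<-delta (suc n) (f x) g (s≤s (f≤n x)))) (∑-fibres xs n f g f≤n) ⟩
  g (f x) ℕ.+ ∑ xs (g ∘ f) ∎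
  where open ≡-Reasoning

oddCycles≤n : ∀ {n} (w : Vec (Fin n) n) → oddCycles w ≤ n
oddCycles≤n {n} w = begin
  oddCycles w                      ≡⟨ oddCycles-∑ w ⟩
  ∑ (allFin n) (𝟙 ∘ oddMin w)      ≤⟨ ∑-mono-≤ (allFin n) (𝟙≤1 ∘ oddMin w) ⟩
  ∑ (allFin n) (λ _ → 1)           ≡⟨ ∑-const (allFin n) 1 ⟩
  length (allFin n) ℕ.* 1          ≡⟨ ℕ.*-identityʳ _ ⟩
  length (allFin n)                ≡⟨ List.length-tabulate id ⟩
  n                                ∎
  where open ℕ.≤-Reasoning

1/d*d : ∀ d .{{_ : NonZero d}} → (+ 1 / d) ℚ.* fromℕ d ≡ 1ℚ
1/d*d (suc d) = ℚ.toℚᵘ-injective (begin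
  ℚ.toℚᵘ ((+ 1 / suc d) ℚ.* fromℕ (suc d))                ≈⟨ ℚ.toℚᵘ-homo-* (+ 1 / suc d) (fromℕ (suc d)) ⟩
  ℚ.toℚᵘ (+ 1 / suc d) ℚᵘ.* ℚ.toℚᵘ (fromℕ (suc d))        ≈⟨ ℚᵘ.*-cong (ℚ.toℚᵘ-fromℚᵘ (ℚᵘ.mkℚᵘ (+ 1) d)) (ℚ.toℚᵘ-fromℚᵘ (ℚᵘ.mkℚᵘ (+ suc d) 0)) ⟩
  ℚᵘ.mkℚᵘ (+ 1) d ℚᵘ.* ℚᵘ.mkℚᵘ (+ suc d) 0                ≈⟨ ℚᵘ.*≡* (cong +_ (solve 1 (λ d → (con 1 :* (con 1 :+ d)) :* con 1 := con 1 :* ((con 1 :+ d) :* con 1)) refl d)) ⟩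
  ℚ.toℚᵘ 1ℚ                                               ∎)
  where
  open ℚᵘ.≃-Reasoning
  open +-*-Solver

-- Since (2i+1)(2j+1) = 2μ + 1, each permutation contributes 2μ + 1 to the power of its number of
-- odd cycles. These contributions add up to `n !` times a Delannoy number, and the prefactor
-- cancels `n !`.
RHSc-Delannoy : ∀ n i j → RHSc n i j ≡ fromℕ (Delannoy (μ i j) n)
RHSc-Delannoy n i j = begin
  RHSc n i j
    ≡⟨ RHSc-coeff n i j ⟩
  1/n! ℚ.* sumℚ (map (λ k → fromℕ (e n k) ℚ.* (fromℕ (a ℕ.^ k) ℚ.* fromℕ (b ℕ.^ k))) (upTo (suc n)))
    ≡⟨ cong (1/n! ℚ.*_) (sumℚ-cong (λ k → trans (cong (fromℕ (e n k) ℚ.*_) (trans (sym (fromℕ-homo-* (a ℕ.^ k) (b ℕ.^ k))) (cong fromℕ (power k))))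
         (sym (fromℕ-homo-* (e n k) (N ℕ.^ k)))) (upTo (suc n))) ⟩
  1/n! ℚ.* sumℚ (map (λ k → fromℕ (e n k ℕ.* N ℕ.^ k)) (upTo (suc n)))
    ≡⟨ cong (1/n! ℚ.*_) (fromℕ-sum (λ k → e n k ℕ.* N ℕ.^ k) (upTo (suc n))) ⟨
  1/n! ℚ.* fromℕ (∑ (upTo (suc n)) (λ k → e n k ℕ.* N ℕ.^ k))
    ≡⟨ cong (λ x → 1/n! ℚ.* fromℕ x) (trans (∑-fibres (Sym n) n oddCycles (N ℕ.^_) oddCycles≤n) (oddCycles-Delannoy (μ i j) n)) ⟩
  1/n! ℚ.* fromℕ (n ! ℕ.* D)
    ≡⟨ cong (1/n! ℚ.*_) (fromℕ-homo-* (n !) D) ⟩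
  1/n! ℚ.* (fromℕ (n !) ℚ.* fromℕ D)
    ≡⟨ ℚ.*-assoc 1/n! (fromℕ (n !)) (fromℕ D) ⟨
  1/n! ℚ.* fromℕ (n !) ℚ.* fromℕ D
    ≡⟨ cong (ℚ._* fromℕ D) (1/d*d (n !) ⦃ n !≢0 ⦄) ⟩
  1ℚ ℚ.* fromℕ D
    ≡⟨ ℚ.*-identityˡ (fromℕ D) ⟩
  fromℕ D ∎
  where
  open ≡-Reasoning
  a b N D : ℕ
  a = 2 ℕ.* i ℕ.+ 1
  b = 2 ℕ.* j ℕ.+ 1
  N = suc (μ i j ℕ.* 2)
  D = Delannoy (μ i j) n
  1/n! : ℚ
  1/n! = (+ 1 / (n !)) ⦃ n !≢0 ⦄
  ab≡N : a ℕ.* b ≡ N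
  ab≡N = solve 2 (λ i j → (con 2 :* i :+ con 1) :* (con 2 :* j :+ con 1) := con 1 :+ (con 2 :* i :* j :+ i :+ j) :* con 2) refl i j
    where open +-*-Solver
  power : ∀ k → a ℕ.^ k ℕ.* b ℕ.^ k ≡ N ℕ.^ k
  power zero    = refl
  power (suc k) = trans (interchange a (a ℕ.^ k) b (b ℕ.^ k)) (cong₂ ℕ._*_ ab≡N (power k))
    where open import Algebra.Properties.CommutativeSemigroup ℕ.*-commutativeSemigroup using (interchange)

theorem4p3 : ((∀ i j → P2.inv ((P2.const 1ℚ P2.- P2.s) P2.* (P2.const 1ℚ P2.- P2.t)) i j ≡ RHSaCoeff (μ i j) 0)
    × (∀ n → 1 ≤ n → ∀ i j → LHS n i j ≡ RHSaCoeff (μ i j) n))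
    × (∀ n → 1 ≤ n → ∀ i j → LHS n i j ≡ RHSb n i j)
    × (∀ n → 1 ≤ n → ∀ i j → LHS n i j ≡ RHSc n i j)
theorem4p3 =
    -- The constant term in x: every coefficient of `1/((1-s)(1-t))` is 1, as is every
    -- `Delannoy m 0`.
    ( (λ i j → trans (inv-[1-s][1-t] i j) (sym (trans (RHSaCoeff-Delannoy (μ i j) 0) (cong fromℕ (Delannoy-0 (μ i j))))))
    , λ { (suc m) _ i j → trans (LHS-Delannoy m i j) (sym (RHSaCoeff-Delannoy (μ i j) (suc m))) })
  , (λ { (suc m) _ i j → trans (LHS-Delannoy m i j) (sym (RHSb-Delannoy (suc m) i j)) })
  , (λ { (suc m) _ i j → trans (LHS-Delannoy m i j) (sym (RHSc-Delannoy (suc m) i j)) })
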